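{- Let $r\ge 3$, let $e\ge 3$ be an odd integer, $q=2^e$, let $\mathcal{V}^r_\varepsilon\subset\mathrm{PG}(r,q^2)$ be the hypersurface defined in the context, and let $j\ge 1$ be an integer. Let $\overline{\mathcal{V}^r_\varepsilon}$ be the multiset of points of $\mathrm{PG}(r,q^2)$ consisting of the points of $\mathcal{V}^r_\varepsilon\setminus\Pi_\infty$ (each with multiplicity one) together with the point $P_\infty=(0,0,\dots,0,1)$ with multiplicity $j$. Then the linear code associated with $\overline{\mathcal{V}^r_\varepsilon}$ is a $[q^{2r-1}+j,\,r+1]_{q^2}$ code with (non-zero) weights $$q^{2r-1},\quad q^{2r-1}-q^{2r-3},\quad q^{2r-1}-q^{2r-3}+(-1)^{r-1}q^{r-2}+j,$$ $$q^{2r-1}-q^{2r-3}+(-1)^{r-1}q^{r-2}-(-1)^{r-1}q^{r-1}+j.$$ Furthermore, it is a $3$-weight code (i.e. it has exactly three distinct non-zero weights) in the following cases: (i) $r$ odd and $j=q^{r-1}-q^{r-2}$, or $j=q^{2r-3}-q^{r-2}$, or $j=q^{2r-3}+q^{r-1}-q^{r-2}$; (ii) $r$ even and $j=q^{r-2}$, or $j=q^{2r-3}+q^{r-2}$, or $j=q^{2r-3}-q^{r-1}+q^{r-2}$.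
   Context: Let $e\ge 3$ be odd, $q=2^e$, $r\ge 2$. Points of $\mathrm{PG}(r,q^2)$ (projective space of projective dimension $r$ over $\mathbb{F}_{q^2}$) have homogeneous coordinates $(X_0,\dots,X_r)$; $\Pi_\infty$ is the hyperplane $X_0=0$, and affine coordinates on the complement $\mathrm{AG}(r,q^2)$ are $x_i=X_i/X_0$. For an exponent involving $\sigma$, $\sigma$ stands for $2^{(e+1)/2}$, i.e. $x^{\sigma}=x^{2^{(e+1)/2}}$ and $x^{\sigma+2}=x^{2^{(e+1)/2}+2}$. Fix $\varepsilon\in\mathbb{F}_{q^2}\setminus\mathbb{F}_q$ such that $\varepsilon^2+\varepsilon+\delta=0$ for some $\delta\in\mathbb{F}_q\setminus\{1\}$ with absolute trace $\mathrm{Tr}_{q/2}(\delta)=\sum_{i=0}^{e-1}\delta^{2^i}=1$. Put $$\Gamma_{\varepsilon}(x)=[x+(x^q+x)\varepsilon]^{\sigma+2}+(x^q+x)^{\sigma}+(x^{2q}+x^2)\varepsilon+x^{q+1}+x^2.$$ $\mathcal{V}^r_\varepsilon$ is the projective hypersurface of $\mathrm{PG}(r,q^2)$ with affine equation $x_r^q+x_r=\Gamma_{\varepsilon}(x_1)+\dots+\Gamma_{\varepsilon}(x_{r-1})$, i.e. the zero locus of the homogenization (with respect to $X_0$) of the corresponding polynomial; it is identified with its set of $\mathbb{F}_{q^2}$-rational points. The linear code associated with a multiset of $N$ points (counted with multiplicity) of $\mathrm{PG}(r,q^2)$ is the linear code of length $N$ over $\mathbb{F}_{q^2}$ spanned by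 the rows of an $(r+1)\times N$ matrix whose columns are coordinate vectors of the points of the multiset, each point repeated according to its multiplicity; it is unique up to monomial equivalence. An $[N,k]_{q^2}$ code is a linear code over $\mathbb{F}_{q^2}$ of length $N$ and dimension $k$. Weights are Hamming weights of non-zero codewords. -}

module Defs where

open import Level using (0ℓ)
open import Algebra.Bundles using (CommutativeRing; Semiring)
open import Algebra.Structures using (IsCommutativeRing)
import Algebra.Definitions.RawSemiring as RawSemiringDefs
import Algebra.Properties.CommutativeMonoid.Sum as CMSum
import Algebra.Properties.Semiring.Sum as SemiringSum
open import Data.Bool using (if_then_else_)
open import Data.Fin using (Fin; zero; suc; toℕ; fromℕ; inject₁)
import Data.Fin.Properties as Fin
open import Data.Integer as ℤ using (ℤ)
open import Data.List using (List; length; filter; allFin)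
open import Data.List.Membership.Propositional using (_∈_)
open import Data.List.Relation.Unary.Unique.Propositional using (Unique)
open import Data.Nat as ℕ using (ℕ; _⊔_; _∸_)
open import Data.Product using (_×_; _,_; proj₁; ∃)
import Data.Vec.Functional as Vector
open Vector using (Vector)
open import Function using (_∘_)
open import Function.Bundles using (_↔_; _⇔_; Inverse)
open import Function.Properties.Inverse using (↔⇒↣)
open import Relation.Binary using (DecidableEquality)
open import Relation.Binary.PropositionalEquality
open import Relation.Nullary using (Dec; ¬_; ¬?; does)
open import Relation.Nullary.Decidable using (map′; via-injection; dec-true; _×-dec_)
open import Relation.Unary using (Decidable)

record FiniteField (n : ℕ) : Set₁ where
  infixl 6 _+_
  infixl 7 _*_
  infix 8 -_
  field
    Carrier           : Set
    _+_ _*_           : Carrier → Carrier → Carrier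
    -_                : Carrier → Carrier
    0# 1#             : Carrier
    isCommutativeRing : IsCommutativeRing _≡_ _+_ _*_ -_ 0# 1#
    0≢1               : 0# ≢ 1#
    inverse           : ∀ x → x ≢ 0# → ∃ λ y → x * y ≡ 1#
    enumeration       : Carrier ↔ Fin n

  commutativeRing : CommutativeRing 0ℓ 0ℓ
  commutativeRing = record { isCommutativeRing = isCommutativeRing }

  open CommutativeRing commutativeRing public
    using (semiring; +-commutativeMonoid)
  open RawSemiringDefs (Semiring.rawSemiring semiring) public using (_^_; sum)

  _≟_ : DecidableEquality Carrier
  _≟_ = via-injection (↔⇒↣ enumeration) Fin._≟_

  any? : {P : Carrier → Set} → Decidable P → Dec (∃ P)
  any? {P} P? = map′
    (λ (i , p) → Inverse.from enumeration i , p)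
    (λ (x , p) → Inverse.to enumeration x ,
                 subst P (sym (Inverse.strictlyInverseʳ enumeration x)) p)
    (Fin.any? (λ i → P? (Inverse.from enumeration i)))

count : ∀ {n} {P : Fin n → Set} → Decidable P → ℕ
count {n} P? = length (filter P? (allFin n))

module _ {n : ℕ} (K : FiniteField n) where
  open FiniteField K

  data Poly (m : ℕ) : Set where
    con     : Carrier → Poly m
    var     : Fin m → Poly m
    _⊕_ _⊗_ : Poly m → Poly m → Poly m
    _↑_     : Poly m → ℕ → Poly m

  infixl 6 _⊕_
  infixl 7 _⊗_
  infixr 8 _↑_

  eval : ∀ {m} → Poly m → Vector Carrier m → Carrier
  eval (con c) x = c
  eval (var i) x = x i
  eval (f ⊕ g) x = eval f x + eval g x
  eval (f ⊗ g) x = eval f x * eval g x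
  eval (f ↑ k) x = eval f x ^ k

  -- Formal degree of an expression.  It is the true degree as long as the
  -- terms of top formal degree do not cancel.
  degree : ∀ {m} → Poly m → ℕ
  degree (con c) = 0
  degree (var i) = 1
  degree (f ⊕ g) = degree f ⊔ degree g
  degree (f ⊗ g) = degree f ℕ.+ degree g
  degree (f ↑ k) = k ℕ.* degree f

  -- For d ≥ degree f, the form X₀ᵈ · f(X₁/X₀, …, Xₘ/X₀); the affine variable
  -- with index i becomes the homogeneous variable with index suc i, and
  -- index zero is X₀.
  homogenizeTo : ∀ {m} → ℕ → Poly m → Poly (ℕ.suc m)
  homogenizeTo d (con c) = con c ⊗ var zero ↑ d
  homogenizeTo d (var i) = var (suc i) ⊗ var zero ↑ (d ∸ 1)
  homogenizeTo d (f ⊕ g) = homogenizeTo d f ⊕ homogenizeTo d g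
  homogenizeTo d (f ⊗ g) =
    homogenizeTo (degree f) f ⊗ homogenizeTo (degree g) g
      ⊗ var zero ↑ (d ∸ (degree f ℕ.+ degree g))
  homogenizeTo d (f ↑ k) =
    homogenizeTo (degree f) f ↑ k ⊗ var zero ↑ (d ∸ k ℕ.* degree f)

  homogenization : ∀ {m} → Poly m → Poly (ℕ.suc m)
  homogenization f = homogenizeTo (degree f) f

  -- A point of PG(r, K), given by a vector of homogeneous coordinates
  -- X₀, …, Xᵣ; equality of points is _∼_.
  Point : ℕ → Set
  Point r = ∃ λ (X : Vector Carrier (ℕ.suc r)) → ∃ λ i → X i ≢ 0#

  coords : ∀ {r} → Point r → Vector Carrier (ℕ.suc r)
  coords = proj₁

  infix 4 _∼_ _∼?_

  _∼_ : ∀ {r} → Point r → Point r → Set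
  P ∼ Q = ∃ λ c → c ≢ 0# × (∀ i → coords Q i ≡ c * coords P i)

  _∼?_ : ∀ {r} (P Q : Point r) → Dec (P ∼ Q)
  P ∼? Q = any? λ c →
    ¬? (c ≟ 0#) ×-dec Fin.all? (λ i → coords Q i ≟ (c * coords P i))

  AtInfinity : ∀ {r} → Point r → Set
  AtInfinity P = coords P zero ≡ 0#

  AtInfinity? : ∀ {r} → Decidable (AtInfinity {r})
  AtInfinity? P = coords P zero ≟ 0#

  Zero : ∀ {r} → Poly (ℕ.suc r) → Point r → Set
  Zero F P = eval F (coords P) ≡ 0#

  P∞ : ∀ r → Point r
  P∞ r = (λ i → if does (i Fin.≟ fromℕ r) then 1# else 0#) , fromℕ r , nonzero
    where
    nonzero : (if does (fromℕ r Fin.≟ fromℕ r) then 1# else 0#) ≢ 0#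
    nonzero rewrite dec-true (fromℕ r Fin.≟ fromℕ r) refl = 0≢1 ∘ sym

  -- The subfield with q elements is the set of x with x ^ q ≡ x.
  InSubfield : ℕ → Carrier → Set
  InSubfield q x = x ^ q ≡ x

  record IsParameter (e : ℕ) (ε : Carrier) : Set where
    field
      ε∉𝔽q  : ¬ InSubfield (2 ℕ.^ e) ε
      δ     : Carrier
      δ∈𝔽q  : InSubfield (2 ℕ.^ e) δ
      δ≢1   : δ ≢ 1#
      trace : sum {e} (λ i → δ ^ (2 ℕ.^ toℕ i)) ≡ 1#
      root  : ε ^ 2 + ε + δ ≡ 0#

  Γ : ∀ {m} → ℕ → Carrier → Poly m → Poly m
  Γ e ε x =
      (x ⊕ (x ↑ q ⊕ x) ⊗ con ε) ↑ (σ ℕ.+ 2)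
    ⊕ (x ↑ q ⊕ x) ↑ σ
    ⊕ (x ↑ (2 ℕ.* q) ⊕ x ↑ 2) ⊗ con ε
    ⊕ x ↑ (q ℕ.+ 1)
    ⊕ x ↑ 2
    where
    q = 2 ℕ.^ e
    σ = 2 ℕ.^ ((e ℕ.+ 1) ℕ./ 2)

  -- xᵣ^q + xᵣ − (Γ(x₁) + … + Γ(xᵣ₋₁)), where xᵢ is the variable with index
  -- i − 1.  Only r ≥ 1 is meaningful.  For r ≥ 2 the formal degree is
  -- q (σ + 2), and ε ^ (σ + 2) ≢ 0 is up to sign the coefficient of
  -- x₁^(q (σ + 2)), so the formal degree is the true one.
  affinePolynomial : ∀ r → ℕ → Carrier → Poly r
  affinePolynomial ℕ.zero      e ε = con 0#
  affinePolynomial (ℕ.suc r-1) e ε =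
    (xᵣ ↑ (2 ℕ.^ e) ⊕ xᵣ) ⊕ con (- 1#) ⊗ ΣΓ
    where
    xᵣ = var (fromℕ r-1)
    ΣΓ = Vector.foldr _⊕_ (con 0#) {r-1} (λ i → Γ e ε (var (inject₁ i)))

  𝒱 : ∀ r → ℕ → Carrier → Point r → Set
  𝒱 r e ε = Zero (homogenization (affinePolynomial r e ε))

  𝒱? : ∀ r e ε → Decidable (𝒱 r e ε)
  𝒱? r e ε P = eval (homogenization (affinePolynomial r e ε)) (coords P) ≟ 0#

  -- Multisets of points are given by their multiplicity functions.
  𝒱̄ : ∀ r → ℕ → Carrier → ℕ → Point r → ℕ
  𝒱̄ r e ε j P =
    (if does (𝒱? r e ε P ×-dec ¬? (AtInfinity? P)) then 1 else 0)
    ℕ.+ (if does (P ∼? P∞ r) then j else 0)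

  record LinearCode (N : ℕ) : Set₁ where
    field
      Codeword : Vector Carrier N → Set
      closed-0 : Codeword (λ _ → 0#)
      closed-+ : ∀ {u v} → Codeword u → Codeword v → Codeword (λ i → u i + v i)
      closed-* : ∀ a {v} → Codeword v → Codeword (λ i → a * v i)

  open LinearCode

  combination : ∀ {k N} → Vector Carrier k → (Fin k → Vector Carrier N) →
                Vector Carrier N
  combination a b i = sum (λ l → a l * b l i)

  span : ∀ {k N} → (Fin k → Vector Carrier N) → LinearCode N
  span {k} b = record
    { Codeword = λ v → ∃ λ a → ∀ i → v i ≡ combination a b i
    ; closed-0 = (λ _ → 0#) , λ i →
        sym (trans (sum-cong-≗ {k} λ l → zeroˡ (b l i)) (sum-replicate-zero k))
    ; closed-+ = λ (a , p) (a′ , p′) → (λ l → a l + a′ l) , λ i →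
        trans (cong₂ _+_ (p i) (p′ i))
        (trans (sym (∑-distrib-+ (λ l → a l * b l i) (λ l → a′ l * b l i)))
               (sum-cong-≗ {k} λ l → sym (distribʳ (b l i) (a l) (a′ l))))
    ; closed-* = λ c (a , p) → (λ l → c * a l) , λ i →
        trans (cong (c *_) (p i))
        (trans (*-distribˡ-sum c (λ l → a l * b l i))
               (sum-cong-≗ {k} λ l → sym (*-assoc c (a l) (b l i))))
    }
    where
    open IsCommutativeRing isCommutativeRing using (zeroˡ; distribʳ; *-assoc)
    open CMSum +-commutativeMonoid
      using (sum-cong-≗; sum-replicate-zero; ∑-distrib-+)
    open SemiringSum semiring using (*-distribˡ-sum)

  LinearlyIndependent : ∀ {k N} → (Fin k → Vector Carrier N) → Set
  LinearlyIndependent b =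
    ∀ a → (∀ i → combination a b i ≡ 0#) → ∀ l → a l ≡ 0#

  HasDimension : ∀ {N} → LinearCode N → ℕ → Set
  HasDimension {N} C k = ∃ λ (b : Fin k → Vector Carrier N) →
    (∀ l → Codeword C (b l)) ×
    LinearlyIndependent b ×
    (∀ v → Codeword C v → Codeword (span b) v)

  weight : ∀ {N} → Vector Carrier N → ℕ
  weight v = count (λ i → ¬? (v i ≟ 0#))

  IsWeight : ∀ {N} → LinearCode N → ℤ → Set
  IsWeight C w = ∃ λ v →
    Codeword C v × (∃ λ i → v i ≢ 0#) × ℤ.+ weight v ≡ w

  HasWeights : ∀ {N} → LinearCode N → List ℤ → Set
  HasWeights C ws = ∀ w → w ∈ ws ⇔ IsWeight C w

  IsWeightCode : ∀ {N} → ℕ → LinearCode N → Set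
  IsWeightCode t C = ∃ λ ws → Unique ws × length ws ≡ t × HasWeights C ws

  -- G lists coordinate vectors, which are the columns of a matrix, of the
  -- points of the multiset μ, each repeated according to its multiplicity.
  Lists : ∀ {N r} → (Fin N → Point r) → (Point r → ℕ) → Set
  Lists G μ = ∀ P → count (λ i → G i ∼? P) ≡ μ P

  associatedCode : ∀ {N r} → (Fin N → Point r) → LinearCode N
  associatedCode G = span (λ k i → coords (G i) k)

module Submission where

-- Writing x = a + b ε with a, b ∈ 𝔽_q turns Γ into f(a, b) = a^(σ+2) + a b + b^σ, the equation of the
-- Suzuki–Tits ovoid.  The substitutions (a, b) ↦ (a + u, b + t + u^σ a) absorb linear forms, and
-- (a, b) ↦ (c a, c^(σ+1) b) scales f, so f plus any linear form takes one value of 𝔽_q exactly once and every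
-- other one q + 1 times.  Convolving r − 1 such distributions counts the affine points on a hyperplane that
-- avoids P∞; hyperplanes through P∞ are counted by a linear equation in x₁, …, xᵣ₋₁.

open import Defs
open import Algebra.Bundles using (CommutativeMonoid; CommutativeRing)
import Algebra.Properties.CommutativeMonoid.Sum as CMSum
import Algebra.Properties.CommutativeSemiring.Exp as Exp
import Algebra.Properties.Group as GroupProperties
import Algebra.Properties.Ring as RingProperties
import Algebra.Properties.Semiring.Mult as Mult
import Algebra.Properties.Semiring.Sum as SemiringSum
import Algebra.Solver.Ring as RingSolver
open import Algebra.Solver.Ring.AlmostCommutativeRing using (fromCommutativeRing; _-Raw-AlmostCommutative⟶_)
open import Data.Bool using (Bool; true; false; if_then_else_)
import Data.Bool.Properties as Bool
open import Data.Fin using (Fin; zero; suc; fromℕ; inject₁)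
open import Data.Fin.Permutation using (Permutation′; permutation)
import Data.Fin.Properties as Fin
open import Data.Integer as ℤ using (ℤ; 0ℤ; 1ℤ)
import Data.Integer.Properties as ℤ
open import Data.Integer.Tactic.RingSolver using (solve-∀)
open import Data.List using (List; []; _∷_; length; filter; map; tabulate; allFin; cartesianProductWith; _++_)
import Data.List.Membership.Propositional.Properties as List
open import Data.List.Membership.Propositional using (_∈_)
import Data.List.Properties as List
open import Data.List.Relation.Unary.All as All using (All)
open import Data.List.Relation.Unary.AllPairs as AllPairs using (AllPairs)
open import Data.List.Relation.Unary.Any using (here; there)
open import Data.List.Relation.Unary.Unique.Propositional using (Unique)
import Data.Maybe as Maybe
open import Data.Nat as ℕ using (ℕ; _≤_; _∸_; _%_)
import Data.Nat.DivMod as ℕ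
import Data.Nat.Properties as ℕ
open import Data.Nat.Tactic.RingSolver using () renaming (solve-∀ to solve-∀ᴺ)
open import Data.Product using (_×_; _,_; proj₁; proj₂; ∃)
open import Data.Sum using (_⊎_; inj₁; inj₂)
import Data.Vec.Functional as Vector
open Vector using (Vector)
open import Function using (_∘_; id)
open import Function.Bundles using (Inverse; Equivalence; mk⇔)
open import Relation.Binary.Consequences using (dec⇒weaklyDec)
open import Relation.Binary.Definitions using (tri<; tri≈; tri>)
open import Relation.Binary.PropositionalEquality hiding (J)
open import Relation.Nullary using (Dec; yes; no; ¬_; ¬?; does; _because_; contradiction)
open import Relation.Nullary.Decidable using (dec-true; dec-false; decidable-stable; _×-dec_)
open import Relation.Unary using (Decidable)

-- The weight of a codeword is the number of listed points off a hyperplane. The value distribution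
-- of f comes without solving f = γ: f vanishes only at the origin, the scaling makes all nonzero
-- values of 𝔽_q equally frequent, and 1 + (q - 1) X = q² forces X = q + 1. Both substitutions rest
-- on σ² being squaring on 𝔽_q, which is where e odd enters. The distribution is the constant q + 1
-- minus q times a point mass. Under convolution constants absorb everything and point masses add
-- their positions, so r - 1 summands again give a constant plus (-q)^(r-1) times a point mass.
-- Hence hyperplanes off `P∞` have two weights, and hence the sign (-1)^(r-1). The linear forms
-- arise by eliminating xᵣ: on such a hyperplane xᵣ is an affine function of the other coordinates,
-- and its trace contributes terms Tr (wᵢ xᵢ). The listing `G` is arbitrary in order and in the
-- representatives chosen, so nothing can be counted on it directly; `∑-listed` trades it for
-- normalized points weighted by multiplicity. The multiplicity j shifts only the two weights of
-- hyperplanes off `P∞`, and the special values of j make one of them collide with a weight of a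
-- hyperplane through `P∞`.

module IntegerSums where
  open import Data.Integer using (+_; _+_; _*_; _-_)
  open ≡-Reasoning

  private
    variable
      A B : Set
      P Q : Set

  -- Integer-valued, because the distributions below have a negative coefficient at their
  -- exceptional value.
  [[_]] : Dec P → ℤ
  [[ d ]] = if does d then 1ℤ else 0ℤ

  [[]]-true : (d : Dec P) → P → [[ d ]] ≡ 1ℤ
  [[]]-true d p rewrite dec-true d p = refl

  [[]]-false : (d : Dec P) → ¬ P → [[ d ]] ≡ 0ℤ
  [[]]-false d ¬p rewrite dec-false d ¬p = refl

  [[]]-cong : (d : Dec P) (d′ : Dec Q) → (P → Q) → (Q → P) → [[ d ]] ≡ [[ d′ ]]
  [[]]-cong (yes p) d′ f g = sym ([[]]-true d′ (f p))
  [[]]-cong (no ¬p) d′ f g = sym ([[]]-false d′ (¬p ∘ g))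

  [[]]-× : (d : Dec P) (d′ : Dec Q) → [[ d ×-dec d′ ]] ≡ [[ d ]] * [[ d′ ]]
  [[]]-× (true because _)  d′ = sym (ℤ.*-identityˡ [[ d′ ]])
  [[]]-× (false because _) d′ = sym (ℤ.*-zeroˡ [[ d′ ]])

  [[]]-¬ : (d : Dec P) → [[ ¬? d ]] ≡ 1ℤ - [[ d ]]
  [[]]-¬ (true because _)  = refl
  [[]]-¬ (false because _) = refl

  -- Under an indicator an equality is needed only on its support; this is how a value at a listed
  -- point is exchanged for the value at a proportional one.
  [[]]-case : (d : Dec P) {x y : ℤ} → (P → x ≡ y) → [[ d ]] * x ≡ [[ d ]] * y
  [[]]-case (yes p) x≡y = cong (1ℤ *_) (x≡y p)
  [[]]-case (no _)  x≡y = refl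

  ∑ : List A → (A → ℤ) → ℤ
  ∑ []       f = 0ℤ
  ∑ (x ∷ xs) f = f x + ∑ xs f

  ∑-cong : ∀ (xs : List A) {f g : A → ℤ} → (∀ x → f x ≡ g x) → ∑ xs f ≡ ∑ xs g
  ∑-cong []       f≗g = refl
  ∑-cong (x ∷ xs) f≗g = cong₂ _+_ (f≗g x) (∑-cong xs f≗g)

  ∑-distrib-+ : ∀ (xs : List A) (f g : A → ℤ) →
                ∑ xs (λ x → f x + g x) ≡ ∑ xs f + ∑ xs g
  ∑-distrib-+ []       f g = refl
  ∑-distrib-+ (x ∷ xs) f g = begin
    f x + g x + ∑ xs (λ x → f x + g x)  ≡⟨ cong (_+_ (f x + g x)) (∑-distrib-+ xs f g) ⟩
    f x + g x + (∑ xs f + ∑ xs g)       ≡⟨ interchange (f x) (g x) (∑ xs f) (∑ xs g) ⟩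
    f x + ∑ xs f + (g x + ∑ xs g)       ∎
    where
    interchange : ∀ a b c d → a + b + (c + d) ≡ a + c + (b + d)
    interchange = solve-∀

  ∑-*ˡ : ∀ (xs : List A) c (f : A → ℤ) → ∑ xs (λ x → c * f x) ≡ c * ∑ xs f
  ∑-*ˡ []       c f = sym (ℤ.*-zeroʳ c)
  ∑-*ˡ (x ∷ xs) c f = trans (cong (_+_ (c * f x)) (∑-*ˡ xs c f))
                            (sym (ℤ.*-distribˡ-+ c (f x) (∑ xs f)))

  ∑-*ʳ : ∀ (xs : List A) c (f : A → ℤ) → ∑ xs (λ x → f x * c) ≡ ∑ xs f * c
  ∑-*ʳ xs c f = trans (∑-cong xs (λ x → ℤ.*-comm (f x) c))
                      (trans (∑-*ˡ xs c f) (ℤ.*-comm c (∑ xs f)))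

  ∑-const : ∀ (xs : List A) c → ∑ xs (λ _ → c) ≡ + length xs * c
  ∑-const []       c = sym (ℤ.*-zeroˡ c)
  ∑-const (x ∷ xs) c = trans (cong (_+_ c) (∑-const xs c)) (sym (ℤ.suc-* (+ length xs) c))

  ∑-zero : ∀ (xs : List A) → ∑ xs (λ _ → 0ℤ) ≡ 0ℤ
  ∑-zero xs = trans (∑-const xs 0ℤ) (ℤ.*-zeroʳ (+ length xs))

  ∑-comm : ∀ (xs : List A) (ys : List B) (f : A → B → ℤ) →
           ∑ xs (λ x → ∑ ys (f x)) ≡ ∑ ys (λ y → ∑ xs (λ x → f x y))
  ∑-comm []       ys f = sym (∑-zero ys)
  ∑-comm (x ∷ xs) ys f = trans (cong (_+_ (∑ ys (f x))) (∑-comm xs ys f))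
                               (sym (∑-distrib-+ ys (f x) _))

  ∑-++ : ∀ (xs ys : List A) (f : A → ℤ) → ∑ (xs ++ ys) f ≡ ∑ xs f + ∑ ys f
  ∑-++ []       ys f = sym (ℤ.+-identityˡ (∑ ys f))
  ∑-++ (x ∷ xs) ys f = trans (cong (_+_ (f x)) (∑-++ xs ys f))
                             (sym (ℤ.+-assoc (f x) (∑ xs f) (∑ ys f)))

  ∑-map : ∀ (g : A → B) (xs : List A) (f : B → ℤ) → ∑ (map g xs) f ≡ ∑ xs (f ∘ g)
  ∑-map g []       f = refl
  ∑-map g (x ∷ xs) f = cong (_+_ (f (g x))) (∑-map g xs f)

  ∑-cartesianProductWith : ∀ {C : Set} (g : A → B → C) xs ys (f : C → ℤ) →
    ∑ (cartesianProductWith g xs ys) f ≡ ∑ xs (λ x → ∑ ys (λ y → f (g x y)))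
  ∑-cartesianProductWith g []       ys f = refl
  ∑-cartesianProductWith g (x ∷ xs) ys f =
    trans (∑-++ (map (g x) ys) _ f)
          (cong₂ _+_ (∑-map (g x) ys f) (∑-cartesianProductWith g xs ys f))

  length-filter : ∀ {P : A → Set} (P? : Decidable P) xs →
                  + length (filter P? xs) ≡ ∑ xs (λ x → [[ P? x ]])
  length-filter P? []       = refl
  length-filter P? (x ∷ xs) with P? x
  ... | true  because _ = cong (_+_ 1ℤ) (length-filter P? xs)
  ... | false because _ = trans (length-filter P? xs) (sym (ℤ.+-identityˡ _))

  -- The bridge to sums over `Fin n`, for which invariance under permutations is available.
  ∑-tabulate : ∀ {n} (g : Fin n → A) (f : A → ℤ) →
               ∑ (tabulate g) f ≡ SemiringSum.sum ℤ.+-*-semiring (f ∘ g)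
  ∑-tabulate {n = ℕ.zero}  g f = refl
  ∑-tabulate {n = ℕ.suc n} g f = cong (_+_ (f (g zero))) (∑-tabulate (g ∘ suc) f)

module _ {c ℓ} (M : CommutativeMonoid c ℓ) where
  open CommutativeMonoid M using (Carrier; _≈_; ε; ∙-congˡ; identityˡ; identityʳ)
    renaming (trans to ≈-trans)
  open CMSum M using (sum; sum-replicate-zero)

  -- Stated for any commutative monoid because it serves sums in ℤ, sums in the field and products
  -- in the field.
  sum-if-≟ : ∀ {n} (k : Fin n) (a : Carrier) →
             sum (λ i → if does (i Fin.≟ k) then a else ε) ≈ a
  sum-if-≟ {ℕ.suc n} zero    a = ≈-trans (∙-congˡ (sum-replicate-zero n)) (identityʳ a)
  sum-if-≟ {ℕ.suc n} (suc k) a = ≈-trans (identityˡ _) (sum-if-≟ k a)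

open IntegerSums

-- Finite fields: sums over all elements, characteristic, and x ^ n = x

module FiniteFieldProperties {n : ℕ} (K : FiniteField n) where
  open FiniteField K
  open CommutativeRing commutativeRing
    using (+-identityʳ; +-comm; +-assoc; *-assoc; *-comm; *-identityˡ; *-identityʳ; zeroˡ; zeroʳ
          ; -‿inverseʳ; +-group; *-commutativeMonoid)
  open Inverse enumeration using (to; from; strictlyInverseˡ; strictlyInverseʳ)
  open ≡-Reasoning

  elements : List Carrier
  elements = tabulate from

  length-elements : length elements ≡ n
  length-elements = List.length-tabulate from

  module _ (φ ψ : Carrier → Carrier) (φψ : ∀ x → φ (ψ x) ≡ x) (ψφ : ∀ x → ψ (φ x) ≡ x) where

    private
      conjugate-inverse : ∀ (f g : Carrier → Carrier) → (∀ x → f (g x) ≡ x) →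
                          ∀ i → to (f (from (to (g (from i))))) ≡ i
      conjugate-inverse f g fg i =
        trans (cong (to ∘ f) (strictlyInverseʳ (g (from i))))
              (trans (cong to (fg (from i))) (strictlyInverseˡ i))

      π : Permutation′ n
      π = permutation (to ∘ φ ∘ from) (to ∘ ψ ∘ from)
                      (conjugate-inverse φ ψ φψ) (conjugate-inverse ψ φ ψφ)

    sum-bijection : ∀ {c ℓ} (M : CommutativeMonoid c ℓ) (f : Carrier → CommutativeMonoid.Carrier M) →
      CommutativeMonoid._≈_ M (CMSum.sum M (f ∘ from)) (CMSum.sum M (f ∘ φ ∘ from))
    sum-bijection M f =
      CommutativeMonoid.trans M (CMSum.sum-permute M (f ∘ from) π)
        (CommutativeMonoid.reflexive M (CMSum.sum-cong-≗ M (λ i → cong f (strictlyInverseʳ (φ (from i))))))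

    ∑-bijection : ∀ (f : Carrier → ℤ) → ∑ elements (f ∘ φ) ≡ ∑ elements f
    ∑-bijection f = trans (∑-tabulate from (f ∘ φ))
      (trans (sym (sum-bijection ℤ.+-0-commutativeMonoid f)) (sym (∑-tabulate from f)))

  does-from-≟ : ∀ i x → does (from i ≟ x) ≡ does (i Fin.≟ to x)
  does-from-≟ i x with i Fin.≟ to x
  ... | yes i≡ = dec-true (from i ≟ x) (trans (cong from i≡) (strictlyInverseʳ x))
  ... | no i≢ = dec-false (from i ≟ x) (λ eq → i≢ (trans (sym (strictlyInverseˡ i)) (cong to eq)))

  sum-if-from-≟ : ∀ {c ℓ} (M : CommutativeMonoid c ℓ) x a →
    CommutativeMonoid._≈_ M
      (CMSum.sum M (λ i → if does (from i ≟ x) then a else CommutativeMonoid.ε M)) a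
  sum-if-from-≟ M x a = CommutativeMonoid.trans M
    (CommutativeMonoid.reflexive M
      (CMSum.sum-cong-≗ M λ i →
        cong (λ b → if b then a else CommutativeMonoid.ε M) (does-from-≟ i x)))
    (sum-if-≟ M (to x) a)

  ∑-≟ : ∀ c → ∑ elements (λ x → [[ x ≟ c ]]) ≡ 1ℤ
  ∑-≟ c = trans (∑-tabulate from (λ x → [[ x ≟ c ]]))
                (sum-if-from-≟ ℤ.+-0-commutativeMonoid c 1ℤ)

  ∑-unique : ∀ {P : Carrier → Set} (P? : Decidable P) c → P c → (∀ x → P x → x ≡ c) →
             ∑ elements (λ x → [[ P? x ]]) ≡ 1ℤ
  ∑-unique {P} P? c Pc unique =
    trans (∑-cong elements λ x → [[]]-cong (P? x) (x ≟ c) (unique x) (λ eq → subst P (sym eq) Pc))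
          (∑-≟ c)

  ∑-pick : ∀ c (f : Carrier → ℤ) → ∑ elements (λ x → [[ x ≟ c ]] ℤ.* f x) ≡ f c
  ∑-pick c f = begin
    ∑ elements (λ x → [[ x ≟ c ]] ℤ.* f x)  ≡⟨ ∑-cong elements (λ x → [[]]-case (x ≟ c) (cong f)) ⟩
    ∑ elements (λ x → [[ x ≟ c ]] ℤ.* f c)  ≡⟨ ∑-*ʳ elements (f c) _ ⟩
    ∑ elements (λ x → [[ x ≟ c ]]) ℤ.* f c  ≡⟨ cong (ℤ._* f c) (∑-≟ c) ⟩
    1ℤ ℤ.* f c                              ≡⟨ ℤ.*-identityˡ (f c) ⟩
    f c                                     ∎

  one-^ : ∀ m → 1# ^ m ≡ 1#
  one-^ ℕ.zero    = refl
  one-^ (ℕ.suc m) = trans (*-identityˡ _) (one-^ m)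

  *-nonzero : ∀ {x y} → x ≢ 0# → y ≢ 0# → x * y ≢ 0#
  *-nonzero {x} {y} x≢0 y≢0 xy≡0 = y≢0 (begin
    y             ≡⟨ *-identityˡ y ⟨
    1# * y        ≡⟨ cong (_* y) (proj₂ (inverse x x≢0)) ⟨
    x * x⁻¹ * y   ≡⟨ cong (_* y) (*-comm x x⁻¹) ⟩
    x⁻¹ * x * y   ≡⟨ *-assoc x⁻¹ x y ⟩
    x⁻¹ * (x * y) ≡⟨ cong (x⁻¹ *_) xy≡0 ⟩
    x⁻¹ * 0#      ≡⟨ zeroʳ x⁻¹ ⟩
    0#            ∎)
    where x⁻¹ = proj₁ (inverse x x≢0)

  ^-nonzero : ∀ {x} m → x ≢ 0# → x ^ m ≢ 0#
  ^-nonzero ℕ.zero    x≢0 = 0≢1 ∘ sym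
  ^-nonzero (ℕ.suc m) x≢0 = *-nonzero x≢0 (^-nonzero m x≢0)

  *-cancelˡ-nonzero : ∀ {x y z} → x ≢ 0# → x * y ≡ x * z → y ≡ z
  *-cancelˡ-nonzero {x} {y} {z} x≢0 eq = begin
    y             ≡⟨ undo y ⟨
    x⁻¹ * (x * y) ≡⟨ cong (x⁻¹ *_) eq ⟩
    x⁻¹ * (x * z) ≡⟨ undo z ⟩
    z             ∎
    where
    x⁻¹ = proj₁ (inverse x x≢0)
    undo : ∀ w → x⁻¹ * (x * w) ≡ w
    undo w = begin
      x⁻¹ * (x * w) ≡⟨ *-assoc x⁻¹ x w ⟨
      x⁻¹ * x * w   ≡⟨ cong (_* w) (*-comm x⁻¹ x) ⟩
      x * x⁻¹ * w   ≡⟨ cong (_* w) (proj₂ (inverse x x≢0)) ⟩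
      1# * w        ≡⟨ *-identityˡ w ⟩
      w             ∎

  module _ where
    open Mult semiring using () renaming (_×_ to _·_)
    open CMSum +-commutativeMonoid
      using (sum-replicate) renaming (∑-distrib-+ to sum-distrib-+)

    -- Translation by 1 permutes the field, so the sum S of all elements satisfies S = S + n · 1.
    card·1≡0 : n · 1# ≡ 0#
    card·1≡0 = sym (GroupProperties.∙-cancelˡ +-group (sum from) 0# (n · 1#) (begin
      sum from + 0#                ≡⟨ +-identityʳ _ ⟩
      sum from                     ≡⟨ sum-bijection (_+ 1#) (_+ - 1#)
                                        (λ x → trans (+-assoc x _ _)
                                            (trans (cong (x +_) (trans (+-comm _ _) (-‿inverseʳ 1#)))
                                                (+-identityʳ x)))
                                        (λ x → trans (+-assoc x _ _)
                                            (trans (cong (x +_) (-‿inverseʳ 1#)) (+-identityʳ x)))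
                                        +-commutativeMonoid id ⟩
      sum (λ i → from i + 1#)      ≡⟨ sum-distrib-+ from (λ _ → 1#) ⟩
      sum from + sum {n} (λ _ → 1#) ≡⟨ cong (sum from +_) (sum-replicate n) ⟩
      sum from + n · 1#            ∎))

  -- The map x ↦ c x permutes the nonzero elements, so it fixes their product.
  module _ (c : Carrier) (c≢0 : c ≢ 0#) where
    open CMSum *-commutativeMonoid renaming
        (sum to ∏; ∑-distrib-+ to ∏-distrib-*; sum-cong-≗ to ∏-cong; sum-replicate to ∏-replicate)

    private
      -- Replacing 0 by 1 turns the product of the nonzero elements into a product over the whole
      -- enumeration.
      unit : Carrier → Carrier
      unit x = if does (x ≟ 0#) then 1# else x

      -- `factor` is what multiplication by c contributes to the product of `unit`; `cofactor`
      -- supplies the one c missing at 0. Hence c ^ n splits as the product of the factors, which is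
      -- 1, times c.
      factor cofactor : Carrier → Carrier
      factor x = if does (x ≟ 0#) then 1# else c
      cofactor x = if does (x ≟ 0#) then c else 1#

      unit-nonzero : ∀ x → unit x ≢ 0#
      unit-nonzero x = by-cases (x ≟ 0#)
        where
        by-cases : (d : Dec (x ≡ 0#)) → (if does d then 1# else x) ≢ 0#
        by-cases (yes _)  = 0≢1 ∘ sym
        by-cases (no x≢0) = x≢0

      unit-* : ∀ x → unit (c * x) ≡ factor x * unit x
      unit-* x = by-cases (x ≟ 0#)
        where
        by-cases : (d : Dec (x ≡ 0#)) →
          unit (c * x) ≡ (if does d then 1# else c) * (if does d then 1# else x)
        by-cases (yes x≡0) = trans
          (cong (λ b → if b then 1# else c * x)
                (dec-true ((c * x) ≟ 0#) (trans (cong (c *_) x≡0) (zeroʳ c))))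
          (sym (*-identityˡ 1#))
        by-cases (no x≢0) = cong (λ b → if b then 1# else c * x)
                                 (dec-false ((c * x) ≟ 0#) (*-nonzero c≢0 x≢0))

      factor*cofactor : ∀ x → factor x * cofactor x ≡ c
      factor*cofactor x with does (x ≟ 0#)
      ... | true  = *-identityˡ c
      ... | false = *-identityʳ c

      ∏-nonzero : ∀ {m} (f : Fin m → Carrier) → (∀ i → f i ≢ 0#) → ∏ f ≢ 0#
      ∏-nonzero {ℕ.zero}  f f≢0 = 0≢1 ∘ sym
      ∏-nonzero {ℕ.suc m} f f≢0 = *-nonzero (f≢0 zero) (∏-nonzero (f ∘ suc) (f≢0 ∘ suc))

      c⁻¹ = proj₁ (inverse c c≢0)

      *-undo : ∀ a b → a * b ≡ 1# → ∀ x → a * (b * x) ≡ x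
      *-undo a b ab≡1 x = trans (sym (*-assoc a b x)) (trans (cong (_* x) ab≡1) (*-identityˡ x))

      ∏-factor : ∏ (factor ∘ from) ≡ 1#
      ∏-factor = *-cancelˡ-nonzero (∏-nonzero (unit ∘ from) (unit-nonzero ∘ from)) (begin
        ∏ (unit ∘ from) * ∏ (factor ∘ from) ≡⟨ *-comm _ _ ⟩
        ∏ (factor ∘ from) * ∏ (unit ∘ from) ≡⟨ ∏-distrib-* (factor ∘ from) (unit ∘ from) ⟨
        ∏ (λ i → factor (from i) * unit (from i)) ≡⟨ ∏-cong (λ i → sym (unit-* (from i))) ⟩
        ∏ (λ i → unit (c * from i)) ≡⟨ sum-bijection (c *_) (c⁻¹ *_)
              (*-undo c c⁻¹ (proj₂ (inverse c c≢0)))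
              (*-undo c⁻¹ c (trans (*-comm c⁻¹ c) (proj₂ (inverse c c≢0)))) *-commutativeMonoid unit ⟨
        ∏ (unit ∘ from) ≡⟨ *-identityʳ _ ⟨
        ∏ (unit ∘ from) * 1# ∎)

    nonzero-^card : c ^ n ≡ c
    nonzero-^card = begin
      c ^ n ≡⟨ ∏-replicate n ⟨
      ∏ {n} (λ _ → c) ≡⟨ ∏-cong (λ i → sym (factor*cofactor (from i))) ⟩
      ∏ (λ i → factor (from i) * cofactor (from i)) ≡⟨ ∏-distrib-* (factor ∘ from) (cofactor ∘ from) ⟩
      ∏ (factor ∘ from) * ∏ (cofactor ∘ from)
        ≡⟨ cong₂ _*_ ∏-factor (sum-if-from-≟ *-commutativeMonoid 0# c) ⟩
      1# * c ≡⟨ *-identityˡ c ⟩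
      c ∎

  ^card : ∀ c → c ^ n ≡ c
  ^card c with c ≟ 0#
  ... | no c≢0 = nonzero-^card c c≢0
  -- The index of 0 inhabits `Fin n`, which shows that the exponent is positive.
  ... | yes refl = zero-^ (to 0#)
    where
    zero-^ : ∀ {m} → Fin m → 0# ^ m ≡ 0#
    zero-^ {ℕ.suc m} _ = zeroˡ _

module _ {n : ℕ} (K : FiniteField n) where
  open FiniteField K
  open CommutativeRing commutativeRing using (+-identityʳ; *-identityʳ)
  open FiniteFieldProperties K using (^-nonzero; card·1≡0)
  open Mult semiring using (×1-homo-*) renaming (_×_ to _·_)
  open ≡-Reasoning

  -- Otherwise (1 + 1)^m would be nonzero, but it equals 2^m · 1, the cardinality times 1.
  card-2^⇒1+1≡0 : ∀ m → n ≡ 2 ℕ.^ m → 1# + 1# ≡ 0#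
  card-2^⇒1+1≡0 m n≡2^m with (1# + 1#) ≟ 0#
  ... | yes eq = eq
  ... | no neq = contradiction (trans (trans (power m) (cong (_· 1#) (sym n≡2^m))) card·1≡0)
      (^-nonzero m neq)
    where
    power : ∀ m → (1# + 1#) ^ m ≡ (2 ℕ.^ m) · 1#
    power ℕ.zero    = sym (+-identityʳ 1#)
    power (ℕ.suc m) = begin
      (1# + 1#) * (1# + 1#) ^ m      ≡⟨ cong₂ (λ x y → (1# + x) * y) (sym (+-identityʳ 1#)) (power m) ⟩
      (2 · 1#) * ((2 ℕ.^ m) · 1#)    ≡⟨ ×1-homo-* 2 (2 ℕ.^ m) ⟨
      (2 ℕ.* 2 ℕ.^ m) · 1#           ∎

-- Arithmetic in characteristic 2

module Characteristic2 {n : ℕ} (K : FiniteField n)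
  (1+1≡0 : FiniteField._+_ K (FiniteField.1# K) (FiniteField.1# K) ≡ FiniteField.0# K) where
  open FiniteField K
  open CommutativeRing commutativeRing
    using (+-identityˡ; +-identityʳ; zeroˡ; *-identityˡ; -‿inverseʳ; commutativeSemiring; ring; +-group)
  open Exp commutativeSemiring using (^-assocʳ)
  open ≡-Reasoning

  -1≡1 : - 1# ≡ 1#
  -1≡1 = GroupProperties.∙-cancelˡ +-group 1# (- 1#) 1# (trans (-‿inverseʳ 1#) (sym 1+1≡0))

  private
    ⟨_⟩ : Bool → Carrier
    ⟨ b ⟩ = if b then 1# else 0#

    Bool⟶K : CommutativeRing.rawRing Bool.xor-∧-commutativeRing
             -Raw-AlmostCommutative⟶ fromCommutativeRing commutativeRing
    Bool⟶K = record
      { ⟦_⟧    = ⟨_⟩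
      ; +-homo = λ { false y → sym (+-identityˡ ⟨ y ⟩)
                   ; true false → sym (+-identityʳ 1#)
                   ; true true → sym 1+1≡0 }
      ; *-homo = λ { false y → sym (zeroˡ ⟨ y ⟩) ; true y → sym (*-identityˡ ⟨ y ⟩) }
      ; -‿homo = λ { false → sym (RingProperties.-0#≈0# ring) ; true → sym -1≡1 }
      ; 0-homo = refl
      ; 1-homo = refl
      }

  -- Coefficients in 𝔽₂, so that the solver decides identities modulo 2.
  module Solver = RingSolver _ _ Bool⟶K (λ x y → Maybe.map (cong ⟨_⟩) (dec⇒weaklyDec Bool._≟_ x y))
  open Solver using (solve; _:=_; _:+_; _:*_; con)

  +-self : ∀ x → x + x ≡ 0#
  +-self = solve 1 (λ x → x :+ x := con false) refl

  +-cancel : ∀ {x y} → x + y ≡ 0# → x ≡ y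
  +-cancel {x} {y} x+y≡0 = begin
    x           ≡⟨ solve 2 (λ x y → x := (x :+ y) :+ y) refl x y ⟩
    x + y + y   ≡⟨ cong (_+ y) x+y≡0 ⟩
    0# + y      ≡⟨ +-identityˡ y ⟩
    y           ∎

  +-move : ∀ {x y z} → x + y ≡ z → x ≡ z + y
  +-move {x} {y} {z} eq = begin
    x           ≡⟨ solve 2 (λ x y → x := (x :+ y) :+ y) refl x y ⟩
    x + y + y   ≡⟨ cong (_+ y) eq ⟩
    z + y       ∎

  frobenius : ∀ m x y → (x + y) ^ (2 ℕ.^ m) ≡ x ^ (2 ℕ.^ m) + y ^ (2 ℕ.^ m)
  frobenius ℕ.zero    x y = solve 2
      (λ x y → (x :+ y) :* con true := x :* con true :+ y :* con true) refl x y
  frobenius (ℕ.suc m) x y = begin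
    (x + y) ^ (2 ℕ.* p)       ≡⟨ ^-assocʳ (x + y) 2 p ⟨
    ((x + y) ^ 2) ^ p
      ≡⟨ cong (_^ p) (solve 2
           (λ x y → (x :+ y) :* ((x :+ y) :* con true) := x :* (x :* con true) :+ y :*
               (y :* con true)) refl x y) ⟩
    (x ^ 2 + y ^ 2) ^ p       ≡⟨ frobenius m (x ^ 2) (y ^ 2) ⟩
    (x ^ 2) ^ p + (y ^ 2) ^ p ≡⟨ cong₂ _+_ (^-assocʳ x 2 p) (^-assocʳ y 2 p) ⟩
    x ^ (2 ℕ.* p) + y ^ (2 ℕ.* p) ∎
    where p = 2 ℕ.^ m

  -- Additivity gives 0^p = 0^p + 0^p, which vanishes in characteristic 2.
  zero-^2^ : ∀ m → 0# ^ (2 ℕ.^ m) ≡ 0#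
  zero-^2^ m = begin
    0# ^ (2 ℕ.^ m)                  ≡⟨ cong (_^ (2 ℕ.^ m)) (+-self 0#) ⟨
    (0# + 0#) ^ (2 ℕ.^ m)           ≡⟨ frobenius m 0# 0# ⟩
    0# ^ (2 ℕ.^ m) + 0# ^ (2 ℕ.^ m) ≡⟨ +-self _ ⟩
    0#                              ∎

-- The subfield 𝔽_q, coordinates with respect to ε, and the Suzuki-Tits form

module SuzukiTits
  (e k : ℕ) (⌈e/2⌉≡1+k : (e ℕ.+ 1) ℕ./ 2 ≡ ℕ.suc k)
  (2⌈e/2⌉≡1+e : ℕ.suc k ℕ.+ ℕ.suc k ≡ ℕ.suc e)
  (K : FiniteField ((2 ℕ.^ e) ℕ.^ 2)) (ε : FiniteField.Carrier K) (isParameter : IsParameter K e ε) where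
  open FiniteField K
  open CommutativeRing commutativeRing
    using (+-identityʳ; zeroˡ; zeroʳ; *-identityʳ; *-comm; commutativeSemiring)
  open Exp commutativeSemiring using (^-distrib-*; ^-assocʳ; ^-homo-*)
  open FiniteFieldProperties K
  open ≡-Reasoning

  q : ℕ
  q = 2 ℕ.^ e

  s : ℕ
  s = 2 ℕ.^ ((e ℕ.+ 1) ℕ./ 2)

  1+1≡0 : 1# + 1# ≡ 0#
  1+1≡0 = card-2^⇒1+1≡0 K (e ℕ.* 2) (ℕ.^-*-assoc 2 e 2)

  open Characteristic2 K 1+1≡0
  open Solver using (solve; _:=_; _:+_; _:*_; con)

  infix 4 _∈F
  _∈F : Carrier → Set
  x ∈F = InSubfield K q x

  F? : ∀ x → Dec (x ∈F)
  F? x = (x ^ q) ≟ x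

  ^q^q : ∀ x → (x ^ q) ^ q ≡ x
  ^q^q x = begin
    (x ^ q) ^ q         ≡⟨ ^-assocʳ x q q ⟩
    x ^ (q ℕ.* q)       ≡⟨ cong (λ m → x ^ (q ℕ.* m)) (sym (ℕ.*-identityʳ q)) ⟩
    x ^ (q ℕ.^ 2)       ≡⟨ ^card x ⟩
    x                   ∎

  +-∈F : ∀ {x y} → x ∈F → y ∈F → x + y ∈F
  +-∈F {x} {y} x∈ y∈ = trans (frobenius e x y) (cong₂ _+_ x∈ y∈)

  *-∈F : ∀ {x y} → x ∈F → y ∈F → x * y ∈F
  *-∈F {x} {y} x∈ y∈ = trans (^-distrib-* x y q) (cong₂ _*_ x∈ y∈)

  0∈F : 0# ∈F
  0∈F = zero-^2^ e

  1∈F : 1# ∈F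
  1∈F = one-^ q

  ^-∈F : ∀ {x} m → x ∈F → x ^ m ∈F
  ^-∈F ℕ.zero    x∈ = 1∈F
  ^-∈F (ℕ.suc m) x∈ = *-∈F x∈ (^-∈F m x∈)

  inverse-∈F : ∀ {x y} → x ∈F → x * y ≡ 1# → y ∈F
  inverse-∈F {x} {y} x∈ xy≡1 = *-cancelˡ-nonzero x≢0 (begin
    x * y ^ q       ≡⟨ cong (_* y ^ q) x∈ ⟨
    x ^ q * y ^ q   ≡⟨ ^-distrib-* x y q ⟨
    (x * y) ^ q     ≡⟨ cong (_^ q) xy≡1 ⟩
    1# ^ q          ≡⟨ 1∈F ⟩
    1#              ≡⟨ xy≡1 ⟨
    x * y           ∎)
    where
    x≢0 : x ≢ 0#
    x≢0 x≡0 = 0≢1 (trans (sym (zeroˡ y)) (trans (cong (_* y) (sym x≡0)) xy≡1))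

  -- The relative trace from 𝔽_(q²) to 𝔽_q. In characteristic 2 its kernel is 𝔽_q, and as `Tr ε` is
  -- 1 it reads off the coefficient of ε.
  Tr : Carrier → Carrier
  Tr x = x ^ q + x

  Tr-∈F : ∀ x → Tr x ∈F
  Tr-∈F x = begin
    (x ^ q + x) ^ q     ≡⟨ frobenius e (x ^ q) x ⟩
    (x ^ q) ^ q + x ^ q ≡⟨ cong (_+ x ^ q) (^q^q x) ⟩
    x + x ^ q           ≡⟨ solve 2 (λ x y → x :+ y := y :+ x) refl x (x ^ q) ⟩
    x ^ q + x           ∎

  Tr-+ : ∀ x y → Tr (x + y) ≡ Tr x + Tr y
  Tr-+ x y = trans (cong (_+ (x + y)) (frobenius e x y))
    (solve 4 (λ x y x̄ ȳ → (x̄ :+ ȳ) :+ (x :+ y) := (x̄ :+ x) :+ (ȳ :+ y)) refl x y (x ^ q) (y ^ q))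

  Tr-F : ∀ {x} → x ∈F → Tr x ≡ 0#
  Tr-F {x} x∈ = trans (cong (_+ x) x∈) (+-self x)

  Tr≡0⇒∈F : ∀ {x} → Tr x ≡ 0# → x ∈F
  Tr≡0⇒∈F = +-cancel

  Tr-* : ∀ {x} y → x ∈F → Tr (x * y) ≡ x * Tr y
  Tr-* {x} y x∈ = begin
    (x * y) ^ q + x * y   ≡⟨ cong (_+ x * y) (^-distrib-* x y q) ⟩
    x ^ q * y ^ q + x * y ≡⟨ cong (λ z → z * y ^ q + x * y) x∈ ⟩
    x * y ^ q + x * y     ≡⟨ solve 3 (λ x y ȳ → x :* ȳ :+ x :* y := x :* (ȳ :+ y)) refl x y (y ^ q) ⟩
    x * (y ^ q + y)       ∎

  -- ε and its conjugate have the same value of ε² + ε, so Tr ε ∈ {0, 1}.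
  Tr-ε : Tr ε ≡ 1#
  Tr-ε = +-cancel (*-cancelˡ-nonzero Trε≢0 (begin
    Tr ε * (Tr ε + 1#)                       ≡⟨ solve 3 (λ x y d → (y :+ x) :* ((y :+ x) :+ con true) :=
                                                   (y :* (y :* con true) :+ y :+ d) :+
                                                       (x :* (x :* con true) :+ x :+ d)) refl ε (ε ^ q) δ ⟩
    (ε ^ q) ^ 2 + ε ^ q + δ + (ε ^ 2 + ε + δ)   ≡⟨ cong₂ _+_ conjugate-root root ⟩
    0# + 0#                                     ≡⟨ +-self 0# ⟩
    0#                                          ≡⟨ zeroʳ (Tr ε) ⟨
    Tr ε * 0#                                ∎))
    where
    open IsParameter isParameter
    Trε≢0 : Tr ε ≢ 0#
    Trε≢0 = ε∉𝔽q ∘ Tr≡0⇒∈F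
    conjugate-root : (ε ^ q) ^ 2 + ε ^ q + δ ≡ 0#
    conjugate-root = begin
      (ε ^ q) ^ 2 + ε ^ q + δ
        ≡⟨ cong (λ z → z + ε ^ q + δ)
             (trans (^-assocʳ ε q 2) (trans (cong (ε ^_) (ℕ.*-comm q 2)) (sym (^-assocʳ ε 2 q)))) ⟩
      (ε ^ 2) ^ q + ε ^ q + δ      ≡⟨ cong (((ε ^ 2) ^ q + ε ^ q) +_) δ∈𝔽q ⟨
      (ε ^ 2) ^ q + ε ^ q + δ ^ q  ≡⟨ cong (_+ δ ^ q) (frobenius e (ε ^ 2) ε) ⟨
      (ε ^ 2 + ε) ^ q + δ ^ q      ≡⟨ frobenius e (ε ^ 2 + ε) δ ⟨
      (ε ^ 2 + ε + δ) ^ q          ≡⟨ cong (_^ q) root ⟩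
      0# ^ q                       ≡⟨ 0∈F ⟩
      0#                           ∎

  -- What is left of x after removing its ε-part, addition and subtraction being the same; it is the
  -- other coordinate in 𝔽_q.
  re : Carrier → Carrier
  re x = x + Tr x * ε

  re-+Tr : ∀ x → re x + Tr x * ε ≡ x
  re-+Tr x = solve 2 (λ x y → (x :+ y) :+ y := x) refl x (Tr x * ε)

  Tr-+ε : ∀ {α β} → α ∈F → β ∈F → Tr (α + β * ε) ≡ β
  Tr-+ε {α} {β} α∈ β∈ = begin
    Tr (α + β * ε)     ≡⟨ Tr-+ α (β * ε) ⟩
    Tr α + Tr (β * ε)  ≡⟨ cong₂ _+_ (Tr-F α∈) (trans (Tr-* ε β∈) (cong (β *_) Tr-ε)) ⟩
    0# + β * 1#        ≡⟨ solve 1 (λ β → con false :+ β :* con true := β) refl β ⟩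
    β                  ∎

  re-+ε : ∀ {α β} → α ∈F → β ∈F → re (α + β * ε) ≡ α
  re-+ε {α} {β} α∈ β∈ = begin
    α + β * ε + Tr (α + β * ε) * ε  ≡⟨ cong (λ z → α + β * ε + z * ε) (Tr-+ε α∈ β∈) ⟩
    α + β * ε + β * ε               ≡⟨ solve 2 (λ x y → (x :+ y) :+ y := x) refl α (β * ε) ⟩
    α                               ∎

  re-∈F : ∀ x → re x ∈F
  re-∈F x = Tr≡0⇒∈F (begin
    Tr (x + Tr x * ε)     ≡⟨ Tr-+ x (Tr x * ε) ⟩
    Tr x + Tr (Tr x * ε)  ≡⟨ cong (Tr x +_) (trans (Tr-* ε (Tr-∈F x)) (cong (Tr x *_) Tr-ε)) ⟩
    Tr x + Tr x * 1#      ≡⟨ solve 1 (λ β → β :+ β :* con true := con false) refl (Tr x) ⟩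
    0#                    ∎)

  -- In the coordinates (re x, Tr x) the form x ↦ Tr (w x) is linear with coefficients Tr w and re w
  -- + Tr w; the translation absorbing it is computed from these two.
  Tr-product : ∀ w x → Tr (w * x) ≡ Tr w * re x + (re w + Tr w) * Tr x
  Tr-product w x = trans (cong (_+ w * x) (^-distrib-* w x q))
    (solve 5 (λ w x w̄ x̄ ε →
      w̄ :* x̄ :+ w :* x :=
      (w̄ :+ w) :* (x :+ (x̄ :+ x) :* ε) :+ ((w :+ (w̄ :+ w) :* ε) :+ (w̄ :+ w)) :* (x̄ :+ x))
      refl w x (w ^ q) (x ^ q) ε)

  σ : Carrier → Carrier
  σ x = x ^ s

  σ-+ : ∀ x y → σ (x + y) ≡ σ x + σ y
  σ-+ = frobenius ((e ℕ.+ 1) ℕ./ 2)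

  σ-* : ∀ x y → σ (x * y) ≡ σ x * σ y
  σ-* x y = ^-distrib-* x y s

  σ-0 : σ 0# ≡ 0#
  σ-0 = zero-^2^ ((e ℕ.+ 1) ℕ./ 2)

  σ-1 : σ 1# ≡ 1#
  σ-1 = one-^ s

  σ-∈F : ∀ {x} → x ∈F → σ x ∈F
  σ-∈F = ^-∈F s

  -- With e = 2k + 1 the map σ is raising to 2^(k+1), and 2^k · 2^(k+1) = q, so τ inverts σ on 𝔽_q.
  τ : Carrier → Carrier
  τ x = x ^ (2 ℕ.^ k)

  σ≡τ² : ∀ x → σ x ≡ τ x * τ x
  σ≡τ² x = begin
    x ^ (2 ℕ.^ ((e ℕ.+ 1) ℕ./ 2))  ≡⟨ cong (λ m → x ^ (2 ℕ.^ m)) ⌈e/2⌉≡1+k ⟩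
    x ^ (2 ℕ.* 2 ℕ.^ k)            ≡⟨ ^-homo-* x (2 ℕ.^ k) _ ⟩
    τ x * x ^ (2 ℕ.^ k ℕ.+ 0)      ≡⟨ cong (λ m → τ x * x ^ m) (ℕ.+-identityʳ (2 ℕ.^ k)) ⟩
    τ x * τ x                      ∎

  σ-τ : ∀ {x} → x ∈F → σ (τ x) ≡ x
  σ-τ {x} x∈ = begin
    (x ^ (2 ℕ.^ k)) ^ (2 ℕ.^ ((e ℕ.+ 1) ℕ./ 2)) ≡⟨ cong (λ m → τ x ^ (2 ℕ.^ m)) ⌈e/2⌉≡1+k ⟩
    (x ^ (2 ℕ.^ k)) ^ (2 ℕ.^ ℕ.suc k)           ≡⟨ ^-assocʳ x (2 ℕ.^ k) (2 ℕ.^ ℕ.suc k) ⟩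
    x ^ (2 ℕ.^ k ℕ.* 2 ℕ.^ ℕ.suc k)             ≡⟨ cong (x ^_) (ℕ.^-distribˡ-+-* 2 k (ℕ.suc k)) ⟨
    x ^ (2 ℕ.^ (k ℕ.+ ℕ.suc k))                 ≡⟨ cong (λ m → x ^ (2 ℕ.^ m)) (ℕ.suc-injective 2⌈e/2⌉≡1+e) ⟩
    x ^ q                                       ≡⟨ x∈ ⟩
    x                                           ∎

  -- On 𝔽_q the map σ is a square root of the Frobenius map, since its exponent squared is 2^(e+1) =
  -- 2q.
  σ-σ : ∀ {x} → x ∈F → σ (σ x) ≡ x * x
  σ-σ {x} x∈ = begin
    σ (σ x)           ≡⟨ cong σ (σ≡τ² x) ⟩
    σ (τ x * τ x)     ≡⟨ σ-* (τ x) (τ x) ⟩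
    σ (τ x) * σ (τ x) ≡⟨ cong₂ _*_ (σ-τ x∈) (σ-τ x∈) ⟩
    x * x             ∎

  ovoid : Carrier → Carrier → Carrier
  ovoid α β = σ α * (α * α) + α * β + σ β

  ovoid-∈F : ∀ {α β} → α ∈F → β ∈F → ovoid α β ∈F
  ovoid-∈F α∈ β∈ = +-∈F (+-∈F (*-∈F (σ-∈F α∈) (*-∈F α∈ α∈)) (*-∈F α∈ β∈)) (σ-∈F β∈)

  -- The shear σ u α is chosen to kill the nonlinear cross terms: multiplied by α it cancels σ u α²,
  -- and its image under σ, which is u² σ α by `σ-σ`, cancels the u² σ α from the expanded first
  -- term. What remains is linear in α and β.
  ovoid-translate : ∀ {u} α β t → u ∈F →
    ovoid (α + u) (β + t + σ u * α) ≡ ovoid α β + (ovoid u t + ((t + σ u * u) * α + u * β))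
  ovoid-translate {u} α β t u∈ = begin
    σ (α + u) * ((α + u) * (α + u)) + (α + u) * (β + t + σ u * α) + σ (β + t + σ u * α)
      ≡⟨ cong₂ (λ y z → y * ((α + u) * (α + u)) + (α + u) * (β + t + σ u * α) + z) (σ-+ α u) σβ′ ⟩
    (σ α + σ u) * ((α + u) * (α + u)) + (α + u) * (β + t + σ u * α) + (σ β + σ t + u * u * σ α)
      ≡⟨ solve 8 (λ α β u t σα σβ σu σt →
            (σα :+ σu) :* ((α :+ u) :* (α :+ u)) :+ (α :+ u) :* (β :+ t :+ σu :* α) :+
                (σβ :+ σt :+ u :* u :* σα) :=
            (σα :* (α :* α) :+ α :* β :+ σβ) :+
                ((σu :* (u :* u) :+ u :* t :+ σt) :+ ((t :+ σu :* u) :* α :+ u :* β)))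
            refl α β u t (σ α) (σ β) (σ u) (σ t) ⟩
    ovoid α β + (ovoid u t + ((t + σ u * u) * α + u * β)) ∎
    where
    σβ′ : σ (β + t + σ u * α) ≡ σ β + σ t + u * u * σ α
    σβ′ = begin
      σ (β + t + σ u * α)         ≡⟨ σ-+ (β + t) (σ u * α) ⟩
      σ (β + t) + σ (σ u * α)     ≡⟨ cong₂ _+_ (σ-+ β t) (σ-* (σ u) α) ⟩
      σ β + σ t + σ (σ u) * σ α   ≡⟨ cong (λ z → σ β + σ t + z * σ α) (σ-σ u∈) ⟩
      σ β + σ t + u * u * σ α     ∎

  -- With α of weight 1 and β of weight σ + 1 all three terms have weight σ + 2; for σ β this is σ
  -- (σ + 1) = 2 + σ, by `σ-σ`.
  ovoid-scale : ∀ {c} α β → c ∈F → ovoid (c * α) (σ c * c * β) ≡ σ c * (c * c) * ovoid α β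
  ovoid-scale {c} α β c∈ = begin
    σ (c * α) * (c * α * (c * α)) + c * α * (σ c * c * β) + σ (σ c * c * β)
      ≡⟨ cong₂ (λ y z → y * (c * α * (c * α)) + c * α * (σ c * c * β) + z) (σ-* c α)
           (trans (σ-* (σ c * c) β) (cong (_* σ β) (trans (σ-* (σ c) c) (cong (_* σ c) (σ-σ c∈))))) ⟩
    σ c * σ α * (c * α * (c * α)) + c * α * (σ c * c * β) + c * c * σ c * σ β
      ≡⟨ solve 6 (λ c α β σc σα σβ →
           σc :* σα :* (c :* α :* (c :* α)) :+ c :* α :* (σc :* c :* β) :+ c :* c :* σc :* σβ :=
           σc :* (c :* c) :* (σα :* (α :* α) :+ α :* β :+ σβ)) refl c α β (σ c) (σ α) (σ β) ⟩
    σ c * (c * c) * ovoid α β ∎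

  -- If σ β = β + 1 then β² = σ (σ β) = β, so β ∈ {0, 1} is fixed by σ.
  ovoid-1≢0 : ∀ {β} → β ∈F → ovoid 1# β ≢ 0#
  ovoid-1≢0 {β} β∈ eq = 0≢1 (begin
    0#                ≡⟨ +-self (σ β) ⟨
    σ β + σ β         ≡⟨ cong (_+ σ β) σβ≡β ⟩
    β + σ β           ≡⟨ cong (β +_) σβ ⟩
    β + (β + 1#)      ≡⟨ solve 1 (λ β → β :+ (β :+ con true) := con true) refl β ⟩
    1#                ∎)
    where
    σβ : σ β ≡ β + 1#
    σβ = sym (+-cancel (begin
      β + 1# + σ β
        ≡⟨ solve 2 (λ β σβ → β :+ con true :+ σβ := con true :*
             (con true :* con true) :+ con true :* β :+ σβ) refl β (σ β) ⟩
      1# * (1# * 1#) + 1# * β + σ β   ≡⟨ cong (λ z → z * (1# * 1#) + 1# * β + σ β) σ-1 ⟨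
      ovoid 1# β                      ≡⟨ eq ⟩
      0#                              ∎))
    β² : β * β ≡ β
    β² = begin
      β * β       ≡⟨ σ-σ β∈ ⟨
      σ (σ β)     ≡⟨ cong σ σβ ⟩
      σ (β + 1#)  ≡⟨ σ-+ β 1# ⟩
      σ β + σ 1#  ≡⟨ cong₂ _+_ σβ σ-1 ⟩
      β + 1# + 1# ≡⟨ solve 1 (λ β → β :+ con true :+ con true := β) refl β ⟩
      β           ∎
    σβ≡β : σ β ≡ β
    σβ≡β with β ≟ 0#
    ... | yes β≡0 = trans (cong σ β≡0) (trans σ-0 (sym β≡0))
    ... | no β≢0 = trans (cong σ β≡1) (trans σ-1 (sym β≡1))
      where
      β≡1 : β ≡ 1#
      β≡1 = *-cancelˡ-nonzero β≢0 (trans β² (sym (*-identityʳ β)))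

  -- If α is nonzero, scaling by its inverse reduces to α = 1, where there is no zero; if α = 0,
  -- only σ β remains.
  ovoid≡0 : ∀ {α β} → α ∈F → β ∈F → ovoid α β ≡ 0# → α ≡ 0# × β ≡ 0#
  ovoid≡0 {α} {β} α∈ β∈ eq with α ≟ 0#
  ... | no α≢0 = contradiction
    (begin
      ovoid 1# (σ c * c * β)        ≡⟨ cong (λ z → ovoid z (σ c * c * β)) cα≡1 ⟨
      ovoid (c * α) (σ c * c * β)   ≡⟨ ovoid-scale α β c∈ ⟩
      σ c * (c * c) * ovoid α β     ≡⟨ cong (σ c * (c * c) *_) eq ⟩
      σ c * (c * c) * 0#            ≡⟨ zeroʳ _ ⟩
      0#                            ∎)
    (ovoid-1≢0 (*-∈F (*-∈F (σ-∈F c∈) c∈) β∈))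
    where
    c = proj₁ (inverse α α≢0)
    c∈ : c ∈F
    c∈ = inverse-∈F α∈ (proj₂ (inverse α α≢0))
    cα≡1 : c * α ≡ 1#
    cα≡1 = trans (*-comm c α) (proj₂ (inverse α α≢0))
  ... | yes refl with β ≟ 0#
  ...   | yes β≡0 = refl , β≡0
  ...   | no β≢0 = contradiction
    (begin
      σ β
        ≡⟨ solve 3 (λ β σβ σ0 → σβ := σ0 :* (con false :* con false) :+ con false :* β :+ σβ) refl β (σ β)
             (σ 0#) ⟩
      ovoid 0# β      ≡⟨ eq ⟩
      0#              ∎)
    (^-nonzero s β≢0)

  -- Written term by term like `Γ`, so that evaluating the polynomial expression yields it
  -- definitionally.
  Γ̂ : Carrier → Carrier
  Γ̂ x =
      (x + (x ^ q + x) * ε) ^ (s ℕ.+ 2)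
    + (x ^ q + x) ^ s
    + (x ^ (2 ℕ.* q) + x ^ 2) * ε
    + x ^ (q ℕ.+ 1)
    + x ^ 2

  -- The last three terms of Γ are the product re x · Tr x multiplied out.
  Γ̂≡ovoid : ∀ x → Γ̂ x ≡ ovoid (re x) (Tr x)
  Γ̂≡ovoid x = begin
    Γ̂ x
      ≡⟨ cong₂ (λ y z → y + σ (Tr x) + (z + x ^ 2) * ε + x ^ (q ℕ.+ 1) + x ^ 2)
           (^-homo-* (re x) s 2)
           (trans (^-homo-* x q (q ℕ.+ 0)) (cong (λ m → x ^ q * x ^ m) (ℕ.+-identityʳ q))) ⟩
    σ (re x) * re x ^ 2 + σ (Tr x) + (x ^ q * x ^ q + x ^ 2) * ε + x ^ (q ℕ.+ 1) + x ^ 2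
      ≡⟨ cong (λ y → σ (re x) * re x ^ 2 + σ (Tr x) + (x ^ q * x ^ q + x ^ 2) * ε + y + x ^ 2)
           (^-homo-* x q 1) ⟩
    σ (re x) * re x ^ 2 + σ (Tr x) + (x ^ q * x ^ q + x ^ 2) * ε + x ^ q * x ^ 1 + x ^ 2
      ≡⟨ solve 5 (λ x x̄ ε σa σb →
           let a = x :+ (x̄ :+ x) :* ε; _^2 = λ y → y :* (y :* con true) in
           σa :* a ^2 :+ σb :+ (x̄ :* x̄ :+ x ^2) :* ε :+ x̄ :* (x :* con true) :+ x ^2 :=
           σa :* (a :* a) :+ a :* (x̄ :+ x) :+ σb)
           refl x (x ^ q) ε (σ (re x)) (σ (Tr x)) ⟩
    ovoid (re x) (Tr x) ∎

  Γ̂-∈F : ∀ x → Γ̂ x ∈F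
  Γ̂-∈F x = subst _∈F (sym (Γ̂≡ovoid x)) (ovoid-∈F (re-∈F x) (Tr-∈F x))

  Γ̂-+ε : ∀ {α β} → α ∈F → β ∈F → Γ̂ (α + β * ε) ≡ ovoid α β
  Γ̂-+ε α∈ β∈ = trans (Γ̂≡ovoid _) (cong₂ ovoid (re-+ε α∈ β∈) (Tr-+ε α∈ β∈))

-- Coefficients of the constant and of the point mass in the distribution of a sum of m terms. A
-- further term runs over q² arguments, which multiplies the constant by q²; the point mass becomes
-- a copy of the distribution q + 1 minus q times a point mass, so B contributes q + 1 times to A
-- and -q times to itself.
A B : ℤ → ℕ → ℤ
A Q ℕ.zero    = 0ℤ
A Q (ℕ.suc m) = Q ℤ.* Q ℤ.* A Q m ℤ.+ (Q ℤ.+ 1ℤ) ℤ.* B Q m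
B Q ℕ.zero    = 1ℤ
B Q (ℕ.suc m) = ℤ.- Q ℤ.* B Q m

-- Extracts the order q of the subfield from its square.
square-injective : ∀ {m n} → m ℕ.* m ≡ n ℕ.* n → m ≡ n
square-injective {m} {n} m²≡n² with ℕ.<-cmp m n
... | tri< m<n _ _ = contradiction m²≡n² (ℕ.<⇒≢ (ℕ.*-mono-< m<n m<n))
... | tri≈ _ m≡n _ = m≡n
... | tri> _ _ n<m = contradiction (sym m²≡n²) (ℕ.<⇒≢ (ℕ.*-mono-< n<m n<m))

-- Solves (q - 1) X = q² - 1 for the common frequency X of the nonzero values.
*-cancelʳ-[n-1] : ∀ {n i j} → 2 ℕ.≤ n →
  i ℤ.* (ℤ.+ n ℤ.- 1ℤ) ≡ j ℤ.* (ℤ.+ n ℤ.- 1ℤ) → i ≡ j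
*-cancelʳ-[n-1] {ℕ.suc (ℕ.suc n)} {i} {j} _ = ℤ.*-cancelʳ-≡ i j (ℤ.+ ℕ.suc n)
*-cancelʳ-[n-1] {1} (ℕ.s≤s ())

-- Counting solutions over 𝔽_(q²)

module Counting
  (e k : ℕ) (⌈e/2⌉≡1+k : (e ℕ.+ 1) ℕ./ 2 ≡ ℕ.suc k)
  (2⌈e/2⌉≡1+e : ℕ.suc k ℕ.+ ℕ.suc k ≡ ℕ.suc e)
  (K : FiniteField ((2 ℕ.^ e) ℕ.^ 2)) (ε : FiniteField.Carrier K) (isParameter : IsParameter K e ε) where
  open FiniteField K
  open CommutativeRing commutativeRing
    using (+-identityˡ; zeroˡ; *-identityˡ; *-identityʳ; *-comm; *-assoc; +-assoc; +-comm)
  open FiniteFieldProperties K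
  open SuzukiTits e k ⌈e/2⌉≡1+k 2⌈e/2⌉≡1+e K ε isParameter
  open Characteristic2 K 1+1≡0
  open Solver using (solve; _:=_; _:+_; _:*_; con)
  open ≡-Reasoning

  Q : ℤ
  Q = ℤ.+ q

  2≤q : 2 ℕ.≤ q
  2≤q = ℕ.^-monoʳ-≤ 2 (subst (1 ℕ.≤_) (trans (sym (ℕ.+-suc k k)) (ℕ.suc-injective 2⌈e/2⌉≡1+e))
      (ℕ.s≤s ℕ.z≤n))

  length-elements-Q : ℤ.+ length elements ≡ Q ℤ.* Q
  length-elements-Q = trans (cong ℤ.+_ (trans length-elements (cong (q ℕ.*_) (ℕ.*-identityʳ q))))
      (ℤ.pos-* q q)

  ∑-elements-1 : ∑ elements (λ _ → 1ℤ) ≡ Q ℤ.* Q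
  ∑-elements-1 = trans (∑-const elements 1ℤ) (trans (ℤ.*-identityʳ _) length-elements-Q)

  +-involutive : ∀ c x → x + c + c ≡ x
  +-involutive c x = solve 2 (λ x c → x :+ c :+ c := x) refl x c

  private
    #F : ℤ
    #F = ∑ elements (λ x → [[ F? x ]])

    -- Adding γ ε to y adds γ to its trace, so every fibre of the trace over 𝔽_q is a translate of
    -- the kernel 𝔽_q.
    ∑-Tr : ∀ {γ} → γ ∈F → ∑ elements (λ y → [[ Tr y ≟ γ ]]) ≡ #F
    ∑-Tr {γ} γ∈ = trans
      (sym (∑-bijection (_+ γ * ε) (_+ γ * ε) (+-involutive (γ * ε)) (+-involutive (γ * ε))
          (λ y → [[ Tr y ≟ γ ]])))
      (∑-cong elements λ y → [[]]-cong (Tr (y + γ * ε) ≟ γ) (F? y)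
        (λ eq → Tr≡0⇒∈F (trans (+-move (trans (sym (Tr-shift y)) eq)) (+-self γ)))
        (λ y∈ → trans (Tr-shift y) (trans (cong (_+ γ) (Tr-F y∈)) (+-identityˡ γ))))
      where
      Tr-shift : ∀ y → Tr (y + γ * ε) ≡ Tr y + γ
      Tr-shift y = trans (Tr-+ y (γ * ε))
        (cong (Tr y +_) (trans (Tr-* ε γ∈) (trans (cong (γ *_) Tr-ε) (*-identityʳ γ))))

    ∑-value : ∀ (f : Carrier → Carrier) → ∑ elements (λ γ → ∑ elements (λ x → [[ f x ≟ γ ]])) ≡ Q ℤ.* Q
    ∑-value f = begin
      ∑ elements (λ γ → ∑ elements (λ x → [[ f x ≟ γ ]]))
        ≡⟨ ∑-comm elements elements (λ γ x → [[ f x ≟ γ ]]) ⟩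
      ∑ elements (λ x → ∑ elements (λ γ → [[ f x ≟ γ ]]))
        ≡⟨ ∑-cong elements (λ x → ∑-unique (f x ≟_) (f x) refl (λ _ → sym)) ⟩
      ∑ elements (λ x → 1ℤ)
        ≡⟨ ∑-elements-1 ⟩
      Q ℤ.* Q ∎

    ∑-value-∉F : ∀ {γ} (f : Carrier → Carrier) → (∀ x → f x ∈F) → ¬ γ ∈F → ∑ elements (λ x → [[ f x ≟ γ ]])
        ≡ 0ℤ
    ∑-value-∉F f f∈ γ∉ = trans
      (∑-cong elements (λ x → [[]]-false (f x ≟ _) (λ eq → γ∉ (subst _∈F eq (f∈ x)))))
      (∑-zero elements)

    -- The subfield is given only as the fixed points of x ↦ x^q, so its size has to be found: the
    -- trace splits the q² elements into fibres over 𝔽_q, each as large as 𝔽_q.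
    #F²≡Q² : #F ℤ.* #F ≡ Q ℤ.* Q
    #F²≡Q² = begin
      #F ℤ.* #F
        ≡⟨ ∑-*ʳ elements #F (λ γ → [[ F? γ ]]) ⟨
      ∑ elements (λ γ → [[ F? γ ]] ℤ.* #F)
        ≡⟨ ∑-cong elements fibre ⟩
      ∑ elements (λ γ → ∑ elements (λ y → [[ Tr y ≟ γ ]]))
        ≡⟨ ∑-value Tr ⟩
      Q ℤ.* Q ∎
      where
      fibre : ∀ γ → [[ F? γ ]] ℤ.* #F ≡ ∑ elements (λ y → [[ Tr y ≟ γ ]])
      fibre γ = by-cases (F? γ)
        where
        by-cases : (d : Dec (γ ∈F)) → [[ d ]] ℤ.* #F ≡ ∑ elements (λ y → [[ Tr y ≟ γ ]])
        by-cases (yes γ∈) = trans (ℤ.*-identityˡ #F) (sym (∑-Tr γ∈))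
        by-cases (no γ∉)  = trans (ℤ.*-zeroˡ #F) (sym (∑-value-∉F Tr Tr-∈F γ∉))

  card-F : ∑ elements (λ x → [[ F? x ]]) ≡ Q
  card-F = trans (sym (length-filter F? elements)) (cong ℤ.+_ (square-injective (ℤ.+-injective (begin
    ℤ.+ (l ℕ.* l)     ≡⟨ ℤ.pos-* l l ⟩
    ℤ.+ l ℤ.* ℤ.+ l   ≡⟨ cong₂ ℤ._*_ (length-filter F? elements) (length-filter F? elements) ⟩
    #F ℤ.* #F         ≡⟨ #F²≡Q² ⟩
    Q ℤ.* Q           ≡⟨ ℤ.pos-* q q ⟨
    ℤ.+ (q ℕ.* q)     ∎))))
    where l = length (filter F? elements)

  card-Tr-fibre : ∀ {γ} → γ ∈F → ∑ elements (λ y → [[ Tr y ≟ γ ]]) ≡ Q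
  card-Tr-fibre γ∈ = trans (∑-Tr γ∈) card-F

  private
    #Γ : Carrier → ℤ
    #Γ γ = ∑ elements (λ x → [[ Γ̂ x ≟ γ ]])

    #Γ-0 : #Γ 0# ≡ 1ℤ
    #Γ-0 = ∑-unique (λ x → Γ̂ x ≟ 0#) 0# Γ̂0 unique
      where
      unique : ∀ x → Γ̂ x ≡ 0# → x ≡ 0#
      unique x eq = begin
        x                ≡⟨ re-+Tr x ⟨
        re x + Tr x * ε  ≡⟨ cong₂ (λ a b → a + b * ε) (proj₁ both≡0) (proj₂ both≡0) ⟩
        0# + 0# * ε      ≡⟨ solve 1 (λ ε → con false :+ con false :* ε := con false) refl ε ⟩
        0#               ∎
        where both≡0 = ovoid≡0 (re-∈F x) (Tr-∈F x) (trans (sym (Γ̂≡ovoid x)) eq)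
      Γ̂0 : Γ̂ 0# ≡ 0#
      Γ̂0 = begin
        Γ̂ 0#              ≡⟨ cong Γ̂ (solve 1 (λ ε → con false := con false :+ con false :* ε) refl ε) ⟩
        Γ̂ (0# + 0# * ε)   ≡⟨ Γ̂-+ε 0∈F 0∈F ⟩
        ovoid 0# 0#
          ≡⟨ solve 1 (λ x → x :* (con false :* con false) :+ con false :* con false :+ x := x) refl (σ 0#) ⟩
        σ 0#              ≡⟨ σ-0 ⟩
        0#                ∎

    scale : Carrier → Carrier → Carrier
    scale c x = c * re x + σ c * c * Tr x * ε

    module _ {c} (c∈ : c ∈F) (x : Carrier) where
      private
        cre∈ : c * re x ∈F
        cre∈ = *-∈F c∈ (re-∈F x)
        cTr∈ : σ c * c * Tr x ∈F
        cTr∈ = *-∈F (*-∈F (σ-∈F c∈) c∈) (Tr-∈F x)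

      re-scale : re (scale c x) ≡ c * re x
      re-scale = re-+ε cre∈ cTr∈

      Tr-scale : Tr (scale c x) ≡ σ c * c * Tr x
      Tr-scale = Tr-+ε cre∈ cTr∈

      Γ̂-scale : Γ̂ (scale c x) ≡ σ c * (c * c) * Γ̂ x
      Γ̂-scale = begin
        Γ̂ (scale c x)                         ≡⟨ Γ̂-+ε cre∈ cTr∈ ⟩
        ovoid (c * re x) (σ c * c * Tr x)     ≡⟨ ovoid-scale (re x) (Tr x) c∈ ⟩
        σ c * (c * c) * ovoid (re x) (Tr x)   ≡⟨ cong (σ c * (c * c) *_) (Γ̂≡ovoid x) ⟨
        σ c * (c * c) * Γ̂ x                   ∎

    scale-scale : ∀ {c d} → c ∈F → d ∈F → c * d ≡ 1# → ∀ x → scale c (scale d x) ≡ x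
    scale-scale {c} {d} c∈ d∈ cd≡1 x = begin
      c * re (scale d x) + σ c * c * Tr (scale d x) * ε
        ≡⟨ cong₂ (λ a b → c * a + σ c * c * b * ε) (re-scale d∈ x) (Tr-scale d∈ x) ⟩
      c * (d * re x) + σ c * c * (σ d * d * Tr x) * ε
        ≡⟨ cong₂ (λ y z → y + z * ε) (sym (*-assoc c d (re x)))
             (solve 5 (λ c d σc σd b → σc :* c :* (σd :* d :* b) := (σc :* σd) :* (c :* d) :* b) refl c d
                 (σ c) (σ d) (Tr x)) ⟩
      c * d * re x + (σ c * σ d) * (c * d) * Tr x * ε
        ≡⟨ cong₂ (λ y z → y * re x + z * y * Tr x * ε) cd≡1
             (trans (sym (σ-* c d)) (trans (cong σ cd≡1) σ-1)) ⟩
      1# * re x + 1# * 1# * Tr x * ε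
        ≡⟨ solve 3 (λ a b ε → con true :* a :+ con true :* con true :* b :* ε := a :+ b :* ε) refl (re x)
             (Tr x) ε ⟩
      re x + Tr x * ε
        ≡⟨ re-+Tr x ⟩
      x ∎

    -- σ c · c² = γ is solved by c = γ τ(γ⁻¹), because σ (τ x) = x and τ(x)² = σ x.
    #Γ-nonzero : ∀ {γ} → γ ∈F → γ ≢ 0# → #Γ γ ≡ #Γ 1#
    #Γ-nonzero {γ} γ∈ γ≢0 = begin
      #Γ γ
        ≡⟨ ∑-bijection (scale c) (scale d) (scale-scale c∈ d∈ cd≡1)
             (scale-scale d∈ c∈ (trans (*-comm d c) cd≡1)) (λ x → [[ Γ̂ x ≟ γ ]]) ⟨
      ∑ elements (λ x → [[ Γ̂ (scale c x) ≟ γ ]])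
        ≡⟨ ∑-cong elements (λ x → [[]]-cong (Γ̂ (scale c x) ≟ γ) (Γ̂ x ≟ 1#)
             (λ eq → *-cancelˡ-nonzero γ≢0 (trans (sym (Γ̂-scale-c x)) (trans eq (sym (*-identityʳ γ)))))
             (λ eq → trans (Γ̂-scale-c x) (trans (cong (γ *_) eq) (*-identityʳ γ)))) ⟩
      #Γ 1# ∎
      where
      γ⁻¹ = proj₁ (inverse γ γ≢0)
      γγ⁻¹≡1 = proj₂ (inverse γ γ≢0)
      γ⁻¹∈ : γ⁻¹ ∈F
      γ⁻¹∈ = inverse-∈F γ∈ γγ⁻¹≡1
      c = γ * τ γ⁻¹
      c∈ : c ∈F
      c∈ = *-∈F γ∈ (^-∈F (2 ℕ.^ k) γ⁻¹∈)
      σc·c²≡γ : σ c * (c * c) ≡ γ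
      σc·c²≡γ = begin
        σ c * (c * c)
          ≡⟨ cong (_* (c * c)) (trans (σ-* γ (τ γ⁻¹)) (cong (σ γ *_) (σ-τ γ⁻¹∈))) ⟩
        σ γ * γ⁻¹ * (γ * τ γ⁻¹ * (γ * τ γ⁻¹))
          ≡⟨ solve 4 (λ g h t σg → σg :* h :* (g :* t :* (g :* t)) := σg :* (t :* t) :*
               (g :* h) :* g) refl γ γ⁻¹ (τ γ⁻¹) (σ γ) ⟩
        σ γ * (τ γ⁻¹ * τ γ⁻¹) * (γ * γ⁻¹) * γ
          ≡⟨ cong₂ (λ y z → σ γ * y * z * γ) (sym (σ≡τ² γ⁻¹)) γγ⁻¹≡1 ⟩
        σ γ * σ γ⁻¹ * 1# * γ
          ≡⟨ cong (λ z → z * 1# * γ) (trans (sym (σ-* γ γ⁻¹)) (trans (cong σ γγ⁻¹≡1) σ-1)) ⟩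
        1# * 1# * γ
          ≡⟨ solve 1 (λ g → con true :* con true :* g := g) refl γ ⟩
        γ ∎
      Γ̂-scale-c : ∀ x → Γ̂ (scale c x) ≡ γ * Γ̂ x
      Γ̂-scale-c x = trans (Γ̂-scale c∈ x) (cong (_* Γ̂ x) σc·c²≡γ)
      c≢0 : c ≢ 0#
      c≢0 c≡0 = γ≢0 (trans (sym σc·c²≡γ) (trans (cong (λ z → σ z * (z * z)) c≡0)
        (solve 1 (λ y → y :* (con false :* con false) := con false) refl (σ 0#))))
      d = proj₁ (inverse c c≢0)
      cd≡1 : c * d ≡ 1#
      cd≡1 = proj₂ (inverse c c≢0)
      d∈ : d ∈F
      d∈ = inverse-∈F c∈ cd≡1

    -- All cases in one formula with a single unknown, valid on the whole field and therefore
    -- summable over it.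
    #Γ-by-#Γ1 : ∀ γ → #Γ γ ≡ [[ F? γ ]] ℤ.* #Γ 1# ℤ.+ [[ γ ≟ 0# ]] ℤ.* (1ℤ ℤ.- #Γ 1#)
    #Γ-by-#Γ1 γ = by-cases (F? γ) (γ ≟ 0#)
      where
      0-case : ∀ x → 1ℤ ≡ 1ℤ ℤ.* x ℤ.+ 1ℤ ℤ.* (1ℤ ℤ.- x)
      0-case = solve-∀
      nonzero-case : ∀ x → x ≡ 1ℤ ℤ.* x ℤ.+ 0ℤ ℤ.* (1ℤ ℤ.- x)
      nonzero-case = solve-∀
      ∉F-case : ∀ x → 0ℤ ≡ 0ℤ ℤ.* x ℤ.+ 0ℤ ℤ.* (1ℤ ℤ.- x)
      ∉F-case = solve-∀
      by-cases : (d : Dec (γ ∈F)) (d′ : Dec (γ ≡ 0#)) →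
        #Γ γ ≡ [[ d ]] ℤ.* #Γ 1# ℤ.+ [[ d′ ]] ℤ.* (1ℤ ℤ.- #Γ 1#)
      by-cases (yes γ∈) (yes refl) = trans #Γ-0 (0-case (#Γ 1#))
      by-cases (yes γ∈) (no γ≢0)   = trans (#Γ-nonzero γ∈ γ≢0) (nonzero-case (#Γ 1#))
      by-cases (no γ∉)  (yes refl) = contradiction 0∈F γ∉
      by-cases (no γ∉)  (no _)     = trans (∑-value-∉F Γ̂ Γ̂-∈F γ∉) (∉F-case (#Γ 1#))

    -- The frequencies of all values add up to q²: the value 0 is taken once, and the q - 1 other
    -- elements of 𝔽_q share the unknown frequency.
    #Γ-1 : #Γ 1# ≡ Q ℤ.+ 1ℤ
    #Γ-1 = *-cancelʳ-[n-1] 2≤q (begin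
      X ℤ.* (Q ℤ.- 1ℤ)
        ≡⟨ rearrange X Q ⟩
      Q ℤ.* X ℤ.+ 1ℤ ℤ.* (1ℤ ℤ.- X) ℤ.- 1ℤ
        ≡⟨ cong (ℤ._- 1ℤ) (cong₂ ℤ._+_
             (trans (cong (ℤ._* X) (sym card-F)) (sym (∑-*ʳ elements X (λ γ → [[ F? γ ]]))))
             (trans (cong (ℤ._* (1ℤ ℤ.- X)) (sym (∑-≟ 0#)))
                 (sym (∑-*ʳ elements (1ℤ ℤ.- X) (λ γ → [[ γ ≟ 0# ]]))))) ⟩
      ∑ elements (λ γ → [[ F? γ ]] ℤ.* X) ℤ.+ ∑ elements (λ γ → [[ γ ≟ 0# ]] ℤ.* (1ℤ ℤ.- X)) ℤ.- 1ℤ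
        ≡⟨ cong (ℤ._- 1ℤ) (∑-distrib-+ elements _ _) ⟨
      ∑ elements (λ γ → [[ F? γ ]] ℤ.* X ℤ.+ [[ γ ≟ 0# ]] ℤ.* (1ℤ ℤ.- X)) ℤ.- 1ℤ
        ≡⟨ cong (ℤ._- 1ℤ) (∑-cong elements #Γ-by-#Γ1) ⟨
      ∑ elements #Γ ℤ.- 1ℤ
        ≡⟨ cong (ℤ._- 1ℤ) (∑-value Γ̂) ⟩
      Q ℤ.* Q ℤ.- 1ℤ
        ≡⟨ factorize Q ⟩
      (Q ℤ.+ 1ℤ) ℤ.* (Q ℤ.- 1ℤ) ∎)
      where
      X = #Γ 1#
      rearrange : ∀ x y → x ℤ.* (y ℤ.- 1ℤ) ≡ y ℤ.* x ℤ.+ 1ℤ ℤ.* (1ℤ ℤ.- x) ℤ.- 1ℤ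
      rearrange = solve-∀
      factorize : ∀ y → y ℤ.* y ℤ.- 1ℤ ≡ (y ℤ.+ 1ℤ) ℤ.* (y ℤ.- 1ℤ)
      factorize = solve-∀

    #Γ-∈F : ∀ {γ} → γ ∈F → #Γ γ ≡ Q ℤ.+ 1ℤ ℤ.- Q ℤ.* [[ γ ≟ 0# ]]
    #Γ-∈F {γ} γ∈ = begin
      #Γ γ
        ≡⟨ #Γ-by-#Γ1 γ ⟩
      [[ F? γ ]] ℤ.* #Γ 1# ℤ.+ [[ γ ≟ 0# ]] ℤ.* (1ℤ ℤ.- #Γ 1#)
        ≡⟨ cong₂ (λ x y → x ℤ.* y ℤ.+ [[ γ ≟ 0# ]] ℤ.* (1ℤ ℤ.- y)) ([[]]-true (F? γ) γ∈) #Γ-1 ⟩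
      1ℤ ℤ.* (Q ℤ.+ 1ℤ) ℤ.+ [[ γ ≟ 0# ]] ℤ.* (1ℤ ℤ.- (Q ℤ.+ 1ℤ))
        ≡⟨ simplify Q [[ γ ≟ 0# ]] ⟩
      Q ℤ.+ 1ℤ ℤ.- Q ℤ.* [[ γ ≟ 0# ]] ∎
      where
      simplify : ∀ x y → 1ℤ ℤ.* (x ℤ.+ 1ℤ) ℤ.+ y ℤ.* (1ℤ ℤ.- (x ℤ.+ 1ℤ)) ≡ x ℤ.+ 1ℤ ℤ.- x ℤ.* y
      simplify = solve-∀

  Γ+linear : Carrier → Carrier → Carrier
  Γ+linear w x = Γ̂ x + Tr (w * x)

  Γ+linear-∈F : ∀ w x → Γ+linear w x ∈F
  Γ+linear-∈F w x = +-∈F (Γ̂-∈F x) (Tr-∈F (w * x))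

  private
    module Translation (w : Carrier) where
      -- Comparing the linear part of `ovoid-translate` with `Tr-product` gives u = re w + Tr w and
      -- t + σ u · u = Tr w; c₀ is the constant by which the values are shifted.
      u t c₀ : Carrier
      u = re w + Tr w
      t = Tr w + σ u * u
      c₀ = ovoid u t
      u∈ : u ∈F
      u∈ = +-∈F (re-∈F w) (Tr-∈F w)
      t∈ : t ∈F
      t∈ = +-∈F (Tr-∈F w) (*-∈F (σ-∈F u∈) u∈)
      c₀∈ : c₀ ∈F
      c₀∈ = ovoid-∈F u∈ t∈

      -- Adding u undoes itself, but the shear of φ was taken at the old first coordinate; ψ
      -- recovers that as re x + u before removing the shear.
      φ ψ : Carrier → Carrier
      φ x = (re x + u) + (Tr x + t + σ u * re x) * ε
      ψ x = (re x + u) + (Tr x + t + σ u * (re x + u)) * ε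

      re+u∈ : ∀ x → re x + u ∈F
      re+u∈ x = +-∈F (re-∈F x) u∈
      φTr∈ : ∀ x → Tr x + t + σ u * re x ∈F
      φTr∈ x = +-∈F (+-∈F (Tr-∈F x) t∈) (*-∈F (σ-∈F u∈) (re-∈F x))
      ψTr∈ : ∀ x → Tr x + t + σ u * (re x + u) ∈F
      ψTr∈ x = +-∈F (+-∈F (Tr-∈F x) t∈) (*-∈F (σ-∈F u∈) (re+u∈ x))

      φψ : ∀ x → φ (ψ x) ≡ x
      φψ x = begin
        (re (ψ x) + u) + (Tr (ψ x) + t + σ u * re (ψ x)) * ε
          ≡⟨ cong₂ (λ a b → (a + u) + (b + t + σ u * a) * ε) (re-+ε (re+u∈ x) (ψTr∈ x))
               (Tr-+ε (re+u∈ x) (ψTr∈ x)) ⟩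
        (re x + u + u) + (Tr x + t + σ u * (re x + u) + t + σ u * (re x + u)) * ε
          ≡⟨ solve 6 (λ a b u t s ε → (a :+ u :+ u) :+
               (b :+ t :+ s :* (a :+ u) :+ t :+ s :* (a :+ u)) :* ε := a :+ b :* ε)
               refl (re x) (Tr x) u t (σ u) ε ⟩
        re x + Tr x * ε
          ≡⟨ re-+Tr x ⟩
        x ∎

      ψφ : ∀ x → ψ (φ x) ≡ x
      ψφ x = begin
        (re (φ x) + u) + (Tr (φ x) + t + σ u * (re (φ x) + u)) * ε
          ≡⟨ cong₂ (λ a b → (a + u) + (b + t + σ u * (a + u)) * ε) (re-+ε (re+u∈ x) (φTr∈ x))
               (Tr-+ε (re+u∈ x) (φTr∈ x)) ⟩
        (re x + u + u) + (Tr x + t + σ u * re x + t + σ u * (re x + u + u)) * ε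
          ≡⟨ solve 6 (λ a b u t s ε → (a :+ u :+ u) :+ (b :+ t :+ s :* a :+ t :+ s :* (a :+ u :+ u)) :* ε :=
               a :+ b :* ε)
               refl (re x) (Tr x) u t (σ u) ε ⟩
        re x + Tr x * ε
          ≡⟨ re-+Tr x ⟩
        x ∎

      Γ̂-φ : ∀ x → Γ̂ (φ x) ≡ Γ+linear w x + c₀
      Γ̂-φ x = begin
        Γ̂ (φ x)
          ≡⟨ Γ̂-+ε (re+u∈ x) (φTr∈ x) ⟩
        ovoid (re x + u) (Tr x + t + σ u * re x)
          ≡⟨ ovoid-translate (re x) (Tr x) t u∈ ⟩
        ovoid (re x) (Tr x) + (c₀ + ((Tr w + σ u * u + σ u * u) * re x + u * Tr x))
          ≡⟨ solve 7 (λ o c w s a u b → o :+ (c :+ ((w :+ s :+ s) :* a :+ u :* b)) := o :+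
               (w :* a :+ u :* b) :+ c)
               refl (ovoid (re x) (Tr x)) c₀ (Tr w) (σ u * u) (re x) u (Tr x) ⟩
        ovoid (re x) (Tr x) + (Tr w * re x + u * Tr x) + c₀
          ≡⟨ cong₂ (λ y z → y + z + c₀) (Γ̂≡ovoid x) (Tr-product w x) ⟨
        Γ+linear w x + c₀ ∎

      #Γ+linear : ∀ γ → ∑ elements (λ x → [[ Γ+linear w x ≟ γ ]]) ≡ #Γ (γ + c₀)
      #Γ+linear γ = trans
        (∑-cong elements λ x → [[]]-cong (Γ+linear w x ≟ γ) (Γ̂ (φ x) ≟ (γ + c₀))
          (λ eq → trans (Γ̂-φ x) (cong (_+ c₀) eq))
          (λ eq → trans (+-move (trans (sym (Γ̂-φ x)) eq)) (+-involutive c₀ γ)))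
        (∑-bijection φ ψ φψ ψφ (λ x → [[ Γ̂ x ≟ (γ + c₀) ]]))

  tuples : ∀ m → List (Vector Carrier m)
  tuples ℕ.zero    = Vector.[] ∷ []
  tuples (ℕ.suc m) = cartesianProductWith Vector._∷_ elements (tuples m)

  ∑-tuples-suc : ∀ m (f : Vector Carrier (ℕ.suc m) → ℤ) →
    ∑ (tuples (ℕ.suc m)) f ≡ ∑ elements (λ x → ∑ (tuples m) (λ t → f (x Vector.∷ t)))
  ∑-tuples-suc m = ∑-cartesianProductWith Vector._∷_ elements (tuples m)

  ∑-elements-const : ∀ c → ∑ elements (λ _ → c) ≡ Q ℤ.* Q ℤ.* c
  ∑-elements-const c = trans (∑-const elements c) (cong (ℤ._* c) length-elements-Q)

  ∑-tuples-1 : ∀ m → ∑ (tuples m) (λ _ → 1ℤ) ≡ (Q ℤ.* Q) ℤ.^ m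
  ∑-tuples-1 ℕ.zero    = refl
  ∑-tuples-1 (ℕ.suc m) = begin
    ∑ (tuples (ℕ.suc m)) (λ _ → 1ℤ)                ≡⟨ ∑-tuples-suc m _ ⟩
    ∑ elements (λ _ → ∑ (tuples m) (λ _ → 1ℤ))     ≡⟨ ∑-cong elements (λ _ → ∑-tuples-1 m) ⟩
    ∑ elements (λ _ → (Q ℤ.* Q) ℤ.^ m)             ≡⟨ ∑-elements-const _ ⟩
    Q ℤ.* Q ℤ.* (Q ℤ.* Q) ℤ.^ m                    ∎

  ∑Γ+linear : ∀ {m} → Vector Carrier m → Vector Carrier m → Carrier
  ∑Γ+linear w x = sum (λ i → Γ+linear (w i) (x i))

  -- Each summand takes one value in 𝔽_q once and the others q + 1 times; A and B are the coefficients of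
  -- the convolution powers of this distribution.
  ∑Γ+linear-count : ∀ m (w : Vector Carrier m) → ∃ λ γ₀ → γ₀ ∈F × (∀ {γ} → γ ∈F →
    ∑ (tuples m) (λ x → [[ ∑Γ+linear w x ≟ γ ]]) ≡ A Q m ℤ.+ B Q m ℤ.* [[ γ ≟ γ₀ ]])
  ∑Γ+linear-count ℕ.zero w = 0# , 0∈F , λ {γ} _ → begin
    [[ 0# ≟ γ ]] ℤ.+ 0ℤ          ≡⟨ cong (ℤ._+ 0ℤ) ([[]]-cong (0# ≟ γ) (γ ≟ 0#) sym sym) ⟩
    [[ γ ≟ 0# ]] ℤ.+ 0ℤ          ≡⟨ simplify [[ γ ≟ 0# ]] ⟩
    0ℤ ℤ.+ 1ℤ ℤ.* [[ γ ≟ 0# ]]   ∎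
    where
    simplify : ∀ x → x ℤ.+ 0ℤ ≡ 0ℤ ℤ.+ 1ℤ ℤ.* x
    simplify = solve-∀
  -- The new summand has its exceptional value at c₀, and exceptional values add under convolution.
  ∑Γ+linear-count (ℕ.suc m) w = γ₀ + c₀ , +-∈F γ₀∈ c₀∈ , count-suc
    where
    induction = ∑Γ+linear-count m (Vector.tail w)
    γ₀ = proj₁ induction
    γ₀∈ : γ₀ ∈F
    γ₀∈ = proj₁ (proj₂ induction)
    count-m = λ {γ} → proj₂ (proj₂ induction) {γ}
    open Translation (w zero)
    simplify : ∀ x y z i → x ℤ.* x ℤ.* y ℤ.+ z ℤ.* (x ℤ.+ 1ℤ ℤ.- x ℤ.* i)
                         ≡ (x ℤ.* x ℤ.* y ℤ.+ (x ℤ.+ 1ℤ) ℤ.* z) ℤ.+ (ℤ.- x ℤ.* z) ℤ.* i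
    simplify = solve-∀
    count-suc : ∀ {γ} → γ ∈F → ∑ (tuples (ℕ.suc m)) (λ x → [[ ∑Γ+linear w x ≟ γ ]])
                ≡ A Q (ℕ.suc m) ℤ.+ B Q (ℕ.suc m) ℤ.* [[ γ ≟ (γ₀ + c₀) ]]
    count-suc {γ} γ∈ = begin
      ∑ (tuples (ℕ.suc m)) (λ x → [[ ∑Γ+linear w x ≟ γ ]])
        ≡⟨ ∑-tuples-suc m _ ⟩
      ∑ elements (λ x → ∑ (tuples m) (λ t → [[ (Γ+linear (w zero) x + ∑Γ+linear (Vector.tail w) t) ≟ γ ]]))
        ≡⟨ ∑-cong elements (λ x → ∑-cong (tuples m) (λ t → [[]]-cong (_ ≟ _) (_ ≟ _)
             (λ eq → +-move (trans (+-comm _ _) eq))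
             (λ eq → trans (cong (Γ+linear (w zero) x +_) eq) (trans (+-comm _ _) (+-involutive _ γ))))) ⟩
      ∑ elements (λ x → ∑ (tuples m) (λ t → [[ ∑Γ+linear (Vector.tail w) t ≟ (γ + Γ+linear (w zero) x) ]]))
        ≡⟨ ∑-cong elements (λ x → count-m (+-∈F γ∈ (Γ+linear-∈F (w zero) x))) ⟩
      ∑ elements (λ x → A Q m ℤ.+ B Q m ℤ.* [[ (γ + Γ+linear (w zero) x) ≟ γ₀ ]])
        ≡⟨ ∑-distrib-+ elements _ _ ⟩
      ∑ elements (λ _ → A Q m) ℤ.+ ∑ elements (λ x → B Q m ℤ.* [[ (γ + Γ+linear (w zero) x) ≟ γ₀ ]])
        ≡⟨ cong₂ ℤ._+_ (∑-elements-const (A Q m)) (∑-*ˡ elements (B Q m) _) ⟩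
      Q ℤ.* Q ℤ.* A Q m ℤ.+ B Q m ℤ.* ∑ elements (λ x → [[ (γ + Γ+linear (w zero) x) ≟ γ₀ ]])
        ≡⟨ cong (λ z → Q ℤ.* Q ℤ.* A Q m ℤ.+ B Q m ℤ.* z) (∑-cong elements (λ x → [[]]-cong (_ ≟ _) (_ ≟ _)
             (λ eq → trans (+-move (trans (+-comm _ γ) eq)) (+-comm γ₀ γ))
             (λ eq → trans (+-comm γ _)
                 (trans (cong (_+ γ) eq) (trans (cong (_+ γ) (+-comm γ γ₀)) (+-involutive γ γ₀)))))) ⟩
      Q ℤ.* Q ℤ.* A Q m ℤ.+ B Q m ℤ.* ∑ elements (λ x → [[ Γ+linear (w zero) x ≟ (γ + γ₀) ]])
        ≡⟨ cong (λ z → Q ℤ.* Q ℤ.* A Q m ℤ.+ B Q m ℤ.* z)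
             (trans (#Γ+linear (γ + γ₀)) (#Γ-∈F (+-∈F (+-∈F γ∈ γ₀∈) c₀∈))) ⟩
      Q ℤ.* Q ℤ.* A Q m ℤ.+ B Q m ℤ.* (Q ℤ.+ 1ℤ ℤ.- Q ℤ.* [[ (γ + γ₀ + c₀) ≟ 0# ]])
        ≡⟨ simplify Q (A Q m) (B Q m) _ ⟩
      A Q (ℕ.suc m) ℤ.+ B Q (ℕ.suc m) ℤ.* [[ (γ + γ₀ + c₀) ≟ 0# ]]
        ≡⟨ cong (λ z → A Q (ℕ.suc m) ℤ.+ B Q (ℕ.suc m) ℤ.* z) ([[]]-cong (_ ≟ _) (_ ≟ _)
             (λ eq → +-cancel (trans (sym (+-assoc γ γ₀ c₀)) eq))
             (λ eq → trans (+-assoc γ γ₀ c₀) (trans (cong (_+ (γ₀ + c₀)) eq) (+-self _)))) ⟩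
      A Q (ℕ.suc m) ℤ.+ B Q (ℕ.suc m) ℤ.* [[ γ ≟ (γ₀ + c₀) ]] ∎

  -- A nonzero leading coefficient lets the other variables determine the first one; a zero leading
  -- coefficient leaves the first variable free. The factor q² on the left avoids an exponent m - 1.
  linear-count : ∀ {m} (v : Vector Carrier m) i → v i ≢ 0# → ∀ c →
    Q ℤ.* Q ℤ.* ∑ (tuples m) (λ x → [[ sum (λ i → v i * x i) ≟ c ]]) ≡ (Q ℤ.* Q) ℤ.^ m
  linear-count {ℕ.suc m} v i vᵢ≢0 c = trans (cong (Q ℤ.* Q ℤ.*_) (∑-tuples-suc m _))
      (by-cases (v zero ≟ 0#) i vᵢ≢0)
    where
    by-cases : Dec (v zero ≡ 0#) → ∀ i → v i ≢ 0# →
      Q ℤ.* Q ℤ.* ∑ elements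
          (λ x → ∑ (tuples m) (λ t → [[ (v zero * x + sum (λ i → v (suc i) * t i)) ≟ c ]]))
      ≡ Q ℤ.* Q ℤ.* (Q ℤ.* Q) ℤ.^ m
    by-cases (no v₀≢0) _ _ = cong (Q ℤ.* Q ℤ.*_) (begin
      _ ≡⟨ ∑-comm elements (tuples m) _ ⟩
      ∑ (tuples m) (λ t → ∑ elements (λ x → [[ (v zero * x + sum (λ i → v (suc i) * t i)) ≟ c ]]))
        ≡⟨ ∑-cong (tuples m) (λ t → ∑-unique (λ x → (v zero * x + sum (λ i → v (suc i) * t i)) ≟ c)
             (v₀⁻¹ * (c + sum (λ i → v (suc i) * t i)))
             (trans (cong (_+ sum (λ i → v (suc i) * t i)) (v₀v₀⁻¹ _)) (+-involutive _ c))
             (λ x eq → *-cancelˡ-nonzero v₀≢0 (trans (+-move eq) (sym (v₀v₀⁻¹ _))))) ⟩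
      ∑ (tuples m) (λ _ → 1ℤ)
        ≡⟨ ∑-tuples-1 m ⟩
      (Q ℤ.* Q) ℤ.^ m ∎)
      where
      v₀⁻¹ = proj₁ (inverse (v zero) v₀≢0)
      v₀v₀⁻¹ : ∀ y → v zero * (v₀⁻¹ * y) ≡ y
      v₀v₀⁻¹ y = trans (sym (*-assoc _ _ y))
          (trans (cong (_* y) (proj₂ (inverse (v zero) v₀≢0))) (*-identityˡ y))
    by-cases (yes v₀≡0) zero v₀≢0 = contradiction v₀≡0 v₀≢0
    by-cases (yes v₀≡0) (suc i) vᵢ≢0 = cong (Q ℤ.* Q ℤ.*_) (begin
      _ ≡⟨ ∑-cong elements (λ x → ∑-cong (tuples m) (λ t → cong (λ z → [[ z ≟ c ]])
             (trans (cong (λ z → z * x + sum (λ i → v (suc i) * t i)) v₀≡0)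
                 (trans (cong (_+ sum (λ i → v (suc i) * t i)) (zeroˡ x)) (+-identityˡ _))))) ⟩
      ∑ elements (λ x → ∑ (tuples m) (λ t → [[ sum (λ i → v (suc i) * t i) ≟ c ]]))
        ≡⟨ ∑-elements-const _ ⟩
      Q ℤ.* Q ℤ.* ∑ (tuples m) (λ t → [[ sum (λ i → v (suc i) * t i) ≟ c ]])
        ≡⟨ linear-count (Vector.tail v) i vᵢ≢0 c ⟩
      (Q ℤ.* Q) ℤ.^ m ∎)

-- Homogeneous coordinates and affine points

module _ {a} {A : Set a} where

  -- Adds xᵣ at the end, matching the polynomial, whose variables are `inject₁ i` for the arguments
  -- of Γ and `fromℕ` for xᵣ.
  snoc : ∀ {n} → Vector A n → A → Vector A (ℕ.suc n)
  snoc {ℕ.zero}  xs y _       = y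
  snoc {ℕ.suc n} xs y zero    = xs zero
  snoc {ℕ.suc n} xs y (suc i) = snoc (Vector.tail xs) y i

  snoc-inject₁ : ∀ {n} (xs : Vector A n) y i → snoc xs y (inject₁ i) ≡ xs i
  snoc-inject₁ {ℕ.suc n} xs y zero    = refl
  snoc-inject₁ {ℕ.suc n} xs y (suc i) = snoc-inject₁ (Vector.tail xs) y i

  snoc-fromℕ : ∀ {n} (xs : Vector A n) y → snoc xs y (fromℕ n) ≡ y
  snoc-fromℕ {ℕ.zero}  xs y = refl
  snoc-fromℕ {ℕ.suc n} xs y = snoc-fromℕ (Vector.tail xs) y

inject₁-fromℕ-elim : ∀ {p} n (P : Fin (ℕ.suc n) → Set p) →
  (∀ i → P (inject₁ i)) → P (fromℕ n) → ∀ i → P i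
inject₁-fromℕ-elim ℕ.zero    P init last zero    = last
inject₁-fromℕ-elim (ℕ.suc n) P init last zero    = init zero
inject₁-fromℕ-elim (ℕ.suc n) P init last (suc i) =
  inject₁-fromℕ-elim n (P ∘ suc) (init ∘ suc) last i

count-positive : ∀ {n} {P : Fin n → Set} (P? : Decidable P) i → P i → count P? ≢ 0
count-positive {n} P? i Pi count≡0 with filter P? (allFin n) | List.∈-filter⁺ P? (List.∈-allFin {n} i) Pi
... | _ ∷ _ | _ = contradiction count≡0 λ()
... | []    | ()

module Geometry {n : ℕ} (K : FiniteField n) where
  open FiniteField K
  open CommutativeRing commutativeRing
    using (zeroʳ; *-identityˡ; *-identityʳ; *-comm; *-assoc)
  open FiniteFieldProperties K
  open SemiringSum semiring using (sum-cong-≗; *-distribˡ-sum; sum-init-last)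
  open ≡-Reasoning

  -- At X₀ = 1 every padding power of X₀ evaluates to 1, whatever d is.
  eval-homogenizeTo : ∀ {m} d (f : Poly K m) (X : Vector Carrier (ℕ.suc m)) → X zero ≡ 1# →
                      eval K (homogenizeTo K d f) X ≡ eval K f (Vector.tail X)
  eval-homogenizeTo d f X X₀≡1 = go d f
    where
    X₀^ : ∀ m → X zero ^ m ≡ 1#
    X₀^ m = trans (cong (_^ m) X₀≡1) (one-^ m)
    *X₀^ : ∀ {x y} m → x ≡ y → x * X zero ^ m ≡ y
    *X₀^ m x≡y = trans (cong₂ _*_ x≡y (X₀^ m)) (*-identityʳ _)
    go : ∀ d f → eval K (homogenizeTo K d f) X ≡ eval K f (Vector.tail X)
    go d (con c) = *X₀^ d refl
    go d (var i) = *X₀^ (d ℕ.∸ 1) refl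
    go d (f ⊕ g) = cong₂ _+_ (go d f) (go d g)
    go d (f ⊗ g) = *X₀^ (d ℕ.∸ (degree K f ℕ.+ degree K g))
        (cong₂ _*_ (go (degree K f) f) (go (degree K g) g))
    go d (f ↑ m) = *X₀^ (d ℕ.∸ m ℕ.* degree K f) (cong (_^ m) (go (degree K f) f))

  eval-foldr-⊕ : ∀ {m l} (fs : Vector (Poly K m) l) X →
    eval K (Vector.foldr _⊕_ (con 0#) fs) X ≡ sum (λ i → eval K (fs i) X)
  eval-foldr-⊕ {l = ℕ.zero}  fs X = refl
  eval-foldr-⊕ {l = ℕ.suc l} fs X = cong (eval K (fs zero) X +_) (eval-foldr-⊕ (Vector.tail fs) X)

  ∼-refl : ∀ {r} (P : Point K r) → _∼_ K P P
  ∼-refl P = 1# , 0≢1 ∘ sym , λ i → sym (*-identityˡ _)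

  affinePoint : ∀ {m} → Vector Carrier m → Carrier → Point K (ℕ.suc m)
  affinePoint x y = (1# Vector.∷ snoc x y) , zero , 0≢1 ∘ sym

  dot : ∀ {r} → Vector Carrier (ℕ.suc r) → Point K r → Carrier
  dot a P = sum (λ l → a l * coords K P l)

  dot-∼ : ∀ {r} (a : Vector Carrier (ℕ.suc r)) {P Q : Point K r} → ((c , _) : _∼_ K P Q) → dot a Q
      ≡ c * dot a P
  dot-∼ a {P} {Q} (c , c≢0 , Q≡cP) = begin
    sum (λ l → a l * coords K Q l)
      ≡⟨ sum-cong-≗ (λ l → trans (cong (a l *_) (Q≡cP l)) (swap (a l) c (coords K P l))) ⟩
    sum (λ l → c * (a l * coords K P l))    ≡⟨ *-distribˡ-sum c (λ l → a l * coords K P l) ⟨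
    c * sum (λ l → a l * coords K P l)      ∎
    where
    swap : ∀ x y z → x * (y * z) ≡ y * (x * z)
    swap x y z = trans (sym (*-assoc x y z)) (trans (cong (_* z) (*-comm x y)) (*-assoc y x z))

  dot-affinePoint : ∀ {m} (a : Vector Carrier (ℕ.suc (ℕ.suc m))) x y →
    dot a (affinePoint x y) ≡ a zero + (sum (λ i → a (suc (inject₁ i)) * x i) + a (suc (fromℕ m)) * y)
  dot-affinePoint {m} a x y = cong₂ _+_ (*-identityʳ (a zero)) (trans
    (sum-init-last (λ l → a (suc l) * snoc x y l))
    (cong₂ _+_ (sum-cong-≗ (λ i → cong (a (suc (inject₁ i)) *_) (snoc-inject₁ x y i)))
               (cong (a (suc (fromℕ m)) *_) (snoc-fromℕ x y))))

  sum-unit : ∀ {m} (x : Vector Carrier m) k →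
    sum (λ l → x l * (if does (l Fin.≟ k) then 1# else 0#)) ≡ x k
  sum-unit x k = trans
    (sum-cong-≗ (λ l → by-cases (x l) (l Fin.≟ k) (cong x)))
    (sum-if-≟ +-commutativeMonoid k (x k))
    where
    by-cases : ∀ {l} {y} z (d : Dec (l ≡ k)) → (l ≡ k → z ≡ y) →
      z * (if does d then 1# else 0#) ≡ (if does d then y else 0#)
    by-cases z (yes l≡) z≡y = trans (*-identityʳ z) (z≡y l≡)
    by-cases z (no _)   z≡y = zeroʳ z

  dot-P∞ : ∀ {r} (a : Vector Carrier (ℕ.suc r)) → dot a (P∞ K r) ≡ a (fromℕ r)
  dot-P∞ {r} a = sum-unit a (fromℕ r)

  ≁P∞ : ∀ {r} (P : Point K (ℕ.suc r)) → ¬ AtInfinity K P → ¬ _∼_ K P (P∞ K (ℕ.suc r))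
  ≁P∞ P P₀≢0 (c , c≢0 , eq) = *-nonzero c≢0 P₀≢0 (sym (eq zero))

  ≁affinePoint : ∀ {m} (P : Point K (ℕ.suc m)) → AtInfinity K P → ∀ x y → ¬ _∼_ K P (affinePoint x y)
  ≁affinePoint P P₀≡0 x y (c , c≢0 , eq) =
    0≢1 (sym (trans (eq zero) (trans (cong (c *_) P₀≡0) (zeroʳ c))))

  module _ {m} (P : Point K (ℕ.suc m)) (P₀≢0 : ¬ AtInfinity K P) where
    private
      h : Carrier
      h = proj₁ (inverse _ P₀≢0)
      P₀h≡1 : coords K P zero * h ≡ 1#
      P₀h≡1 = proj₂ (inverse _ P₀≢0)

    affineCoords : Vector Carrier m
    affineCoords i = h * coords K P (suc (inject₁ i))

    lastAffineCoord : Carrier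
    lastAffineCoord = h * coords K P (suc (fromℕ m))

    -- The zeroth coordinates force the scalar to be the inverse of X₀, so a point off the
    -- hyperplane at infinity has a single normalized form.
    ∼affinePoint⇒ : ∀ x y → _∼_ K P (affinePoint x y) → (∀ i → x i ≡ affineCoords i) × y ≡ lastAffineCoord
    ∼affinePoint⇒ x y (c , c≢0 , eq) =
        (λ i → trans (sym (snoc-inject₁ x y i)) (coordinate (inject₁ i)))
      , trans (sym (snoc-fromℕ x y)) (coordinate (fromℕ m))
      where
      c≡h : c ≡ h
      c≡h = *-cancelˡ-nonzero P₀≢0 (trans (*-comm _ c) (trans (sym (eq zero)) (sym P₀h≡1)))
      coordinate : ∀ i → snoc x y i ≡ h * coords K P (suc i)
      coordinate i = trans (eq (suc i)) (cong (_* coords K P (suc i)) c≡h)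

    ⇒∼affinePoint : ∀ x y → (∀ i → x i ≡ affineCoords i) × y ≡ lastAffineCoord → _∼_ K P (affinePoint x y)
    ⇒∼affinePoint x y (x≡ , y≡) = h , h≢0 , λ
      { zero    → trans (sym P₀h≡1) (*-comm _ h)
      ; (suc i) → inject₁-fromℕ-elim m (λ i → snoc x y i ≡ h * coords K P (suc i))
          (λ i → trans (snoc-inject₁ x y i) (x≡ i)) (trans (snoc-fromℕ x y) y≡) i }
      where
      h≢0 : h ≢ 0#
      h≢0 h≡0 = 0≢1 (trans (sym (zeroʳ _)) (trans (cong (coords K P zero *_) (sym h≡0)) P₀h≡1))

-- From the listed multiset to point counts, and weights by hyperplane

module HypersurfaceCode
  (e k : ℕ) (⌈e/2⌉≡1+k : (e ℕ.+ 1) ℕ./ 2 ≡ ℕ.suc k)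
  (2⌈e/2⌉≡1+e : ℕ.suc k ℕ.+ ℕ.suc k ≡ ℕ.suc e)
  (K : FiniteField ((2 ℕ.^ e) ℕ.^ 2)) (ε : FiniteField.Carrier K) (isParameter : IsParameter K e ε) where
  open FiniteField K
  open CommutativeRing commutativeRing
    using (+-identityʳ; zeroˡ; zeroʳ; *-identityˡ; *-identityʳ; *-assoc; +-assoc; distribˡ)
  open SemiringSum semiring using (sum-cong-≗; *-distribˡ-sum) renaming (∑-distrib-+ to sum-distrib-+)
  open FiniteFieldProperties K
  open Geometry K
  open SuzukiTits e k ⌈e/2⌉≡1+k 2⌈e/2⌉≡1+e K ε isParameter
  open Counting e k ⌈e/2⌉≡1+k 2⌈e/2⌉≡1+e K ε isParameter
  open Characteristic2 K 1+1≡0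
  open ≡-Reasoning

  ∑Γ : ∀ {m} → Vector Carrier m → Carrier
  ∑Γ x = sum (λ i → Γ̂ (x i))

  ∑Γ-∈F : ∀ {m} (x : Vector Carrier m) → ∑Γ x ∈F
  ∑Γ-∈F {ℕ.zero}  x = 0∈F
  ∑Γ-∈F {ℕ.suc m} x = +-∈F (Γ̂-∈F (x zero)) (∑Γ-∈F (Vector.tail x))

  eval-𝒱 : ∀ {m} (x : Vector Carrier m) y →
    eval K (homogenization K (affinePolynomial K (ℕ.suc m) e ε)) (coords K (affinePoint x y)) ≡ Tr y + ∑Γ x
  eval-𝒱 {m} x y = trans
    (eval-homogenizeTo (degree K (affinePolynomial K (ℕ.suc m) e ε)) (affinePolynomial K (ℕ.suc m) e ε)
        (coords K (affinePoint x y)) refl)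
    (cong₂ _+_ (cong Tr (snoc-fromℕ x y))
      (trans (cong₂ _*_ -1≡1 (trans
          (eval-foldr-⊕ (λ i → Γ K e ε (var (inject₁ i))) (snoc x y))
          (sum-cong-≗ (λ i → cong Γ̂ (snoc-inject₁ x y i)))))
        (*-identityˡ (∑Γ x))))

  -- Vectors are functions and are compared coordinatewise; up to this comparison `tuples` contains
  -- every vector exactly once.
  ∑-tuples-≗ : ∀ {m} (c : Vector Carrier m) →
    ∑ (tuples m) (λ x → [[ Fin.all? (λ i → x i ≟ c i) ]]) ≡ 1ℤ
  ∑-tuples-≗ {ℕ.zero}  c = refl
  ∑-tuples-≗ {ℕ.suc m} c = begin
    ∑ (tuples (ℕ.suc m)) (λ x → [[ Fin.all? (λ i → x i ≟ c i) ]])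
      ≡⟨ ∑-tuples-suc m _ ⟩
    ∑ elements (λ x → ∑ (tuples m) (λ t → [[ Fin.all? (λ i → (x Vector.∷ t) i ≟ c i) ]]))
      ≡⟨ ∑-cong elements (λ x → ∑-cong (tuples m) (λ t → trans
           ([[]]-cong (Fin.all? (λ i → (x Vector.∷ t) i ≟ c i))
             ((x ≟ c zero) ×-dec Fin.all? (λ i → t i ≟ c (suc i)))
             (λ eq → eq zero , eq ∘ suc) (λ { (eq , eqs) zero → eq ; (eq , eqs) (suc i) → eqs i }))
           ([[]]-× (x ≟ c zero) (Fin.all? (λ i → t i ≟ c (suc i)))))) ⟩
    ∑ elements (λ x → ∑ (tuples m) (λ t → [[ x ≟ c zero ]] ℤ.* [[ Fin.all? (λ i → t i ≟ c (suc i)) ]]))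
      ≡⟨ ∑-cong elements (λ x → ∑-*ˡ (tuples m) [[ x ≟ c zero ]]
           (λ t → [[ Fin.all? (λ i → t i ≟ c (suc i)) ]])) ⟩
    ∑ elements (λ x → [[ x ≟ c zero ]] ℤ.* ∑ (tuples m) (λ t → [[ Fin.all? (λ i → t i ≟ c (suc i)) ]]))
      ≡⟨ ∑-cong elements (λ x → cong ([[ x ≟ c zero ]] ℤ.*_) (∑-tuples-≗ (Vector.tail c))) ⟩
    ∑ elements (λ x → [[ x ≟ c zero ]] ℤ.* 1ℤ)
      ≡⟨ ∑-pick (c zero) (λ _ → 1ℤ) ⟩
    1ℤ ∎

  ∑-∼affinePoint : ∀ {m} (P : Point K (ℕ.suc m)) → ¬ AtInfinity K P →
    ∑ (tuples m) (λ x → ∑ elements (λ y → [[ _∼?_ K P (affinePoint x y) ]])) ≡ 1ℤ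
  ∑-∼affinePoint {m} P P₀≢0 = begin
    ∑ (tuples m) (λ x → ∑ elements (λ y → [[ _∼?_ K P (affinePoint x y) ]]))
      ≡⟨ ∑-cong (tuples m) (λ x → ∑-cong elements (λ y → trans
           ([[]]-cong (_∼?_ K P (affinePoint x y)) (Fin.all? (λ i → x i ≟ c i) ×-dec (y ≟ c′))
              (∼affinePoint⇒ P P₀≢0 x y) (⇒∼affinePoint P P₀≢0 x y))
           ([[]]-× (Fin.all? (λ i → x i ≟ c i)) (y ≟ c′)))) ⟩
    ∑ (tuples m) (λ x → ∑ elements (λ y → [[ Fin.all? (λ i → x i ≟ c i) ]] ℤ.* [[ y ≟ c′ ]]))
      ≡⟨ ∑-cong (tuples m) (λ x → trans
           (∑-*ˡ elements [[ Fin.all? (λ i → x i ≟ c i) ]] (λ y → [[ y ≟ c′ ]]))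
               (trans (cong ([[ Fin.all? (λ i → x i ≟ c i) ]] ℤ.*_) (∑-≟ c′)) (ℤ.*-identityʳ _))) ⟩
    ∑ (tuples m) (λ x → [[ Fin.all? (λ i → x i ≟ c i) ]])
      ≡⟨ ∑-tuples-≗ c ⟩
    1ℤ ∎
    where
    c = affineCoords P P₀≢0
    c′ = lastAffineCoord P P₀≢0

  module _ {n j N : ℕ} (G : Fin N → Point K (ℕ.suc n)) (lists : Lists K G (𝒱̄ K (ℕ.suc n) e ε j)) where

    private
      r = ℕ.suc n
      J = ℤ.+ j

    multiplicity-affinePoint : ∀ x y → ℤ.+ 𝒱̄ K r e ε j (affinePoint x y) ≡ [[ Tr y ≟ ∑Γ x ]]
    multiplicity-affinePoint x y = begin
      ℤ.+ ((if does d then 1 else 0) ℕ.+ (if does (_∼?_ K P (P∞ K r)) then j else 0))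
        ≡⟨ cong (λ b → ℤ.+ ((if does d then 1 else 0) ℕ.+ (if b then j else 0)))
             (dec-false (_∼?_ K P (P∞ K r)) (≁P∞ P (0≢1 ∘ sym))) ⟩
      ℤ.+ ((if does d then 1 else 0) ℕ.+ 0)
        ≡⟨ indicator d ⟩
      [[ d ]]
        ≡⟨ [[]]-cong d (Tr y ≟ ∑Γ x)
             (λ p → +-cancel (trans (sym (eval-𝒱 x y)) (proj₁ p)))
             (λ eq → trans (eval-𝒱 x y) (trans (cong (_+ ∑Γ x) eq) (+-self (∑Γ x))) , 0≢1 ∘ sym) ⟩
      [[ Tr y ≟ ∑Γ x ]] ∎
      where
      P = affinePoint x y
      d = 𝒱? K r e ε P ×-dec ¬? (AtInfinity? K P)
      indicator : ∀ {A : Set} (d : Dec A) → ℤ.+ ((if does d then 1 else 0) ℕ.+ 0) ≡ [[ d ]]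
      indicator (yes _) = refl
      indicator (no _)  = refl

    multiplicity-P∞ : 𝒱̄ K r e ε j (P∞ K r) ≡ j
    multiplicity-P∞ = cong₂ (λ b b′ → (if b then 1 else 0) ℕ.+ (if b′ then j else 0))
      (dec-false (𝒱? K r e ε (P∞ K r) ×-dec ¬? (AtInfinity? K (P∞ K r))) (λ p → proj₂ p refl))
      (dec-true (_∼?_ K (P∞ K r) (P∞ K r)) (∼-refl (P∞ K r)))

    multiplicity-zero : ∀ P → AtInfinity K P → ¬ _∼_ K P (P∞ K r) → 𝒱̄ K r e ε j P ≡ 0
    multiplicity-zero P P₀≡0 P≁P∞ = cong₂ (λ b b′ → (if b then 1 else 0) ℕ.+ (if b′ then j else 0))
      (dec-false (𝒱? K r e ε P ×-dec ¬? (AtInfinity? K P)) (λ p → proj₂ p P₀≡0))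
      (dec-false (_∼?_ K P (P∞ K r)) P≁P∞)

    ∑-∼ : ∀ P → ∑ (allFin N) (λ i → [[ _∼?_ K (G i) P ]]) ≡ ℤ.+ 𝒱̄ K r e ε j P
    ∑-∼ P = trans (sym (length-filter (λ i → _∼?_ K (G i) P) (allFin N))) (cong ℤ.+_ (lists P))

    -- A listed point counts itself, so its multiplicity is positive; at infinity only `P∞` has
    -- positive multiplicity.
    listed-∼P∞ : ∀ i → AtInfinity K (G i) → _∼_ K (G i) (P∞ K r)
    listed-∼P∞ i Gᵢ₀≡0 = by-cases (_∼?_ K (G i) (P∞ K r))
      where
      by-cases : Dec (_∼_ K (G i) (P∞ K r)) → _∼_ K (G i) (P∞ K r)
      by-cases (yes ∼P∞) = ∼P∞
      by-cases (no ≁P∞)  = contradiction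
        (trans (lists (G i)) (multiplicity-zero (G i) Gᵢ₀≡0 ≁P∞))
        (count-positive (λ i′ → _∼?_ K (G i′) (G i)) i (∼-refl (G i)))

    -- A partition of unity: each listed point is proportional to exactly one of the normalized
    -- affine points and `P∞`.
    representative : ∀ i →
      ∑ (tuples n) (λ x → ∑ elements (λ y → [[ _∼?_ K (G i) (affinePoint x y) ]]))
          ℤ.+ [[ _∼?_ K (G i) (P∞ K r) ]] ≡ 1ℤ
    representative i = by-cases (AtInfinity? K (G i))
      where
      by-cases : Dec (AtInfinity K (G i)) →
        ∑ (tuples n) (λ x → ∑ elements (λ y → [[ _∼?_ K (G i) (affinePoint x y) ]]))
            ℤ.+ [[ _∼?_ K (G i) (P∞ K r) ]] ≡ 1ℤ
      by-cases (yes ∞) = cong₂ ℤ._+_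
        (trans (∑-cong (tuples n)
            (λ x → trans (∑-cong elements
                (λ y → [[]]-false (_∼?_ K (G i) (affinePoint x y)) (≁affinePoint (G i) ∞ x y)))
                    (∑-zero elements))) (∑-zero (tuples n)))
        ([[]]-true (_∼?_ K (G i) (P∞ K r)) (listed-∼P∞ i ∞))
      by-cases (no ¬∞) = cong₂ ℤ._+_ (∑-∼affinePoint (G i) ¬∞)
        ([[]]-false (_∼?_ K (G i) (P∞ K r)) (≁P∞ (G i) ¬∞))

    -- Each term is multiplied by the partition of unity `representative`, f is moved to the
    -- representative, and the sums are exchanged; the inner sum over the listing is then a
    -- multiplicity, known from `lists`.
    ∑-listed : ∀ (f : Point K r → ℤ) → (∀ {P Q} → _∼_ K P Q → f P ≡ f Q) →
      ∑ (allFin N) (f ∘ G) ≡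
      ∑ (tuples n) (λ x → ∑ elements (λ y → [[ Tr y ≟ ∑Γ x ]] ℤ.* f (affinePoint x y))) ℤ.+ J ℤ.* f (P∞ K r)
    ∑-listed f f-∼ = begin
      ∑ (allFin N) (f ∘ G)
        ≡⟨ ∑-cong (allFin N) pointwise ⟩
      ∑ (allFin N) (λ i → ∑ (tuples n)
          (λ x → ∑ elements (λ y → [[ _∼?_ K (G i) (affinePoint x y) ]] ℤ.* f (affinePoint x y)))
                          ℤ.+ [[ _∼?_ K (G i) (P∞ K r) ]] ℤ.* f (P∞ K r))
        ≡⟨ ∑-distrib-+ (allFin N) _ _ ⟩
      ∑ (allFin N) (λ i → ∑ (tuples n)
          (λ x → ∑ elements (λ y → [[ _∼?_ K (G i) (affinePoint x y) ]] ℤ.* f (affinePoint x y))))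
        ℤ.+ ∑ (allFin N) (λ i → [[ _∼?_ K (G i) (P∞ K r) ]] ℤ.* f (P∞ K r))
        ≡⟨ cong₂ ℤ._+_
             (trans (∑-comm (allFin N) (tuples n) _) (∑-cong (tuples n) (λ x →
               trans (∑-comm (allFin N) elements _) (∑-cong elements (λ y → trans
                 (∑-*ʳ (allFin N) (f (affinePoint x y)) _)
                 (cong (ℤ._* f (affinePoint x y))
                     (trans (∑-∼ (affinePoint x y)) (multiplicity-affinePoint x y))))))))
             (trans (∑-*ʳ (allFin N) (f (P∞ K r)) _)
               (cong (ℤ._* f (P∞ K r)) (trans (∑-∼ (P∞ K r)) (cong ℤ.+_ multiplicity-P∞)))) ⟩
      ∑ (tuples n) (λ x → ∑ elements (λ y → [[ Tr y ≟ ∑Γ x ]] ℤ.* f (affinePoint x y))) ℤ.+ J ℤ.* f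
          (P∞ K r) ∎
      where
      pointwise : ∀ i → f (G i) ≡
        ∑ (tuples n) (λ x → ∑ elements (λ y → [[ _∼?_ K (G i) (affinePoint x y) ]] ℤ.* f (affinePoint x y)))
        ℤ.+ [[ _∼?_ K (G i) (P∞ K r) ]] ℤ.* f (P∞ K r)
      pointwise i = begin
        f (G i)
          ≡⟨ ℤ.*-identityˡ (f (G i)) ⟨
        1ℤ ℤ.* f (G i)
          ≡⟨ cong (ℤ._* f (G i)) (representative i) ⟨
        (∑ (tuples n) (λ x → ∑ elements (λ y → [[ _∼?_ K (G i) (affinePoint x y) ]]))
            ℤ.+ [[ _∼?_ K (G i) (P∞ K r) ]]) ℤ.* f (G i)
          ≡⟨ ℤ.*-distribʳ-+ (f (G i))
               (∑ (tuples n) (λ x → ∑ elements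
                   (λ y → [[ _∼?_ K (G i) (affinePoint x y) ]]))) [[ _∼?_ K (G i) (P∞ K r) ]] ⟩
        ∑ (tuples n) (λ x → ∑ elements (λ y → [[ _∼?_ K (G i) (affinePoint x y) ]])) ℤ.* f (G i)
          ℤ.+ [[ _∼?_ K (G i) (P∞ K r) ]] ℤ.* f (G i)
          ≡⟨ cong₂ ℤ._+_
               (trans (sym (∑-*ʳ (tuples n) (f (G i)) _)) (∑-cong (tuples n) (λ x →
                 trans (sym (∑-*ʳ elements (f (G i)) _)) (∑-cong elements (λ y →
                   [[]]-case (_∼?_ K (G i) (affinePoint x y)) f-∼)))))
               ([[]]-case (_∼?_ K (G i) (P∞ K r)) f-∼) ⟩
        ∑ (tuples n) (λ x → ∑ elements (λ y → [[ _∼?_ K (G i) (affinePoint x y) ]] ℤ.* f (affinePoint x y)))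
          ℤ.+ [[ _∼?_ K (G i) (P∞ K r) ]] ℤ.* f (P∞ K r) ∎

    -- Provides the position at which a codeword with aᵣ nonzero is seen not to vanish.
    P∞-listed : 1 ℕ.≤ j → ∃ λ i → _∼_ K (G i) (P∞ K r)
    P∞-listed 1≤j = by-cases (Fin.any? (λ i → _∼?_ K (G i) (P∞ K r)))
      where
      by-cases : Dec (∃ λ i → _∼_ K (G i) (P∞ K r)) → ∃ λ i → _∼_ K (G i) (P∞ K r)
      by-cases (yes ∃i) = ∃i
      by-cases (no ∄i)  = contradiction
        (ℤ.+-injective (begin
          ℤ.+ j                                                 ≡⟨ cong ℤ.+_ multiplicity-P∞ ⟨
          ℤ.+ 𝒱̄ K r e ε j (P∞ K r)                              ≡⟨ ∑-∼ (P∞ K r) ⟨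
          ∑ (allFin N) (λ i → [[ _∼?_ K (G i) (P∞ K r) ]])
            ≡⟨ ∑-cong (allFin N) (λ i → [[]]-false (_∼?_ K (G i) (P∞ K r)) (λ p → ∄i (i , p))) ⟩
          ∑ (allFin N) (λ i → 0ℤ)                               ≡⟨ ∑-zero (allFin N) ⟩
          0ℤ                                                    ∎))
        (λ j≡0 → ℕ.<⇒≢ 1≤j (sym j≡0))

    -- The case f = 1 of `∑-listed`: above each of the q^(2n) tuples x there are q values y with
    -- trace `∑Γ x`.
    length-code : ℤ.+ N ≡ (Q ℤ.* Q) ℤ.^ n ℤ.* Q ℤ.+ J
    length-code = begin
      ℤ.+ N
        ≡⟨ cong ℤ.+_ (List.length-tabulate {n = N} id) ⟨
      ℤ.+ length (allFin N)
        ≡⟨ ℤ.*-identityʳ _ ⟨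
      ℤ.+ length (allFin N) ℤ.* 1ℤ
        ≡⟨ ∑-const (allFin N) 1ℤ ⟨
      ∑ (allFin N) (λ _ → 1ℤ)
        ≡⟨ ∑-listed (λ _ → 1ℤ) (λ _ → refl) ⟩
      ∑ (tuples n) (λ x → ∑ elements (λ y → [[ Tr y ≟ ∑Γ x ]] ℤ.* 1ℤ)) ℤ.+ J ℤ.* 1ℤ
        ≡⟨ cong₂ ℤ._+_ (∑-cong (tuples n)
             (λ x → trans (∑-*ʳ elements 1ℤ _)
                 (trans (ℤ.*-identityʳ _) (trans (card-Tr-fibre (∑Γ-∈F x)) (sym (ℤ.*-identityˡ Q))))))
                     (ℤ.*-identityʳ J) ⟩
      ∑ (tuples n) (λ x → 1ℤ ℤ.* Q) ℤ.+ J
        ≡⟨ cong (ℤ._+ J) (trans (∑-*ʳ (tuples n) Q _) (cong (ℤ._* Q) (∑-tuples-1 n))) ⟩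
      (Q ℤ.* Q) ℤ.^ n ℤ.* Q ℤ.+ J ∎

    module _ (a : Vector Carrier (ℕ.suc r)) where
      private
        a₀ aᵣ : Carrier
        a₀ = a zero
        aᵣ = a (fromℕ r)
        a′ : Vector Carrier n
        a′ i = a (suc (inject₁ i))

      ∑-nonzero : ℤ
      ∑-nonzero = ∑ (allFin N) (λ i → [[ ¬? (dot a (G i) ≟ 0#) ]])

      weight-dot : ∀ (v : Vector Carrier N) → (∀ i → v i ≡ dot a (G i)) → ℤ.+ weight K v ≡ ∑-nonzero
      weight-dot v v≡ = trans (length-filter (λ i → ¬? (v i ≟ 0#)) (allFin N))
        (∑-cong (allFin N) (λ i → cong (λ z → [[ ¬? (z ≟ 0#) ]]) (v≡ i)))

      private
        on-affine : Vector Carrier n → Carrier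
        on-affine x = a₀ + sum (λ i → a′ i * x i)

        ∑-nonzero-affine : ∑-nonzero ≡
          ∑ (tuples n) (λ x → ∑ elements
              (λ y → [[ Tr y ≟ ∑Γ x ]] ℤ.* (1ℤ ℤ.- [[ (on-affine x + aᵣ * y) ≟ 0# ]])))
          ℤ.+ J ℤ.* [[ ¬? (aᵣ ≟ 0#) ]]
        ∑-nonzero-affine = trans
          (∑-listed (λ P → [[ ¬? (dot a P ≟ 0#) ]]) (λ {P} {Q} P∼Q →
            [[]]-cong (¬? (dot a P ≟ 0#)) (¬? (dot a Q ≟ 0#))
              (λ ≢0 Q≡0 → *-nonzero (proj₁ (proj₂ P∼Q)) ≢0 (trans (sym (dot-∼ a {P} {Q} P∼Q)) Q≡0))
              (λ ≢0 P≡0 → ≢0 (trans (dot-∼ a {P} {Q} P∼Q) (trans (cong (proj₁ P∼Q *_) P≡0) (zeroʳ _))))))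
          (cong₂ ℤ._+_
            (∑-cong (tuples n) (λ x → ∑-cong elements (λ y → cong ([[ Tr y ≟ ∑Γ x ]] ℤ.*_)
              (trans ([[]]-¬ (dot a (affinePoint x y) ≟ 0#))
                (cong (λ z → 1ℤ ℤ.- [[ z ≟ 0# ]]) (trans (dot-affinePoint a x y) (sym (+-assoc _ _ _))))))))
            (cong (λ z → J ℤ.* [[ ¬? (z ≟ 0#) ]]) (dot-P∞ a)))

      -- The equation of the hyperplane does not involve y, so of the q affine points above each x
      -- either all or none lie on it; `P∞` lies on it, so j does not appear.
      ∑-nonzero-aᵣ≡0 : aᵣ ≡ 0# →
        ∑-nonzero ≡ Q ℤ.* ((Q ℤ.* Q) ℤ.^ n ℤ.- ∑ (tuples n) (λ x → [[ sum (λ i → a′ i * x i) ≟ a₀ ]]))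
      ∑-nonzero-aᵣ≡0 aᵣ≡0 = begin
        ∑-nonzero
          ≡⟨ ∑-nonzero-affine ⟩
        ∑ (tuples n) (λ x → ∑ elements
            (λ y → [[ Tr y ≟ ∑Γ x ]] ℤ.* (1ℤ ℤ.- [[ (on-affine x + aᵣ * y) ≟ 0# ]])))
          ℤ.+ J ℤ.* [[ ¬? (aᵣ ≟ 0#) ]]
          ≡⟨ cong₂ ℤ._+_ (∑-cong (tuples n) on-x)
               (trans (cong (J ℤ.*_) ([[]]-false (¬? (aᵣ ≟ 0#)) (λ ≢0 → ≢0 aᵣ≡0))) (ℤ.*-zeroʳ J)) ⟩
        ∑ (tuples n) (λ x → Q ℤ.* 1ℤ ℤ.+ (ℤ.- Q) ℤ.* [[ sum (λ i → a′ i * x i) ≟ a₀ ]]) ℤ.+ 0ℤ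
          ≡⟨ cong (ℤ._+ 0ℤ) (trans (∑-distrib-+ (tuples n) _ _)
               (cong₂ ℤ._+_ (trans (∑-*ˡ (tuples n) Q _) (cong (Q ℤ.*_) (∑-tuples-1 n)))
                   (∑-*ˡ (tuples n) (ℤ.- Q) _))) ⟩
        Q ℤ.* (Q ℤ.* Q) ℤ.^ n ℤ.+ (ℤ.- Q) ℤ.* ∑ (tuples n) (λ x → [[ sum (λ i → a′ i * x i) ≟ a₀ ]]) ℤ.+ 0ℤ
          ≡⟨ factor Q _ _ ⟩
        Q ℤ.* ((Q ℤ.* Q) ℤ.^ n ℤ.- ∑ (tuples n) (λ x → [[ sum (λ i → a′ i * x i) ≟ a₀ ]])) ∎
        where
        factor : ∀ x y z → x ℤ.* y ℤ.+ (ℤ.- x) ℤ.* z ℤ.+ 0ℤ ≡ x ℤ.* (y ℤ.- z)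
        factor = solve-∀
        expand : ∀ x y → x ℤ.* (1ℤ ℤ.- y) ≡ x ℤ.* 1ℤ ℤ.+ (ℤ.- x) ℤ.* y
        expand = solve-∀
        on-x : ∀ x → ∑ elements (λ y → [[ Tr y ≟ ∑Γ x ]] ℤ.* (1ℤ ℤ.- [[ (on-affine x + aᵣ * y) ≟ 0# ]]))
                   ≡ Q ℤ.* 1ℤ ℤ.+ (ℤ.- Q) ℤ.* [[ sum (λ i → a′ i * x i) ≟ a₀ ]]
        on-x x = begin
          ∑ elements (λ y → [[ Tr y ≟ ∑Γ x ]] ℤ.* (1ℤ ℤ.- [[ (on-affine x + aᵣ * y) ≟ 0# ]]))
            ≡⟨ ∑-cong elements (λ y → cong (λ z → [[ Tr y ≟ ∑Γ x ]] ℤ.* (1ℤ ℤ.- z))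
                 ([[]]-cong ((on-affine x + aᵣ * y) ≟ 0#) (sum (λ i → a′ i * x i) ≟ a₀)
                   (λ eq → sym (+-cancel (trans (sym (no-y y)) eq)))
                   (λ eq → trans (no-y y) (trans (cong (a₀ +_) eq) (+-self a₀))))) ⟩
          ∑ elements (λ y → [[ Tr y ≟ ∑Γ x ]] ℤ.* (1ℤ ℤ.- [[ sum (λ i → a′ i * x i) ≟ a₀ ]]))
            ≡⟨ trans (∑-*ʳ elements (1ℤ ℤ.- [[ sum (λ i → a′ i * x i) ≟ a₀ ]]) _)
                 (cong (ℤ._* (1ℤ ℤ.- [[ sum (λ i → a′ i * x i) ≟ a₀ ]])) (card-Tr-fibre (∑Γ-∈F x))) ⟩
          Q ℤ.* (1ℤ ℤ.- [[ sum (λ i → a′ i * x i) ≟ a₀ ]])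
            ≡⟨ expand Q _ ⟩
          Q ℤ.* 1ℤ ℤ.+ (ℤ.- Q) ℤ.* [[ sum (λ i → a′ i * x i) ≟ a₀ ]] ∎
          where
          no-y : ∀ y → on-affine x + aᵣ * y ≡ on-affine x
          no-y y = trans (cong (λ z → on-affine x + z * y) aᵣ≡0)
              (trans (cong (on-affine x +_) (zeroˡ y)) (+-identityʳ _))

      -- Solving the hyperplane equation for y turns incidence into an equation ∑ (Γ(xᵢ) + Tr(wᵢ xᵢ)) = γ.
      module _ (aᵣ≢0 : aᵣ ≢ 0#) where
        aᵣ⁻¹ : Carrier
        aᵣ⁻¹ = proj₁ (inverse aᵣ aᵣ≢0)

        private
          w : Vector Carrier n
          w i = aᵣ⁻¹ * a′ i

          Tr-sum : ∀ {m} (f : Vector Carrier m) → Tr (sum f) ≡ sum (Tr ∘ f)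
          Tr-sum {ℕ.zero}  f = Tr-F 0∈F
          Tr-sum {ℕ.suc m} f = trans (Tr-+ (f zero) _) (cong (Tr (f zero) +_) (Tr-sum (Vector.tail f)))

          solution : Vector Carrier n → Carrier
          solution x = aᵣ⁻¹ * on-affine x

          aᵣ*solution : ∀ x → aᵣ * solution x ≡ on-affine x
          aᵣ*solution x = trans (sym (*-assoc aᵣ aᵣ⁻¹ _))
              (trans (cong (_* on-affine x) (proj₂ (inverse aᵣ aᵣ≢0))) (*-identityˡ _))

          Tr-solution : ∀ x → Tr (solution x) ≡ Tr (aᵣ⁻¹ * a₀) + sum (λ i → Tr (w i * x i))
          Tr-solution x = begin
            Tr (aᵣ⁻¹ * (a₀ + sum (λ i → a′ i * x i)))
              ≡⟨ cong Tr (distribˡ aᵣ⁻¹ a₀ _) ⟩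
            Tr (aᵣ⁻¹ * a₀ + aᵣ⁻¹ * sum (λ i → a′ i * x i))
              ≡⟨ Tr-+ _ _ ⟩
            Tr (aᵣ⁻¹ * a₀) + Tr (aᵣ⁻¹ * sum (λ i → a′ i * x i))
              ≡⟨ cong (λ z → Tr (aᵣ⁻¹ * a₀) + Tr z) (*-distribˡ-sum aᵣ⁻¹ (λ i → a′ i * x i)) ⟩
            Tr (aᵣ⁻¹ * a₀) + Tr (sum (λ i → aᵣ⁻¹ * (a′ i * x i)))
              ≡⟨ cong (Tr (aᵣ⁻¹ * a₀) +_) (Tr-sum (λ i → aᵣ⁻¹ * (a′ i * x i))) ⟩
            Tr (aᵣ⁻¹ * a₀) + sum (λ i → Tr (aᵣ⁻¹ * (a′ i * x i)))
              ≡⟨ cong (Tr (aᵣ⁻¹ * a₀) +_) (sum-cong-≗ (λ i → cong Tr (*-assoc aᵣ⁻¹ (a′ i) (x i)))) ⟨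
            Tr (aᵣ⁻¹ * a₀) + sum (λ i → Tr (w i * x i)) ∎

          -- Of the q points above x only the one with y = `solution x` can lie on the hyperplane,
          -- and it belongs to the hypersurface exactly when its trace is `∑Γ x`.
          incident-count : ∀ x → ∑ elements
              (λ y → [[ Tr y ≟ ∑Γ x ]] ℤ.* (1ℤ ℤ.- [[ (on-affine x + aᵣ * y) ≟ 0# ]]))
                               ≡ Q ℤ.* 1ℤ ℤ.+ ℤ.-1ℤ ℤ.* [[ ∑Γ+linear w x ≟ Tr (aᵣ⁻¹ * a₀) ]]
          incident-count x = begin
            ∑ elements (λ y → [[ Tr y ≟ ∑Γ x ]] ℤ.* (1ℤ ℤ.- [[ (on-affine x + aᵣ * y) ≟ 0# ]]))
              ≡⟨ ∑-cong elements (λ y → trans (cong (λ z → [[ Tr y ≟ ∑Γ x ]] ℤ.* (1ℤ ℤ.- z))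
                   ([[]]-cong ((on-affine x + aᵣ * y) ≟ 0#) (y ≟ solution x)
                     (λ eq → *-cancelˡ-nonzero aᵣ≢0 (trans (sym (+-cancel eq)) (sym (aᵣ*solution x))))
                     (λ eq → trans (cong (on-affine x +_) (trans (cong (aᵣ *_) eq) (aᵣ*solution x)))
                         (+-self _))))
                   (expand [[ Tr y ≟ ∑Γ x ]] [[ y ≟ solution x ]])) ⟩
            ∑ elements (λ y → [[ Tr y ≟ ∑Γ x ]] ℤ.+ ℤ.-1ℤ ℤ.* ([[ y ≟ solution x ]] ℤ.* [[ Tr y ≟ ∑Γ x ]]))
              ≡⟨ ∑-distrib-+ elements _ _ ⟩
            ∑ elements (λ y → [[ Tr y ≟ ∑Γ x ]]) ℤ.+ ∑ elements
                (λ y → ℤ.-1ℤ ℤ.* ([[ y ≟ solution x ]] ℤ.* [[ Tr y ≟ ∑Γ x ]]))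
              ≡⟨ cong₂ ℤ._+_ (trans (card-Tr-fibre (∑Γ-∈F x)) (sym (ℤ.*-identityʳ Q)))
                   (trans (∑-*ˡ elements ℤ.-1ℤ _)
                       (cong (ℤ.-1ℤ ℤ.*_) (∑-pick (solution x) (λ y → [[ Tr y ≟ ∑Γ x ]])))) ⟩
            Q ℤ.* 1ℤ ℤ.+ ℤ.-1ℤ ℤ.* [[ Tr (solution x) ≟ ∑Γ x ]]
              ≡⟨ cong (λ z → Q ℤ.* 1ℤ ℤ.+ ℤ.-1ℤ ℤ.* z)
                   ([[]]-cong (Tr (solution x) ≟ ∑Γ x) (∑Γ+linear w x ≟ Tr (aᵣ⁻¹ * a₀))
                   (λ eq → trans (sum-distrib-+ (λ i → Γ̂ (x i)) (λ i → Tr (w i * x i)))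
                       (sym (+-move (trans (sym (Tr-solution x)) eq))))
                   (λ eq → trans (Tr-solution x)
                       (sym (+-move (trans (sym
                           (sum-distrib-+ (λ i → Γ̂ (x i)) (λ i → Tr (w i * x i)))) eq))))) ⟩
            Q ℤ.* 1ℤ ℤ.+ ℤ.-1ℤ ℤ.* [[ ∑Γ+linear w x ≟ Tr (aᵣ⁻¹ * a₀) ]] ∎
            where
            expand : ∀ x y → x ℤ.* (1ℤ ℤ.- y) ≡ x ℤ.+ ℤ.-1ℤ ℤ.* (y ℤ.* x)
            expand = solve-∀

        exceptional : Carrier
        exceptional = proj₁ (∑Γ+linear-count n w)

        exceptional-∈F : exceptional ∈F
        exceptional-∈F = proj₁ (proj₂ (∑Γ+linear-count n w))

        ∑-nonzero-aᵣ≢0 : ∑-nonzero ≡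
          (Q ℤ.* Q) ℤ.^ n ℤ.* Q ℤ.- (A Q n ℤ.+ B Q n ℤ.* [[ Tr (aᵣ⁻¹ * a₀) ≟ exceptional ]]) ℤ.+ J
        ∑-nonzero-aᵣ≢0 = begin
          ∑-nonzero
            ≡⟨ ∑-nonzero-affine ⟩
          ∑ (tuples n) (λ x → ∑ elements
              (λ y → [[ Tr y ≟ ∑Γ x ]] ℤ.* (1ℤ ℤ.- [[ (on-affine x + aᵣ * y) ≟ 0# ]])))
            ℤ.+ J ℤ.* [[ ¬? (aᵣ ≟ 0#) ]]
            ≡⟨ cong₂ ℤ._+_ (∑-cong (tuples n) incident-count)
                 (trans (cong (J ℤ.*_) ([[]]-true (¬? (aᵣ ≟ 0#)) aᵣ≢0)) (ℤ.*-identityʳ J)) ⟩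
          ∑ (tuples n) (λ x → Q ℤ.* 1ℤ ℤ.+ ℤ.-1ℤ ℤ.* [[ ∑Γ+linear w x ≟ Tr (aᵣ⁻¹ * a₀) ]]) ℤ.+ J
            ≡⟨ cong (ℤ._+ J) (trans (∑-distrib-+ (tuples n) _ _) (cong₂ ℤ._+_
                 (trans (∑-*ˡ (tuples n) Q _) (cong (Q ℤ.*_) (∑-tuples-1 n)))
                 (trans (∑-*ˡ (tuples n) ℤ.-1ℤ _)
                     (cong (ℤ.-1ℤ ℤ.*_) (proj₂ (proj₂ (∑Γ+linear-count n w)) (Tr-∈F (aᵣ⁻¹ * a₀))))))) ⟩
          Q ℤ.* (Q ℤ.* Q) ℤ.^ n ℤ.+ ℤ.-1ℤ ℤ.* (A Q n ℤ.+ B Q n ℤ.* [[ Tr (aᵣ⁻¹ * a₀) ≟ exceptional ]]) ℤ.+ J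
            ≡⟨ rearrange Q _ _ J ⟩
          (Q ℤ.* Q) ℤ.^ n ℤ.* Q ℤ.- (A Q n ℤ.+ B Q n ℤ.* [[ Tr (aᵣ⁻¹ * a₀) ≟ exceptional ]]) ℤ.+ J ∎
          where
          rearrange : ∀ x y z j → x ℤ.* y ℤ.+ ℤ.-1ℤ ℤ.* z ℤ.+ j ≡ y ℤ.* x ℤ.- z ℤ.+ j
          rearrange = solve-∀

-- Closed forms of the coefficients and of the weights

module Numerics where
  open import Data.Integer using (+_; _+_; _*_; _-_; -_; _^_; -1ℤ)
  open ≡-Reasoning

  pos-^ : ∀ a m → (+ a) ^ m ≡ + (a ℕ.^ m)
  pos-^ a ℕ.zero    = refl
  pos-^ a (ℕ.suc m) = trans (cong (+ a *_) (pos-^ a m)) (sym (ℤ.pos-* a (a ℕ.^ m)))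

  -- Here n plays the role of r - 1, so the parity assumed is that of r.
  -1^-even : ∀ n → ℕ.suc n ℕ.% 2 ≡ 1 → -1ℤ ^ n ≡ 1ℤ
  -1^-even ℕ.zero                _  = refl
  -1^-even (ℕ.suc (ℕ.suc n)) odd = cong (λ x → -1ℤ * (-1ℤ * x)) (-1^-even n odd)

  -1^-odd : ∀ n → ℕ.suc n ℕ.% 2 ≡ 0 → -1ℤ ^ n ≡ -1ℤ
  -1^-odd 1                   _ = refl
  -1^-odd (ℕ.suc (ℕ.suc n)) even = cong (λ x → -1ℤ * (-1ℤ * x)) (-1^-odd n even)

  square-^ : ∀ Q m → (Q * Q) ^ m ≡ Q ^ m * Q ^ m
  square-^ Q ℕ.zero    = refl
  square-^ Q (ℕ.suc m) = trans (cong (Q * Q *_) (square-^ Q m)) (regroup Q (Q ^ m))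
    where
    regroup : ∀ x y → x * x * (y * y) ≡ x * y * (x * y)
    regroup = solve-∀

  ^-double : ∀ Q m → Q ^ (m ℕ.+ m) ≡ Q ^ m * Q ^ m
  ^-double Q m = ℤ.^-distribˡ-+-* Q m m

  2[2+m]∸1 : ∀ m → 2 ℕ.* (2 ℕ.+ m) ℕ.∸ 1 ≡ 3 ℕ.+ (m ℕ.+ m)
  2[2+m]∸1 m = cong (ℕ._∸ 1) (lemma m)
    where
    lemma : ∀ m → 2 ℕ.* (2 ℕ.+ m) ≡ 4 ℕ.+ (m ℕ.+ m)
    lemma = solve-∀ᴺ

  2[2+m]∸3 : ∀ m → 2 ℕ.* (2 ℕ.+ m) ℕ.∸ 3 ≡ 1 ℕ.+ (m ℕ.+ m)
  2[2+m]∸3 m = cong (ℕ._∸ 2) (2[2+m]∸1 m)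

  B-closed : ∀ Q m → B Q m ≡ -1ℤ ^ m * Q ^ m
  B-closed Q ℕ.zero    = refl
  B-closed Q (ℕ.suc m) = trans (cong (- Q *_) (B-closed Q m)) (regroup Q (-1ℤ ^ m) (Q ^ m))
    where
    regroup : ∀ x y z → - x * (y * z) ≡ -1ℤ * y * (x * z)
    regroup = solve-∀

  -- The conservation law of the counts: summed over the q values in 𝔽_q they exhaust the q^(2m)
  -- tuples. It also follows from the recurrence, as shown here.
  Q*A+B : ∀ Q m → Q * A Q m + B Q m ≡ (Q * Q) ^ m
  Q*A+B Q ℕ.zero    = cong (_+ 1ℤ) (ℤ.*-zeroʳ Q)
  Q*A+B Q (ℕ.suc m) = trans (regroup Q (A Q m) (B Q m)) (cong (Q * Q *_) (Q*A+B Q m))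
    where
    regroup : ∀ x a b → x * (x * x * a + (x + 1ℤ) * b) + (- x) * b ≡ x * x * (x * a + b)
    regroup = solve-∀

  -- The recurrence regroups as q (q A + B) + B, where `Q*A+B` and `B-closed` apply; the sign is
  -- then shifted to the exponent used in the weights.
  A-closed : ∀ Q m → A Q (ℕ.suc m) ≡ Q * (Q * Q) ^ m - -1ℤ ^ ℕ.suc m * Q ^ m
  A-closed Q m = begin
    Q * Q * A Q m + (Q + 1ℤ) * B Q m          ≡⟨ regroup Q (A Q m) (B Q m) ⟩
    Q * (Q * A Q m + B Q m) + B Q m           ≡⟨ cong₂ (λ x y → Q * x + y) (Q*A+B Q m) (B-closed Q m) ⟩
    Q * (Q * Q) ^ m + -1ℤ ^ m * Q ^ m         ≡⟨ signs (Q * (Q * Q) ^ m) (-1ℤ ^ m) (Q ^ m) ⟩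
    Q * (Q * Q) ^ m - -1ℤ * -1ℤ ^ m * Q ^ m   ∎
    where
    regroup : ∀ x a b → x * x * a + (x + 1ℤ) * b ≡ x * (x * a + b) + b
    regroup = solve-∀
    signs : ∀ x y z → x + y * z ≡ x - -1ℤ * y * z
    signs = solve-∀

  -- Here r = m + 2.
  module CodeWeights (Q J : ℤ) (m : ℕ) where
    E₁ E₃ s w₁ w₂ w₃ w₄ : ℤ
    E₁ = Q ^ (2 ℕ.* (2 ℕ.+ m) ℕ.∸ 1)
    E₃ = Q ^ (2 ℕ.* (2 ℕ.+ m) ℕ.∸ 3)
    s  = -1ℤ ^ ℕ.suc m
    w₁ = E₁
    w₂ = E₁ - E₃
    w₃ = E₁ - E₃ + s * Q ^ m + J
    w₄ = E₁ - E₃ + s * Q ^ m - s * Q ^ ℕ.suc m + J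

    E₁≡ : E₁ ≡ (Q * Q) ^ ℕ.suc m * Q
    E₁≡ = begin
      Q ^ (2 ℕ.* (2 ℕ.+ m) ℕ.∸ 1)       ≡⟨ cong (Q ^_) (2[2+m]∸1 m) ⟩
      Q * (Q * (Q * Q ^ (m ℕ.+ m)))
        ≡⟨ cong (λ z → Q * (Q * (Q * z))) (trans (^-double Q m) (sym (square-^ Q m))) ⟩
      Q * (Q * (Q * (Q * Q) ^ m))       ≡⟨ regroup Q ((Q * Q) ^ m) ⟩
      Q * Q * (Q * Q) ^ m * Q           ∎
      where
      regroup : ∀ x y → x * (x * (x * y)) ≡ x * x * y * x
      regroup = solve-∀

    E₃≡ : E₃ ≡ Q * (Q * Q) ^ m
    E₃≡ = trans (cong (Q ^_) (2[2+m]∸3 m)) (cong (Q *_) (trans (^-double Q m) (sym (square-^ Q m))))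

    A≡ : A Q (ℕ.suc m) ≡ E₃ - s * Q ^ m
    A≡ = trans (A-closed Q m) (cong (_- s * Q ^ m) (sym E₃≡))

    w₂≡ : Q * ((Q * Q) ^ ℕ.suc m - (Q * Q) ^ m) ≡ w₂
    w₂≡ = trans (regroup Q ((Q * Q) ^ ℕ.suc m) ((Q * Q) ^ m)) (cong₂ _-_ (sym E₁≡) (sym E₃≡))
      where
      regroup : ∀ x y z → x * (y - z) ≡ y * x - x * z
      regroup = solve-∀

    -- The factor 0 here, and 1 in `w₄≡`, is the indicator of the exceptional value in
    -- `∑-nonzero-aᵣ≢0`.
    w₃≡ : (Q * Q) ^ ℕ.suc m * Q - (A Q (ℕ.suc m) + B Q (ℕ.suc m) * 0ℤ) + J ≡ w₃
    w₃≡ = trans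
      (cong₂ (λ x y → x - (y + B Q (ℕ.suc m) * 0ℤ) + J) (sym E₁≡) A≡)
      (regroup E₁ E₃ (s * Q ^ m) (B Q (ℕ.suc m)) J)
      where
      regroup : ∀ x y z b j → x - (y - z + b * 0ℤ) + j ≡ x - y + z + j
      regroup = solve-∀

    w₄≡ : (Q * Q) ^ ℕ.suc m * Q - (A Q (ℕ.suc m) + B Q (ℕ.suc m) * 1ℤ) + J ≡ w₄
    w₄≡ = trans
      (trans (cong₂ (λ x y → x - (y + B Q (ℕ.suc m) * 1ℤ) + J) (sym E₁≡) A≡)
             (cong (λ b → E₁ - (E₃ - s * Q ^ m + b * 1ℤ) + J) (B-closed Q (ℕ.suc m))))
      (regroup E₁ E₃ (s * Q ^ m) (s * Q ^ ℕ.suc m) J)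
      where
      regroup : ∀ x y z b j → x - (y - z + b * 1ℤ) + j ≡ x - y + z - b + j
      regroup = solve-∀

  module Powers (q : ℕ) (2≤q : 2 ℕ.≤ q) where

    ^-positive : ∀ a → 0 ℕ.< q ℕ.^ a
    ^-positive a = ℕ.m^n>0 q {{ℕ.>-nonZero (ℕ.<-trans (ℕ.s≤s ℕ.z≤n) 2≤q)}} a

    ^≢0 : ∀ a → (+ q) ^ a ≢ 0ℤ
    ^≢0 a eq = ℕ.<⇒≢ (^-positive a) (sym (ℤ.+-injective (trans (sym (pos-^ q a)) eq)))

    ^-injective-< : ∀ {a b} → a ℕ.< b → (+ q) ^ a ≢ (+ q) ^ b
    ^-injective-< {a} {b} a<b eq = ℕ.<⇒≢ (ℕ.^-monoʳ-< q 2≤q a<b)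
      (ℤ.+-injective (trans (sym (pos-^ q a)) (trans eq (pos-^ q b))))

    ^+^≢0 : ∀ a b → (+ q) ^ a + (+ q) ^ b ≢ 0ℤ
    ^+^≢0 a b eq = ℕ.<⇒≢ (ℕ.<-≤-trans (^-positive a) (ℕ.m≤m+n (q ℕ.^ a) (q ℕ.^ b)))
      (sym (ℤ.+-injective (trans (ℤ.pos-+ (q ℕ.^ a) (q ℕ.^ b))
          (trans (sym (cong₂ _+_ (pos-^ q a) (pos-^ q b))) eq))))

-- Length, dimension and weights of the code

module WeightDistribution
  (e k : ℕ) (⌈e/2⌉≡1+k : (e ℕ.+ 1) ℕ./ 2 ≡ ℕ.suc k)
  (2⌈e/2⌉≡1+e : ℕ.suc k ℕ.+ ℕ.suc k ≡ ℕ.suc e)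
  (K : FiniteField ((2 ℕ.^ e) ℕ.^ 2)) (ε : FiniteField.Carrier K) (isParameter : IsParameter K e ε)
  {m j N : ℕ} (1≤m : 1 ℕ.≤ m) (1≤j : 1 ℕ.≤ j)
  (G : Fin N → Point K (2 ℕ.+ m)) (lists : Lists K G (𝒱̄ K (2 ℕ.+ m) e ε j)) where
  open FiniteField K
  open CommutativeRing commutativeRing
    using (zeroˡ; zeroʳ; *-identityˡ; *-identityʳ; *-comm; *-assoc; +-comm)
  open SemiringSum semiring using (sum-cong-≗; sum-replicate-zero)
  open FiniteFieldProperties K
  open Geometry K
  open SuzukiTits e k ⌈e/2⌉≡1+k 2⌈e/2⌉≡1+e K ε isParameter hiding (s)
  open Counting e k ⌈e/2⌉≡1+k 2⌈e/2⌉≡1+e K ε isParameter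
  open HypersurfaceCode e k ⌈e/2⌉≡1+k 2⌈e/2⌉≡1+e K ε isParameter
  open Characteristic2 K 1+1≡0
  open Numerics
  open ≡-Reasoning

  private
    r = 2 ℕ.+ m
    J = ℤ.+ j
    C = associatedCode K G

  open CodeWeights Q J m
  open Powers q 2≤q

  weights : List ℤ
  weights = w₁ ∷ w₂ ∷ w₃ ∷ w₄ ∷ []

  length-N : N ≡ q ℕ.^ (2 ℕ.* r ℕ.∸ 1) ℕ.+ j
  length-N = ℤ.+-injective (begin
    ℤ.+ N                                       ≡⟨ length-code G lists ⟩
    (Q ℤ.* Q) ℤ.^ ℕ.suc m ℤ.* Q ℤ.+ J           ≡⟨ cong (ℤ._+ J) E₁≡ ⟨
    E₁ ℤ.+ J                                    ≡⟨ cong (ℤ._+ J) (pos-^ q (2 ℕ.* r ℕ.∸ 1)) ⟩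
    ℤ.+ (q ℕ.^ (2 ℕ.* r ℕ.∸ 1)) ℤ.+ J           ≡⟨ ℤ.pos-+ (q ℕ.^ (2 ℕ.* r ℕ.∸ 1)) j ⟨
    ℤ.+ (q ℕ.^ (2 ℕ.* r ℕ.∸ 1) ℕ.+ j)           ∎)

  sum-zero : ∀ {l} (v x : Vector Carrier l) → (∀ i → v i ≡ 0#) → sum (λ i → v i * x i) ≡ 0#
  sum-zero {l} v x v≡0 = trans (sum-cong-≗ (λ i → trans (cong (_* x i) (v≡0 i)) (zeroˡ (x i))))
      (sum-replicate-zero l)

  codeword-weight : Vector Carrier (ℕ.suc r) → ℤ
  codeword-weight a = ∑-nonzero G lists a

  module _ (a : Vector Carrier (ℕ.suc r)) where

    -- The hyperplane is X₀ = 0, which contains `P∞` and misses every affine point.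
    codeword-weight≡w₁ : a (fromℕ r) ≡ 0# → (∀ i → a (suc (inject₁ i)) ≡ 0#) → a zero ≢ 0# →
        codeword-weight a ≡ w₁
    codeword-weight≡w₁ aᵣ≡0 a′≡0 a₀≢0 = begin
      codeword-weight a
        ≡⟨ ∑-nonzero-aᵣ≡0 G lists a aᵣ≡0 ⟩
      Q ℤ.* ((Q ℤ.* Q) ℤ.^ ℕ.suc m ℤ.- ∑ (tuples (ℕ.suc m))
          (λ x → [[ sum (λ i → a (suc (inject₁ i)) * x i) ≟ a zero ]]))
        ≡⟨ cong (λ z → Q ℤ.* ((Q ℤ.* Q) ℤ.^ ℕ.suc m ℤ.- z)) (trans
             (∑-cong (tuples (ℕ.suc m)) (λ x → [[]]-false (sum (λ i → a (suc (inject₁ i)) * x i) ≟ a zero)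
               (λ eq → a₀≢0 (trans (sym eq) (sum-zero (λ i → a (suc (inject₁ i))) x a′≡0)))))
             (∑-zero (tuples (ℕ.suc m)))) ⟩
      Q ℤ.* ((Q ℤ.* Q) ℤ.^ ℕ.suc m ℤ.- 0ℤ)
        ≡⟨ simplify Q ((Q ℤ.* Q) ℤ.^ ℕ.suc m) ⟩
      (Q ℤ.* Q) ℤ.^ ℕ.suc m ℤ.* Q
        ≡⟨ E₁≡ ⟨
      w₁ ∎
      where
      simplify : ∀ x y → x ℤ.* (y ℤ.- 0ℤ) ≡ y ℤ.* x
      simplify = solve-∀

    codeword-weight≡w₂ : a (fromℕ r) ≡ 0# → ∀ i → a (suc (inject₁ i)) ≢ 0# → codeword-weight a ≡ w₂
    codeword-weight≡w₂ aᵣ≡0 i aᵢ≢0 = begin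
      codeword-weight a
        ≡⟨ ∑-nonzero-aᵣ≡0 G lists a aᵣ≡0 ⟩
      Q ℤ.* ((Q ℤ.* Q) ℤ.^ ℕ.suc m ℤ.- ∑ (tuples (ℕ.suc m))
          (λ x → [[ sum (λ i → a (suc (inject₁ i)) * x i) ≟ a zero ]]))
        ≡⟨ cong (λ z → Q ℤ.* ((Q ℤ.* Q) ℤ.^ ℕ.suc m ℤ.- z)) solutions ⟩
      Q ℤ.* ((Q ℤ.* Q) ℤ.^ ℕ.suc m ℤ.- (Q ℤ.* Q) ℤ.^ m)
        ≡⟨ w₂≡ ⟩
      w₂ ∎
      where
      instance
        q≢0 : ℕ.NonZero q
        q≢0 = ℕ.m^n≢0 2 e
      solutions : ∑ (tuples (ℕ.suc m)) (λ x → [[ sum (λ i → a (suc (inject₁ i)) * x i) ≟ a zero ]]) ≡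
          (Q ℤ.* Q) ℤ.^ m
      solutions = ℤ.*-cancelˡ-≡ Q _ _ (ℤ.*-cancelˡ-≡ Q _ _
        (trans (sym (ℤ.*-assoc Q Q _))
            (trans (linear-count (λ i → a (suc (inject₁ i))) i aᵢ≢0 (a zero)) (ℤ.*-assoc Q Q _))))

    module _ (aᵣ≢0 : a (fromℕ r) ≢ 0#) where

      codeword-weight≡w₃ : Tr (aᵣ⁻¹ G lists a aᵣ≢0 * a zero) ≢ exceptional G lists a aᵣ≢0 →
          codeword-weight a ≡ w₃
      codeword-weight≡w₃ ≢exc = trans (∑-nonzero-aᵣ≢0 G lists a aᵣ≢0)
        (trans (cong (λ z → (Q ℤ.* Q) ℤ.^ ℕ.suc m ℤ.* Q ℤ.- (A Q (ℕ.suc m) ℤ.+ B Q (ℕ.suc m) ℤ.* z) ℤ.+ J)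
                     ([[]]-false (_ ≟ _) ≢exc)) w₃≡)

      codeword-weight≡w₄ : Tr (aᵣ⁻¹ G lists a aᵣ≢0 * a zero) ≡ exceptional G lists a aᵣ≢0 →
          codeword-weight a ≡ w₄
      codeword-weight≡w₄ ≡exc = trans (∑-nonzero-aᵣ≢0 G lists a aᵣ≢0)
        (trans (cong (λ z → (Q ℤ.* Q) ℤ.^ ℕ.suc m ℤ.* Q ℤ.- (A Q (ℕ.suc m) ℤ.+ B Q (ℕ.suc m) ℤ.* z) ℤ.+ J)
                     ([[]]-true (_ ≟ _) ≡exc)) w₄≡)

      -- The form takes the value aᵣ at `P∞`, hence a nonzero value at a listed multiple of it; no
      -- estimate of w₃ or w₄ enters.
      aᵣ≢0⇒nonzero : ∃ λ i → dot a (G i) ≢ 0#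
      aᵣ≢0⇒nonzero = proj₁ listed , λ dot≡0 → aᵣ≢0 (begin
        a (fromℕ r)                             ≡⟨ dot-P∞ a ⟨
        dot a (P∞ K r)                          ≡⟨ dot-∼ a {G (proj₁ listed)} {P∞ K r} (proj₂ listed) ⟩
        proj₁ (proj₂ listed) * dot a (G (proj₁ listed)) ≡⟨ cong (proj₁ (proj₂ listed) *_) dot≡0 ⟩
        proj₁ (proj₂ listed) * 0#               ≡⟨ zeroʳ _ ⟩
        0#                                      ∎)
        where listed = P∞-listed G lists 1≤j

    weight≢0⇒nonzero : codeword-weight a ≢ 0ℤ → ∃ λ i → dot a (G i) ≢ 0#
    weight≢0⇒nonzero weight≢0 = by-cases (Fin.any? (λ i → ¬? (dot a (G i) ≟ 0#)))
      where
      by-cases : Dec (∃ λ i → dot a (G i) ≢ 0#) → ∃ λ i → dot a (G i) ≢ 0#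
      by-cases (yes ∃i) = ∃i
      by-cases (no ∄i) = contradiction
        (trans (∑-cong (allFin N) (λ i → [[]]-false (¬? (dot a (G i) ≟ 0#)) (λ ≢0 → ∄i (i , ≢0))))
            (∑-zero (allFin N)))
        weight≢0

  w₁≢0 : w₁ ≢ 0ℤ
  w₁≢0 = ^≢0 (2 ℕ.* r ℕ.∸ 1)

  w₂≢0 : w₂ ≢ 0ℤ
  w₂≢0 eq = ^-injective-< exponents (sym (ℤ.i-j≡0⇒i≡j _ _ eq))
    where
    exponents : 2 ℕ.* r ℕ.∸ 3 ℕ.< 2 ℕ.* r ℕ.∸ 1
    exponents = subst₂ ℕ._<_ (sym (2[2+m]∸3 m)) (sym (2[2+m]∸1 m)) (ℕ.s≤s (ℕ.m≤n+m (1 ℕ.+ (m ℕ.+ m)) 1))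

  -- The second component says that a nonzero form never gives the zero codeword, which is the
  -- linear independence of the rows.
  classify : ∀ a → (∃ λ l → a l ≢ 0#) → codeword-weight a ∈ weights × (∃ λ i → dot a (G i) ≢ 0#)
  classify a (l , aₗ≢0) = by-last (a (fromℕ r) ≟ 0#)
    where
    by-exceptional : (aᵣ≢0 : a (fromℕ r) ≢ 0#) →
      Dec (Tr (aᵣ⁻¹ G lists a aᵣ≢0 * a zero) ≡ exceptional G lists a aᵣ≢0) → codeword-weight a ∈ weights
    by-exceptional aᵣ≢0 (yes ≡exc) = there (there (there (here (codeword-weight≡w₄ a aᵣ≢0 ≡exc))))
    by-exceptional aᵣ≢0 (no ≢exc)  = there (there (here (codeword-weight≡w₃ a aᵣ≢0 ≢exc)))

    by-middle : a (fromℕ r) ≡ 0# → Dec (∃ λ i → a (suc (inject₁ i)) ≢ 0#) →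
      codeword-weight a ∈ weights × (∃ λ i → dot a (G i) ≢ 0#)
    by-middle aᵣ≡0 (yes (i , aᵢ≢0)) =
        there (here (codeword-weight≡w₂ a aᵣ≡0 i aᵢ≢0))
      , weight≢0⇒nonzero a (λ eq → w₂≢0 (trans (sym (codeword-weight≡w₂ a aᵣ≡0 i aᵢ≢0)) eq))
    by-middle aᵣ≡0 (no ∄i) =
        here (codeword-weight≡w₁ a aᵣ≡0 a′≡0 a₀≢0)
      , weight≢0⇒nonzero a (λ eq → w₁≢0 (trans (sym (codeword-weight≡w₁ a aᵣ≡0 a′≡0 a₀≢0)) eq))
      where
      a′≡0 : ∀ i → a (suc (inject₁ i)) ≡ 0#
      a′≡0 i = decidable-stable (a (suc (inject₁ i)) ≟ 0#) (λ ≢0 → ∄i (i , ≢0))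
      a₀≢0 : a zero ≢ 0#
      a₀≢0 a₀≡0 = aₗ≢0 (all-zero l)
        where
        all-zero : ∀ l → a l ≡ 0#
        all-zero zero    = a₀≡0
        all-zero (suc l) = inject₁-fromℕ-elim (ℕ.suc m) (λ i → a (suc i) ≡ 0#) a′≡0 aᵣ≡0 l

    by-last : Dec (a (fromℕ r) ≡ 0#) → codeword-weight a ∈ weights × (∃ λ i → dot a (G i) ≢ 0#)
    by-last (yes aᵣ≡0) = by-middle aᵣ≡0 (Fin.any? (λ i → ¬? (a (suc (inject₁ i)) ≟ 0#)))
    by-last (no aᵣ≢0)  = by-exceptional aᵣ≢0 (_ ≟ _) , aᵣ≢0⇒nonzero a aᵣ≢0

  isWeight : ∀ a {w} → codeword-weight a ≡ w → (∃ λ i → dot a (G i) ≢ 0#) → IsWeight K C w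
  isWeight a ≡w nonzero = (λ i → dot a (G i)) , (a , λ i → refl) , nonzero , trans
      (weight-dot G lists a (λ i → dot a (G i)) (λ i → refl)) ≡w

  isWeight-w₁ : IsWeight K C w₁
  isWeight-w₁ = isWeight a value (weight≢0⇒nonzero a (λ eq → w₁≢0 (trans (sym value) eq)))
    where
    a : Vector Carrier (ℕ.suc r)
    a = 1# Vector.∷ λ _ → 0#
    value : codeword-weight a ≡ w₁
    value = codeword-weight≡w₁ a refl (λ _ → refl) (0≢1 ∘ sym)

  isWeight-w₂ : IsWeight K C w₂
  isWeight-w₂ = isWeight a value (weight≢0⇒nonzero a (λ eq → w₂≢0 (trans (sym value) eq)))
    where
    a : Vector Carrier (ℕ.suc r)
    a = 0# Vector.∷ 1# Vector.∷ λ _ → 0#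
    value : codeword-weight a ≡ w₂
    value = codeword-weight≡w₂ a refl zero (0≢1 ∘ sym)

  private
    hyperplane : Carrier → Vector Carrier (ℕ.suc r)
    hyperplane c = c Vector.∷ snoc (λ _ → 0#) 1#

    last≢0 : ∀ c → hyperplane c (fromℕ r) ≢ 0#
    last≢0 c eq = 0≢1 (trans (sym eq) (snoc-fromℕ {n = ℕ.suc m} (λ _ → 0#) 1#))

    -- The exceptional value depends only on the middle and last coefficients, which `hyperplane c`
    -- does not vary with c; so this value serves every c definitionally.
    γ₀ : Carrier
    γ₀ = exceptional G lists (hyperplane 0#) (last≢0 0#)

    γ₀∈ : γ₀ ∈F
    γ₀∈ = exceptional-∈F G lists (hyperplane 0#) (last≢0 0#)

    last : Carrier
    last = hyperplane 0# (fromℕ r)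

    -- As Tr (γ ε) = γ, the coefficient a₀ = aᵣ γ ε makes γ the right-hand side of the counted equation.
    target : Carrier → Carrier
    target γ = last * (γ * ε)

    Tr-target : ∀ {γ} → γ ∈F → Tr (aᵣ⁻¹ G lists (hyperplane (target γ)) (last≢0 (target γ)) * target γ) ≡ γ
    Tr-target {γ} γ∈ = begin
      Tr (proj₁ last⁻¹ * (last * (γ * ε)))
        ≡⟨ cong Tr (trans (sym (*-assoc _ last _))
             (trans (cong (_* (γ * ε)) (trans (*-comm _ last) (proj₂ last⁻¹))) (*-identityˡ _))) ⟩
      Tr (γ * ε)    ≡⟨ Tr-* ε γ∈ ⟩
      γ * Tr ε      ≡⟨ cong (γ *_) Tr-ε ⟩
      γ * 1#        ≡⟨ *-identityʳ γ ⟩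
      γ             ∎
      where last⁻¹ = inverse last (last≢0 (target γ))

  isWeight-w₃ : IsWeight K C w₃
  isWeight-w₃ = isWeight (hyperplane c)
    (codeword-weight≡w₃ (hyperplane c) (last≢0 c)
      (λ eq → 0≢1 (begin
        0#             ≡⟨ +-self γ₀ ⟨
        γ₀ + γ₀        ≡⟨ cong (_+ γ₀) (trans (sym (Tr-target γ₀+1∈)) eq) ⟨
        γ₀ + 1# + γ₀   ≡⟨ trans (cong (_+ γ₀) (+-comm γ₀ 1#)) (+-involutive γ₀ 1#) ⟩
        1#             ∎)))
    (aᵣ≢0⇒nonzero (hyperplane c) (last≢0 c))
    where
    c = target (γ₀ + 1#)
    γ₀+1∈ : γ₀ + 1# ∈F
    γ₀+1∈ = +-∈F γ₀∈ 1∈F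

  isWeight-w₄ : IsWeight K C w₄
  isWeight-w₄ = isWeight (hyperplane (target γ₀))
    (codeword-weight≡w₄ (hyperplane (target γ₀)) (last≢0 (target γ₀)) (Tr-target γ₀∈))
    (aᵣ≢0⇒nonzero (hyperplane (target γ₀)) (last≢0 (target γ₀)))

  hasWeights : HasWeights K C weights
  hasWeights w = mk⇔ to from
    where
    to : w ∈ weights → IsWeight K C w
    to (here refl)                         = isWeight-w₁
    to (there (here refl))                 = isWeight-w₂
    to (there (there (here refl)))         = isWeight-w₃
    to (there (there (there (here refl)))) = isWeight-w₄
    from : IsWeight K C w → w ∈ weights
    from (v , (a , v≡) , (i , vᵢ≢0) , ≡w) = subst (_∈ weights) (trans (sym (weight-dot G lists a v v≡)) ≡w)
      (proj₁ (classify a (by-cases (Fin.any? (λ l → ¬? (a l ≟ 0#))))))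
      where
      by-cases : Dec (∃ λ l → a l ≢ 0#) → ∃ λ l → a l ≢ 0#
      by-cases (yes ∃l) = ∃l
      by-cases (no ∄l)  = contradiction
        (trans (v≡ i) (sum-zero a (coords K (G i))
            (λ l → decidable-stable (a l ≟ 0#) (λ ≢0 → ∄l (l , ≢0)))))
        vᵢ≢0

  -- The basis consists of the rows of the matrix, independent by `classify`.
  hasDimension : HasDimension K C (r ℕ.+ 1)
  hasDimension = subst (HasDimension K C) (ℕ.+-comm 1 r)
    ( (λ l i → coords K (G i) l)
    , (λ l → (λ l′ → if does (l′ Fin.≟ l) then 1# else 0#) , λ i → trans
        (sym (sum-unit (coords K (G i)) l))
        (sum-cong-≗ (λ l′ → *-comm (coords K (G i) l′) (if does (l′ Fin.≟ l) then 1# else 0#))))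
    , (λ a dot≡0 l → decidable-stable (a l ≟ 0#) (λ aₗ≢0 →
        let (i , dot≢0) = proj₂ (classify a (l , aₗ≢0)) in dot≢0 (dot≡0 i)))
    , (λ v codeword → codeword) )

  HasWeights-resp : ∀ {ws ws′} → (∀ {w} → w ∈ ws → w ∈ ws′) → (∀ {w} → w ∈ ws′ → w ∈ ws) →
    HasWeights K C ws → HasWeights K C ws′
  HasWeights-resp ⊆ ⊇ has w = mk⇔ (Equivalence.to (has w) ∘ ⊇) (⊆ ∘ Equivalence.from (has w))

  unique : ∀ {u} → w₁ ≢ u → w₂ ≢ u → Unique (w₁ ∷ w₂ ∷ u ∷ [])
  unique w₁≢u w₂≢u =
    (w₁≢w₂ All.∷ w₁≢u All.∷ All.[]) AllPairs.∷ (w₂≢u All.∷ All.[]) AllPairs.∷ All.[] AllPairs.∷ AllPairs.[]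
    where
    cancel : ∀ x y → y ≡ x ℤ.- (x ℤ.- y)
    cancel = solve-∀
    w₁≢w₂ : w₁ ≢ w₂
    w₁≢w₂ eq = ^≢0 (2 ℕ.* r ℕ.∸ 3) (trans (cancel E₁ E₃) (ℤ.i≡j⇒i-j≡0 eq))

  -- The values of j that leave exactly three weights

  isWeightCode-w₃ : w₁ ≢ w₃ → w₂ ≢ w₃ → w₄ ∈ w₁ ∷ w₂ ∷ w₃ ∷ [] → IsWeightCode K 3 C
  isWeightCode-w₃ w₁≢w₃ w₂≢w₃ w₄∈ = w₁ ∷ w₂ ∷ w₃ ∷ [] , unique w₁≢w₃ w₂≢w₃ , refl , HasWeights-resp
    (λ { (here eq) → here eq ; (there (here eq)) → there (here eq) ; (there (there (here eq))) → there
        (there (here eq))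
       ; (there (there (there (here refl)))) → w₄∈ })
    (λ { (here eq) → here eq ; (there (here eq)) → there (here eq) ; (there (there (here eq))) → there
        (there (here eq))
       ; (there (there (there ()))) })
    hasWeights

  isWeightCode-w₄ : w₁ ≢ w₄ → w₂ ≢ w₄ → w₃ ∈ w₁ ∷ w₂ ∷ w₄ ∷ [] → IsWeightCode K 3 C
  isWeightCode-w₄ w₁≢w₄ w₂≢w₄ w₃∈ = w₁ ∷ w₂ ∷ w₄ ∷ [] , unique w₁≢w₄ w₂≢w₄ , refl , HasWeights-resp
    (λ { (here eq) → here eq ; (there (here eq)) → there (here eq) ; (there (there (here refl))) → w₃∈
       ; (there (there (there (here eq)))) → there (there (here eq)) })
    (λ { (here eq) → here eq ; (there (here eq)) → there (here eq) ; (there (there (here eq))) → there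
        (there (there (here eq)))
       ; (there (there (there ()))) })
    hasWeights

  private
    P R : ℤ
    P = Q ℤ.^ m
    R = Q ℤ.^ ℕ.suc m

    -- The exponents are r - 1 and 2r - 3. They differ because r ≥ 3; for r = 2 both are 1.
    R≢E₃ : R ≢ E₃
    R≢E₃ = ^-injective-< (subst (ℕ.suc m ℕ.<_) (sym (2[2+m]∸3 m)) (ℕ.s≤s (ℕ.m<m+n m 1≤m)))

    -- As w₃ and w₄ differ by R up to sign, making one of them equal to w₁ or w₂ puts the other at
    -- distance R from it. The remaining possibility w₂ - R would require a negative j.
    data ThirdWeight (u : ℤ) : Set where
      w₂+R : u ≡ E₁ ℤ.- E₃ ℤ.+ R → ThirdWeight u
      w₁-R : u ≡ E₁ ℤ.- R → ThirdWeight u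
      w₁+R : u ≡ E₁ ℤ.+ R → ThirdWeight u

    w₁≢third : ∀ {u} → ThirdWeight u → w₁ ≢ u
    w₁≢third (w₂+R refl) eq = R≢E₃ (sym (ℤ.i-j≡0⇒i≡j E₃ R (trans (cancel E₁ E₃ R) (ℤ.i≡j⇒i-j≡0 eq))))
      where
      cancel : ∀ x y z → y ℤ.- z ≡ x ℤ.- (x ℤ.- y ℤ.+ z)
      cancel = solve-∀
    w₁≢third (w₁-R refl) eq = ^≢0 (ℕ.suc m) (trans (cancel E₁ R) (ℤ.i≡j⇒i-j≡0 eq))
      where
      cancel : ∀ x z → z ≡ x ℤ.- (x ℤ.- z)
      cancel = solve-∀
    w₁≢third (w₁+R refl) eq = ^≢0 (ℕ.suc m) (trans (cancel E₁ R) (ℤ.i≡j⇒i-j≡0 (sym eq)))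
      where
      cancel : ∀ x z → z ≡ x ℤ.+ z ℤ.- x
      cancel = solve-∀

    w₂≢third : ∀ {u} → ThirdWeight u → w₂ ≢ u
    w₂≢third (w₂+R refl) eq = ^≢0 (ℕ.suc m) (trans (cancel w₂ R) (ℤ.i≡j⇒i-j≡0 (sym eq)))
      where
      cancel : ∀ x z → z ≡ x ℤ.+ z ℤ.- x
      cancel = solve-∀
    w₂≢third (w₁-R refl) eq = R≢E₃ (ℤ.i-j≡0⇒i≡j R E₃ (trans (cancel E₁ E₃ R) (ℤ.i≡j⇒i-j≡0 eq)))
      where
      cancel : ∀ x y z → z ℤ.- y ≡ x ℤ.- y ℤ.- (x ℤ.- z)
      cancel = solve-∀
    w₂≢third (w₁+R refl) eq = ^+^≢0 (ℕ.suc m) (2 ℕ.* r ℕ.∸ 3)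
        (trans (cancel E₁ E₃ R) (ℤ.i≡j⇒i-j≡0 (sym eq)))
      where
      cancel : ∀ x y z → z ℤ.+ y ≡ x ℤ.+ z ℤ.- (x ℤ.- y)
      cancel = solve-∀

    third-w₃ : ThirdWeight w₃ → w₄ ∈ w₁ ∷ w₂ ∷ w₃ ∷ [] → IsWeightCode K 3 C
    third-w₃ third = isWeightCode-w₃ (w₁≢third third) (w₂≢third third)

    third-w₄ : ThirdWeight w₄ → w₃ ∈ w₁ ∷ w₂ ∷ w₄ ∷ [] → IsWeightCode K 3 C
    third-w₄ third = isWeightCode-w₄ (w₁≢third third) (w₂≢third third)

    w₃[_,_] w₄[_,_] : ℤ → ℤ → ℤ
    w₃[ s , J ] = E₁ ℤ.- E₃ ℤ.+ s ℤ.* P ℤ.+ J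
    w₄[ s , J ] = E₁ ℤ.- E₃ ℤ.+ s ℤ.* P ℤ.- s ℤ.* R ℤ.+ J

  isWeightCode-odd : s ≡ 1ℤ →
    (J ≡ R ℤ.- P ⊎ J ≡ E₃ ℤ.- P ⊎ J ≡ E₃ ℤ.+ R ℤ.- P) → IsWeightCode K 3 C
  isWeightCode-odd s≡1 (inj₁ J≡) = third-w₃
    (w₂+R (trans (cong₂ w₃[_,_] s≡1 J≡) (w₃-value E₁ E₃ P R)))
    (there (here (trans (cong₂ w₄[_,_] s≡1 J≡) (w₄-value E₁ E₃ P R))))
    where
    w₃-value : ∀ x y z w → x ℤ.- y ℤ.+ 1ℤ ℤ.* z ℤ.+ (w ℤ.- z) ≡ x ℤ.- y ℤ.+ w
    w₃-value = solve-∀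
    w₄-value : ∀ x y z w → x ℤ.- y ℤ.+ 1ℤ ℤ.* z ℤ.- 1ℤ ℤ.* w ℤ.+ (w ℤ.- z) ≡ x ℤ.- y
    w₄-value = solve-∀
  isWeightCode-odd s≡1 (inj₂ (inj₁ J≡)) = third-w₄
    (w₁-R (trans (cong₂ w₄[_,_] s≡1 J≡) (w₄-value E₁ E₃ P R)))
    (here (trans (cong₂ w₃[_,_] s≡1 J≡) (w₃-value E₁ E₃ P)))
    where
    w₃-value : ∀ x y z → x ℤ.- y ℤ.+ 1ℤ ℤ.* z ℤ.+ (y ℤ.- z) ≡ x
    w₃-value = solve-∀
    w₄-value : ∀ x y z w → x ℤ.- y ℤ.+ 1ℤ ℤ.* z ℤ.- 1ℤ ℤ.* w ℤ.+ (y ℤ.- z) ≡ x ℤ.- w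
    w₄-value = solve-∀
  isWeightCode-odd s≡1 (inj₂ (inj₂ J≡)) = third-w₃
    (w₁+R (trans (cong₂ w₃[_,_] s≡1 J≡) (w₃-value E₁ E₃ P R)))
    (here (trans (cong₂ w₄[_,_] s≡1 J≡) (w₄-value E₁ E₃ P R)))
    where
    w₃-value : ∀ x y z w → x ℤ.- y ℤ.+ 1ℤ ℤ.* z ℤ.+ (y ℤ.+ w ℤ.- z) ≡ x ℤ.+ w
    w₃-value = solve-∀
    w₄-value : ∀ x y z w → x ℤ.- y ℤ.+ 1ℤ ℤ.* z ℤ.- 1ℤ ℤ.* w ℤ.+ (y ℤ.+ w ℤ.- z) ≡ x
    w₄-value = solve-∀

  isWeightCode-even : s ≡ ℤ.-1ℤ →
    (J ≡ P ⊎ J ≡ E₃ ℤ.+ P ⊎ J ≡ E₃ ℤ.- R ℤ.+ P) → IsWeightCode K 3 C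
  isWeightCode-even s≡-1 (inj₁ J≡) = third-w₄
    (w₂+R (trans (cong₂ w₄[_,_] s≡-1 J≡) (w₄-value E₁ E₃ P R)))
    (there (here (trans (cong₂ w₃[_,_] s≡-1 J≡) (w₃-value E₁ E₃ P))))
    where
    w₃-value : ∀ x y z → x ℤ.- y ℤ.+ ℤ.-1ℤ ℤ.* z ℤ.+ z ≡ x ℤ.- y
    w₃-value = solve-∀
    w₄-value : ∀ x y z w → x ℤ.- y ℤ.+ ℤ.-1ℤ ℤ.* z ℤ.- ℤ.-1ℤ ℤ.* w ℤ.+ z ≡ x ℤ.- y ℤ.+ w
    w₄-value = solve-∀
  isWeightCode-even s≡-1 (inj₂ (inj₁ J≡)) = third-w₄
    (w₁+R (trans (cong₂ w₄[_,_] s≡-1 J≡) (w₄-value E₁ E₃ P R)))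
    (here (trans (cong₂ w₃[_,_] s≡-1 J≡) (w₃-value E₁ E₃ P)))
    where
    w₃-value : ∀ x y z → x ℤ.- y ℤ.+ ℤ.-1ℤ ℤ.* z ℤ.+ (y ℤ.+ z) ≡ x
    w₃-value = solve-∀
    w₄-value : ∀ x y z w → x ℤ.- y ℤ.+ ℤ.-1ℤ ℤ.* z ℤ.- ℤ.-1ℤ ℤ.* w ℤ.+ (y ℤ.+ z) ≡ x ℤ.+ w
    w₄-value = solve-∀
  isWeightCode-even s≡-1 (inj₂ (inj₂ J≡)) = third-w₃
    (w₁-R (trans (cong₂ w₃[_,_] s≡-1 J≡) (w₃-value E₁ E₃ P R)))
    (here (trans (cong₂ w₄[_,_] s≡-1 J≡) (w₄-value E₁ E₃ P R)))
    where
    w₃-value : ∀ x y z w → x ℤ.- y ℤ.+ ℤ.-1ℤ ℤ.* z ℤ.+ (y ℤ.- w ℤ.+ z) ≡ x ℤ.- w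
    w₃-value = solve-∀
    w₄-value : ∀ x y z w → x ℤ.- y ℤ.+ ℤ.-1ℤ ℤ.* z ℤ.- ℤ.-1ℤ ℤ.* w ℤ.+ (y ℤ.- w ℤ.+ z) ≡ x
    w₄-value = solve-∀

odd-half : ∀ e → e ℕ.% 2 ≡ 1 → (e ℕ.+ 1) ℕ./ 2 ≡ ℕ.suc (e ℕ./ 2)
odd-half e e-odd = begin
  (e ℕ.+ 1) ℕ./ 2                 ≡⟨ cong (ℕ._/ 2) e+1≡ ⟩
  (ℕ.suc (e ℕ./ 2) ℕ.* 2) ℕ./ 2   ≡⟨ ℕ.m*n/n≡m (ℕ.suc (e ℕ./ 2)) 2 ⟩
  ℕ.suc (e ℕ./ 2)                 ∎
  where
  open ≡-Reasoning
  e+1≡ : e ℕ.+ 1 ≡ ℕ.suc (e ℕ./ 2) ℕ.* 2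
  e+1≡ = trans (ℕ.+-comm e 1) (cong ℕ.suc (trans (ℕ.m≡m%n+[m/n]*n e 2) (cong (ℕ._+ e ℕ./ 2 ℕ.* 2) e-odd)))

odd-double-half : ∀ e → e ℕ.% 2 ≡ 1 → ℕ.suc (e ℕ./ 2) ℕ.+ ℕ.suc (e ℕ./ 2) ≡ ℕ.suc e
odd-double-half e e-odd = begin
  ℕ.suc k ℕ.+ ℕ.suc k       ≡⟨ cong (ℕ.suc k ℕ.+_) (sym (ℕ.+-identityʳ (ℕ.suc k))) ⟩
  2 ℕ.* ℕ.suc k             ≡⟨ ℕ.*-comm 2 (ℕ.suc k) ⟩
  ℕ.suc k ℕ.* 2             ≡⟨ cong ℕ.suc (trans (ℕ.m≡m%n+[m/n]*n e 2) (cong (ℕ._+ k ℕ.* 2) e-odd)) ⟨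
  ℕ.suc e                   ∎
  where
  open ≡-Reasoning
  k = e ℕ./ 2

open import Data.Integer using (+_; _+_; _-_; _*_; _^_; -1ℤ)

theorem3p13 :
    (r e j : ℕ) → 3 ≤ r → 3 ≤ e → e % 2 ≡ 1 → 1 ≤ j →
    let q = 2 ℕ.^ e
        Q = + q
        J = + j
        s = -1ℤ ^ (r ∸ 1)
        d = Q ^ (2 ℕ.* r ∸ 1) - Q ^ (2 ℕ.* r ∸ 3)
    in
    (K : FiniteField (q ℕ.^ 2)) (ε : FiniteField.Carrier K) →
    IsParameter K e ε →
    (N : ℕ) (G : Fin N → Point K r) → Lists K G (𝒱̄ K r e ε j) →
    let C = associatedCode K G in
    (N ≡ q ℕ.^ (2 ℕ.* r ∸ 1) ℕ.+ j × HasDimension K C (r ℕ.+ 1)) ×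
    HasWeights K C
      ( Q ^ (2 ℕ.* r ∸ 1)
      ∷ d
      ∷ d + s * Q ^ (r ∸ 2) + J
      ∷ d + s * Q ^ (r ∸ 2) - s * Q ^ (r ∸ 1) + J
      ∷ []) ×
    ((r % 2 ≡ 1 ×
        (J ≡ Q ^ (r ∸ 1) - Q ^ (r ∸ 2)
        ⊎ J ≡ Q ^ (2 ℕ.* r ∸ 3) - Q ^ (r ∸ 2)
        ⊎ J ≡ Q ^ (2 ℕ.* r ∸ 3) + Q ^ (r ∸ 1) - Q ^ (r ∸ 2))
      ⊎
      r % 2 ≡ 0 ×
        (J ≡ Q ^ (r ∸ 2)
        ⊎ J ≡ Q ^ (2 ℕ.* r ∸ 3) + Q ^ (r ∸ 2)
        ⊎ J ≡ Q ^ (2 ℕ.* r ∸ 3) - Q ^ (r ∸ 1) + Q ^ (r ∸ 2))) →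
     IsWeightCode K 3 C)
theorem3p13 (ℕ.suc (ℕ.suc (ℕ.suc m))) e j (ℕ.s≤s (ℕ.s≤s (ℕ.s≤s ℕ.z≤n)))
            3≤e e-odd 1≤j K ε isParameter N G lists =
  (length-N , hasDimension) , hasWeights , λ
    { (inj₁ (r-odd , J≡))  → isWeightCode-odd (Numerics.-1^-even (2 ℕ.+ m) r-odd) J≡
    ; (inj₂ (r-even , J≡)) → isWeightCode-even (Numerics.-1^-odd (2 ℕ.+ m) r-even) J≡ }
  where
  -- Here r = 3 + m is read as 2 + (m + 1), which yields the positivity needed for `R≢E₃`.
  open WeightDistribution e (e ℕ./ 2) (odd-half e e-odd) (odd-double-half e e-odd) K ε isParameter
    {m = ℕ.suc m} (ℕ.s≤s ℕ.z≤n) 1≤j G lists
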